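{- Let $r\ge1$ be a fixed integer and let $\Pi=(\Pi_1,\dots,\Pi_\ell)$ be an $[r]$-pattern with $\ell\ge 2$ in which every color of $[r]$ appears. Consider the randomly $[r]$-colored random graph process $G_0^r,G_1^r,\dots,G_N^r$ on $[n]$ with $\ell\mid n$. Let $$\tau_1=\min\{i: G_i \text{ has minimum degree at least } 1\},\qquad \tau_{\Pi-connected}=\min\{i: G_i^r \text{ is } \Pi\text{ -connected}\}.$$ Then with high probability $\tau_{\Pi-connected}=\tau_1$.
   Context: The colored random graph process: let $N=\binom n2$. $G_0$ is the empty graph on $[n]$ and for $i\in[N]$, $G_i$ is obtained from $G_{i-1}$ by adding an edge $e_i$ chosen uniformly at random among the edges not in $G_{i-1}$; independently, $e_i$ receives a color chosen uniformly at random from $[r]$; $G_i^r$ is $G_i$ with these colors. An $[r]$-pattern is a finite sequence $\Pi=(\Pi_1,\dots,\Pi_\ell)$ with entries in $[r]$, indices taken cyclically ($\Pi_s=\Pi_j$ where $j\equiv s\pmod\ell$). A path with consecutive edges $f_1,\dots,f_k$ is $\Pi$-colored if there is $0\le l\le\ell-1$ such that $f_j$ has color $\Pi_{j+l}$ for all $j\in[k]$. A colored graph is $\Pi$-connected if every two vertices are joined by a $\Pi$-colored path. "With high probability" means with probability tending to $1$ as $n\to\infty$. -}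

module Defs where

open import Data.Nat using (ℕ; zero; suc; _+_; _*_; _^_; _≤_; _<_; _!)
open import Data.Nat.DivMod using (_mod_)
open import Data.Nat.Combinatorics using (_C_)
open import Data.Fin as F using (Fin; toℕ)
open import Data.Vec using (Vec; lookup)
open import Data.Product using (Σ; ∃; _×_; _,_; proj₁; proj₂)
open import Data.Sum using (_⊎_)
open import Data.Empty using (⊥)
open import Data.List using (List; length)
open import Data.List.Relation.Unary.All using (All)
open import Data.List.Relation.Unary.Unique.Propositional using (Unique)
open import Relation.Nullary using (¬_)
open import Relation.Binary.PropositionalEquality using (_≡_)

Npairs : ℕ → ℕ
Npairs n = n C 2

Ordering : ℕ → Set
Ordering n = Vec (Fin n × Fin n) (Npairs n)

-- A raw coloring: the colour of e_{k+1} is the k-th entry.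
Coloring : ℕ → ℕ → Set
Coloring n r = Vec (Fin r) (Npairs n)

-- The sequence is a valid random-graph-process outcome: every entry is a
-- normalised edge u < v, and every edge {a,b} (a < b) occurs.  Since the
-- length is exactly N, this says the sequence is an enumeration of all
-- edges of K_n without repetition.
ValidOrdering : (n : ℕ) → Ordering n → Set
ValidOrdering n σ =
  ((k : Fin (Npairs n)) → proj₁ (lookup σ k) F.< proj₂ (lookup σ k)) ×
  ((a b : Fin n) → a F.< b → ∃ λ (k : Fin (Npairs n)) → lookup σ k ≡ (a , b))

Joins : ∀ {n} → Fin n × Fin n → Fin n → Fin n → Set
Joins (u , v) a b = (u ≡ a × v ≡ b) ⊎ (u ≡ b × v ≡ a)

Endpoint : ∀ {n} → Fin n → Fin n × Fin n → Set
Endpoint x (u , v) = (u ≡ x) ⊎ (v ≡ x)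

MinDeg1 : (n : ℕ) → Ordering n → ℕ → Set
MinDeg1 n σ i = (x : Fin n) → ∃ λ (k : Fin (Npairs n)) → toℕ k < i × Endpoint x (lookup σ k)

PatColor : ∀ {r ℓ} → Vec (Fin r) ℓ → ℕ → Fin r → Set
PatColor {ℓ = zero} Π s c = ⊥
PatColor {ℓ = suc m} Π s c = lookup Π (s mod suc m) ≡ c

Injective : ∀ {A : Set} {m} → (Fin m → A) → Set
Injective f = ∀ i j → f i ≡ f j → i ≡ j

-- A Π-colored path in G_i^r from x to y with k edges:
-- distinct vertices w_0 = x, ..., w_k = y, a shift l ∈ {0,...,ℓ-1}, and for each
-- j < k an edge of G_i (a position p < i) joining w_j and w_{j+1} whose
-- colour is Π_{(j+1)+l} (1-indexed), i.e. entry (j + l) mod ℓ (0-indexed).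
record PiPath {r ℓ : ℕ} (n : ℕ) (Π : Vec (Fin r) ℓ) (σ : Ordering n)
              (c : Coloring n r) (i : ℕ) (x y : Fin n) : Set where
  field
    len   : ℕ
    verts : Fin (suc len) → Fin n
    inj   : Injective verts
    start : verts F.zero ≡ x
    end   : verts (F.fromℕ len) ≡ y
    shift : Fin ℓ
    edge  : (j : Fin len) → Σ (Fin (Npairs n)) λ p →
              toℕ p < i ×
              Joins (lookup σ p) (verts (F.inject₁ j)) (verts (F.suc j)) ×
              PatColor Π (toℕ j + toℕ shift) (lookup c p)

PiConnected : ∀ {r ℓ} (n : ℕ) → Vec (Fin r) ℓ → Ordering n → Coloring n r → ℕ → Set
PiConnected n Π σ c i = (x y : Fin n) → PiPath n Π σ c i x y

IsMinIndex : (N : ℕ) → (ℕ → Set) → ℕ → Set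
IsMinIndex N P i = i ≤ N × P i × ((j : ℕ) → j < i → ¬ P j)

GoodEvent : ∀ {r ℓ} (n : ℕ) → Vec (Fin r) ℓ → Ordering n × Coloring n r → Set
GoodEvent n Π (σ , c) = ∃ λ i →
  IsMinIndex (Npairs n) (MinDeg1 n σ) i × IsMinIndex (Npairs n) (PiConnected n Π σ c) i

-- The outcome space is {valid orderings} × {colorings}, uniform, of size N! * r^N.
-- "P(event) ≥ 1 - 1/(k+1)" is expressed as: there is a duplicate-free list of
-- outcomes, all valid and in the event, of length L with (k+1)*L ≥ k*(N! * r^N).
ProbAtLeast : (n r : ℕ) → (Ordering n × Coloring n r → Set) → ℕ → Set
ProbAtLeast n r E k = ∃ λ (L : List (Ordering n × Coloring n r)) →
  Unique L × All (λ ω → ValidOrdering n (proj₁ ω) × E ω) L ×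
  k * ((Npairs n) ! * r ^ Npairs n) ≤ suc k * length L

{-
Give the edges independent uniform times in a set so large that almost all labellings are injective;
the order of the times is then a uniform ordering of the edges.  Let G₋ and G₊ consist of the edges
of time < m and < 2m, where the edge probability 1/D of G₋ is chosen so that the expected number of
isolated vertices of G₋ is a large constant.  By a second moment estimate G₋ has an isolated vertex,
while G₊ has none, so that G₋ ⊆ G_τ₁ ⊆ G₊ with high probability.

In G₋ every set of about εD vertices has, in each colour, at least CD neighbours, and any two disjoint
sets of sizes CD and n/8ℓ are joined in each colour.  Removing the sets that fail to expand leaves
all but O(εD) vertices in a set W in which every small set expands in every colour.  Computing W with
the edges at a vertex x masked makes it independent of these edges, and a union bound shows that every
x has a neighbour in W at time τ₁: otherwise x has no edge of G₋ to W but an edge of G₊ to the small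
complement of W, and the expected number of such x is O(ε).  Two vertices of low degree with a common
neighbour are excluded in the same way.

Between two vertices x and y a pattern-coloured path is now found deterministically: from their
neighbours in W grow two disjoint trees whose levels follow the pattern, forwards from x and
backwards from y, one vertex at a time, until one depth class modulo ℓ of each tree is large; then
extend one of the trees until the class matching the other modulo ℓ is large, and join the two classes.

Each bad event is represented by the ℕ-valued sum β of its union bound, so that a labelling is good
when all these sums vanish.
-}
{-# OPTIONS --safe #-}
module Submission where

open import Defs
open import Data.Nat hiding (Ordering; compare; less; equal; greater)
open import Data.Nat.Properties
open import Data.Nat.Combinatorics using (nCk+nC[k+1]≡[n+1]C[k+1]; nC1≡n)
open import Data.Nat.Divisibility using (_∣_)
open import Data.Nat.DivMod using (_/_; _%_; _mod_; m≡m%n+[m/n]*n; m%n<n; m%n%n≡m%n; m<n⇒m%n≡m; [m+kn]%n≡m%n; %-distribˡ-+; %-distribˡ-*)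
open import Data.Nat.Tactic.RingSolver using (solve-∀)
open import Data.Bool as Bool using (Bool; true; false; if_then_else_; not; _∧_; _∨_)
import Data.Bool.ListAction as ListAction
open import Data.Bool.Properties using (∨-zeroʳ)
open import Data.Fin as F using (Fin; toℕ)
import Data.Fin.Properties as F
open import Data.Vec as Vec using (Vec; []; _∷_; lookup; _[_]≔_)
open import Data.Vec.Properties using (lookup∘tabulate; tabulate-cong; tabulate∘lookup; lookup-map; lookup-replicate; ∷-injective)
open import Data.List as List using (List; []; _∷_; _++_; map; concatMap; length; allFin; filter; cartesianProduct)
open import Data.List.Properties using (length-map; length-++; length-tabulate; length-filter; map-tabulate)
open import Data.List.Membership.Propositional using (_∈_; _∉_; lose; find)
open import Data.List.Membership.Propositional.Properties using (∈-∃++; ∈-allFin; ∈-filter⁺; ∈-filter⁻; ∈-map⁺; ∈-map⁻; ∈-++⁺ˡ; ∈-++⁺ʳ; ∈-++⁻; ∈-cartesianProduct⁺; ∈-cartesianProduct⁻; ∈-lookup)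
open import Data.List.Relation.Unary.Any as Any using (here; there)
open import Data.List.Relation.Unary.Any.Properties using (lookup-index)
open import Data.List.Relation.Unary.All as All using (All; []; _∷_)
import Data.List.Relation.Unary.All.Properties as Allₚ
open import Data.List.Relation.Unary.AllPairs using ([]; _∷_)
open import Data.List.Relation.Unary.Unique.Propositional using (Unique)
import Data.List.Relation.Unary.Unique.Propositional.Properties as Unique
open import Data.Product using (Σ; ∃; _×_; _,_; proj₁; proj₂; uncurry)
open import Data.Sum using (_⊎_; inj₁; inj₂; [_,_]′)
open import Data.Empty using (⊥; ⊥-elim)
open import Function using (_∘_)
open import Relation.Nullary using (¬_; Dec; yes; no)
open import Relation.Nullary.Decidable using (⌊_⌋; _×-dec_; _⊎-dec_; _→-dec_; ¬?; map′; decidable-stable)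
open import Relation.Binary.Definitions using (tri<; tri≈; tri>)
open import Relation.Binary.PropositionalEquality

-- Finite sums and the product measure

-- The obstacle is the vertices with a single edge at time τ₁. The colour of that edge fixes the
-- pattern position at which a path leaves such a vertex, and the other end prescribes a position in
-- the same way. Since every colour occurs in the pattern, each edge can be given some position; the
-- two trees then have to be brought to compatible residues modulo `ℓ` before they are joined.
--
-- Two scales are balanced. About X₀ w / D vertices have an edge of G₊ into the complement of W but
-- none of G₋ into W, where `w` bounds that complement, so `w` must be a small fraction of `D`;
-- hence expansion is needed already for sets of `d` = `D` / `e` vertices with `e` large. In one
-- colour such a set sees only about a 1 / `y` fraction of all vertices, but this still exceeds the
-- required O(D), because n / D is unbounded. Low-degree pairs with a common neighbour number about
-- n / D², which is why D² ≥ Z n is recorded as well.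
--
-- Sandwiching G_τ₁ lets every estimate concern independent labels. All probabilities are compared
-- as natural numbers with the denominators multiplied out.

private variable
  𝒳 𝒴 : Set

swap₃ : ∀ x y z → x * (y * z) ≡ y * (x * z)
swap₃ = solve-∀

∑ ∏ : List 𝒳 → (𝒳 → ℕ) → ℕ
∑ []       h = 0
∑ (x ∷ xs) h = h x + ∑ xs h
∏ []       h = 1
∏ (x ∷ xs) h = h x * ∏ xs h

∑-cong : (xs : List 𝒳) {g h : 𝒳 → ℕ} → (∀ x → g x ≡ h x) → ∑ xs g ≡ ∑ xs h
∑-cong []       p = refl
∑-cong (x ∷ xs) p = cong₂ _+_ (p x) (∑-cong xs p)

∑-mono-∈ : (xs : List 𝒳) {g h : 𝒳 → ℕ} → (∀ x → x ∈ xs → g x ≤ h x) → ∑ xs g ≤ ∑ xs h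
∑-mono-∈ []       p = z≤n
∑-mono-∈ (x ∷ xs) p = +-mono-≤ (p x (here refl)) (∑-mono-∈ xs (λ y y∈ → p y (there y∈)))

∑-mono : (xs : List 𝒳) {g h : 𝒳 → ℕ} → (∀ x → g x ≤ h x) → ∑ xs g ≤ ∑ xs h
∑-mono xs p = ∑-mono-∈ xs (λ x _ → p x)

∑-+ : (xs : List 𝒳) (g h : 𝒳 → ℕ) → ∑ xs (λ x → g x + h x) ≡ ∑ xs g + ∑ xs h
∑-+ []       g h = refl
∑-+ (x ∷ xs) g h = trans (cong (g x + h x +_) (∑-+ xs g h)) (shuffle (g x) (h x) (∑ xs g) (∑ xs h))
  where
  shuffle : ∀ a b c d → a + b + (c + d) ≡ a + c + (b + d)
  shuffle = solve-∀

∑-*ˡ : (xs : List 𝒳) (c : ℕ) (h : 𝒳 → ℕ) → ∑ xs (λ x → c * h x) ≡ c * ∑ xs h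
∑-*ˡ []       c h = sym (*-zeroʳ c)
∑-*ˡ (x ∷ xs) c h = trans (cong (c * h x +_) (∑-*ˡ xs c h)) (sym (*-distribˡ-+ c (h x) (∑ xs h)))

∑-*ʳ : (xs : List 𝒳) (h : 𝒳 → ℕ) (c : ℕ) → ∑ xs (λ x → h x * c) ≡ ∑ xs h * c
∑-*ʳ xs h c = trans (∑-cong xs (λ x → *-comm (h x) c)) (trans (∑-*ˡ xs c h) (*-comm c _))

∑-const : (xs : List 𝒳) (c : ℕ) → ∑ xs (λ _ → c) ≡ length xs * c
∑-const []       c = refl
∑-const (x ∷ xs) c = cong (c +_) (∑-const xs c)

∑-swap : (xs : List 𝒳) (ys : List 𝒴) (h : 𝒳 → 𝒴 → ℕ) →
         ∑ xs (λ x → ∑ ys (h x)) ≡ ∑ ys (λ y → ∑ xs (λ x → h x y))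
∑-swap []       ys h = sym (trans (∑-const ys 0) (*-zeroʳ (length ys)))
∑-swap (x ∷ xs) ys h = trans (cong (∑ ys (h x) +_) (∑-swap xs ys h)) (sym (∑-+ ys _ _))

∑-++ : (xs ys : List 𝒳) (h : 𝒳 → ℕ) → ∑ (xs ++ ys) h ≡ ∑ xs h + ∑ ys h
∑-++ []       ys h = refl
∑-++ (x ∷ xs) ys h = trans (cong (h x +_) (∑-++ xs ys h)) (sym (+-assoc (h x) _ _))

∑-map : (f : 𝒳 → 𝒴) (xs : List 𝒳) (h : 𝒴 → ℕ) → ∑ (map f xs) h ≡ ∑ xs (h ∘ f)
∑-map f []       h = refl
∑-map f (x ∷ xs) h = cong (h (f x) +_) (∑-map f xs h)

∑-concatMap : (f : 𝒳 → List 𝒴) (xs : List 𝒳) (h : 𝒴 → ℕ) → ∑ (concatMap f xs) h ≡ ∑ xs (λ x → ∑ (f x) h)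
∑-concatMap f []       h = refl
∑-concatMap f (x ∷ xs) h = trans (∑-++ (f x) _ h) (cong (∑ (f x) h +_) (∑-concatMap f xs h))

∑-cartesianProduct : (xs : List 𝒳) (ys : List 𝒴) (h : 𝒳 × 𝒴 → ℕ) →
                     ∑ (cartesianProduct xs ys) h ≡ ∑ xs (λ x → ∑ ys (λ y → h (x , y)))
∑-cartesianProduct []       ys h = refl
∑-cartesianProduct (x ∷ xs) ys h =
  trans (∑-++ (map (x ,_) ys) _ h) (cong₂ _+_ (∑-map (x ,_) ys h) (∑-cartesianProduct xs ys h))

∈-≤∑ : {xs : List 𝒳} {x : 𝒳} (h : 𝒳 → ℕ) → x ∈ xs → h x ≤ ∑ xs h
∈-≤∑ h (here refl) = m≤m+n _ _
∈-≤∑ h (there {x = y} p) = ≤-trans (∈-≤∑ h p) (m≤n+m _ (h y))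

∑≡0⇒ : {xs : List 𝒳} {x : 𝒳} (h : 𝒳 → ℕ) → ∑ xs h ≡ 0 → x ∈ xs → h x ≡ 0
∑≡0⇒ h e x∈ = n≤0⇒n≡0 (subst (_ ≤_) e (∈-≤∑ h x∈))

length≡∑1 : (xs : List 𝒳) → length xs ≡ ∑ xs (λ _ → 1)
length≡∑1 xs = sym (trans (∑-const xs 1) (*-identityʳ _))

∏-++ : (xs ys : List 𝒳) (h : 𝒳 → ℕ) → ∏ (xs ++ ys) h ≡ ∏ xs h * ∏ ys h
∏-++ []       ys h = sym (+-identityʳ _)
∏-++ (x ∷ xs) ys h = trans (cong (h x *_) (∏-++ xs ys h)) (sym (*-assoc (h x) _ _))

∏≡0⇒ : (xs : List 𝒳) (h : 𝒳 → ℕ) → ∏ xs h ≡ 0 → ∃ λ x → x ∈ xs × h x ≡ 0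
∏≡0⇒ (x ∷ xs) h e with m*n≡0⇒m≡0∨n≡0 (h x) e
... | inj₁ p = x , here refl , p
... | inj₂ p = let (y , y∈ , q) = ∏≡0⇒ xs h p in y , there y∈ , q

∏-cong : (xs : List 𝒳) {g h : 𝒳 → ℕ} → (∀ x → x ∈ xs → g x ≡ h x) → ∏ xs g ≡ ∏ xs h
∏-cong []       p = refl
∏-cong (x ∷ xs) p = cong₂ _*_ (p x (here refl)) (∏-cong xs (λ y y∈ → p y (there y∈)))

∏≤1 : (xs : List 𝒳) (h : 𝒳 → ℕ) → (∀ x → h x ≤ 1) → ∏ xs h ≤ 1
∏≤1 []       h p = ≤-refl
∏≤1 (x ∷ xs) h p = *-mono-≤ (p x) (∏≤1 xs h p)

-- Each term of the small sum uses up its own term of the big one.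
∑-inject : (zs : List 𝒳) (ys : List 𝒴) (F : 𝒳 → 𝒴) (h : 𝒴 → ℕ) → Unique zs →
           (∀ {z z'} → z ∈ zs → z' ∈ zs → F z ≡ F z' → z ≡ z') → (∀ {z} → z ∈ zs → F z ∈ ys) →
           ∑ zs (h ∘ F) ≤ ∑ ys h
∑-inject []       ys F h u inj sub = z≤n
∑-inject (z ∷ zs) ys F h (z∉ ∷ u) inj sub with ∈-∃++ (sub (here refl))
... | as , bs , refl = ≤-trans
        (+-monoʳ-≤ (h (F z)) (∑-inject zs (as ++ bs) F h u (λ p q → inj (there p) (there q)) sub'))
        (≤-reflexive (trans (cong (h (F z) +_) (∑-++ as bs h))
           (trans (shuffle (h (F z)) (∑ as h) (∑ bs h)) (sym (∑-++ as (F z ∷ bs) h)))))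
  where
  shuffle : ∀ a b c → a + (b + c) ≡ b + (a + c)
  shuffle = solve-∀
  sub' : ∀ {y} → y ∈ zs → F y ∈ as ++ bs
  sub' {y} y∈ with ∈-++⁻ as (sub (there y∈))
  ... | inj₁ p = ∈-++⁺ˡ p
  ... | inj₂ (here e) = ⊥-elim (All.lookup z∉ y∈ (sym (inj (there y∈) (here refl) e)))
  ... | inj₂ (there p) = ∈-++⁺ʳ as p

allVecs : List 𝒳 → (n : ℕ) → List (Vec 𝒳 n)
allVecs xs zero    = [] ∷ []
allVecs xs (suc n) = concatMap (λ x → map (x ∷_) (allVecs xs n)) xs

∑-allVecs : (xs : List 𝒳) (n : ℕ) (h : Vec 𝒳 (suc n) → ℕ) →
            ∑ (allVecs xs (suc n)) h ≡ ∑ xs (λ x → ∑ (allVecs xs n) (λ v → h (x ∷ v)))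
∑-allVecs xs n h = trans (∑-concatMap _ xs h) (∑-cong xs (λ x → ∑-map (x ∷_) (allVecs xs n) h))

length-allVecs : (xs : List 𝒳) (n : ℕ) → length (allVecs xs n) ≡ length xs ^ n
length-allVecs xs zero    = refl
length-allVecs xs (suc n) = trans (length≡∑1 (allVecs xs (suc n))) (trans (∑-allVecs xs n _)
  (trans (∑-cong xs (λ _ → trans (sym (length≡∑1 (allVecs xs n))) (length-allVecs xs n))) (∑-const xs _)))

∈-concatMap : {f : 𝒳 → List 𝒴} {xs : List 𝒳} {x : 𝒳} {y : 𝒴} → x ∈ xs → y ∈ f x → y ∈ concatMap f xs
∈-concatMap (here refl) q = ∈-++⁺ˡ q
∈-concatMap {f = f} (there {x = z} p) q = ∈-++⁺ʳ (f z) (∈-concatMap p q)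

∈-concatMap⁻ : (f : 𝒳 → List 𝒴) (xs : List 𝒳) {y : 𝒴} → y ∈ concatMap f xs → ∃ λ x → x ∈ xs × y ∈ f x
∈-concatMap⁻ f (x ∷ xs) p with ∈-++⁻ (f x) p
... | inj₁ q = x , here refl , q
... | inj₂ q = let (z , z∈ , r) = ∈-concatMap⁻ f xs q in z , there z∈ , r

∈-allVecs : {xs : List 𝒳} {n : ℕ} (v : Vec 𝒳 n) → (∀ i → lookup v i ∈ xs) → v ∈ allVecs xs n
∈-allVecs []      p = here refl
∈-allVecs (x ∷ v) p = ∈-concatMap (p F.zero) (∈-map⁺ (x ∷_) (∈-allVecs v (λ i → p (F.suc i))))

∑-∏-allVecs : (xs : List 𝒳) (n : ℕ) (g : 𝒳 → ℕ) →
              ∑ (allVecs xs n) (λ v → ∏ (Vec.toList v) g) ≡ ∑ xs g ^ n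
∑-∏-allVecs xs zero    g = refl
∑-∏-allVecs xs (suc n) g = trans (∑-allVecs xs n _)
  (trans (∑-cong xs (λ x → trans (∑-*ˡ (allVecs xs n) (g x) _) (cong (g x *_) (∑-∏-allVecs xs n g))))
         (∑-*ʳ xs g _))

IndepOf : {n : ℕ} → (Vec 𝒳 n → ℕ) → Fin n → Set
IndepOf φ e = ∀ v x → φ (v [ e ]≔ x) ≡ φ v

-- Summing over coordinate `e` first, `φ` is constant and the sum of `g` factors out. This is E[φ g]
-- = E[g] E[φ], cleared of denominators.
∑-indep-factor : (xs : List 𝒳) {n : ℕ} (e : Fin n) (φ : Vec 𝒳 n → ℕ) (g : 𝒳 → ℕ) → IndepOf φ e →
  length xs * ∑ (allVecs xs n) (λ v → φ v * g (lookup v e)) ≡ ∑ xs g * ∑ (allVecs xs n) φ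
∑-indep-factor {𝒳 = 𝒳} xs {suc n} F.zero φ g ind = begin
  length xs * ∑ (allVecs xs (suc n)) (λ v → φ v * g (lookup v F.zero))
    ≡⟨ cong (length xs *_) (trans (∑-allVecs xs n _) (∑-cong xs (λ x → trans (∑-*ʳ (allVecs xs n) _ (g x)) (*-comm (S x) (g x))))) ⟩
  length xs * ∑ xs (λ x → g x * S x) ≡⟨ ∑-const xs _ ⟨
  ∑ xs (λ _ → ∑ xs (λ x → g x * S x)) ≡⟨ ∑-cong xs (λ y → ∑-cong xs (λ x → cong (g x *_) (S-const x y))) ⟩
  ∑ xs (λ y → ∑ xs (λ x → g x * S y)) ≡⟨ ∑-cong xs (λ y → ∑-*ʳ xs g (S y)) ⟩
  ∑ xs (λ y → ∑ xs g * S y) ≡⟨ ∑-*ˡ xs (∑ xs g) S ⟩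
  ∑ xs g * ∑ xs S ≡⟨ cong (∑ xs g *_) (∑-allVecs xs n φ) ⟨
  ∑ xs g * ∑ (allVecs xs (suc n)) φ ∎
  where
  open ≡-Reasoning
  S : 𝒳 → ℕ
  S x = ∑ (allVecs xs n) (λ v → φ (x ∷ v))
  S-const : ∀ x y → S x ≡ S y
  S-const x y = ∑-cong (allVecs xs n) (λ v → ind (y ∷ v) x)
∑-indep-factor xs {suc n} (F.suc e) φ g ind = begin
  length xs * ∑ (allVecs xs (suc n)) (λ v → φ v * g (lookup v (F.suc e)))
    ≡⟨ cong (length xs *_) (∑-allVecs xs n _) ⟩
  length xs * ∑ xs (λ x → ∑ (allVecs xs n) (λ v → φ (x ∷ v) * g (lookup v e)))
    ≡⟨ ∑-*ˡ xs (length xs) _ ⟨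
  ∑ xs (λ x → length xs * ∑ (allVecs xs n) (λ v → φ (x ∷ v) * g (lookup v e)))
    ≡⟨ ∑-cong xs (λ x → ∑-indep-factor xs e (λ v → φ (x ∷ v)) g (λ v y → ind (x ∷ v) y)) ⟩
  ∑ xs (λ x → ∑ xs g * ∑ (allVecs xs n) (λ v → φ (x ∷ v)))
    ≡⟨ ∑-*ˡ xs (∑ xs g) _ ⟩
  ∑ xs g * ∑ xs (λ x → ∑ (allVecs xs n) (λ v → φ (x ∷ v)))
    ≡⟨ cong (∑ xs g *_) (∑-allVecs xs n φ) ⟨
  ∑ xs g * ∑ (allVecs xs (suc n)) φ ∎
  where open ≡-Reasoning

lookup-update-≢ : {n : ℕ} {i j : Fin n} → i ≢ j → (v : Vec 𝒳 n) (x : 𝒳) → lookup (v [ j ]≔ x) i ≡ lookup v i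
lookup-update-≢ {i = F.zero}  {F.zero}  i≢j v       x = ⊥-elim (i≢j refl)
lookup-update-≢ {i = F.zero}  {F.suc j} i≢j (y ∷ v) x = refl
lookup-update-≢ {i = F.suc i} {F.zero}  i≢j (y ∷ v) x = refl
lookup-update-≢ {i = F.suc i} {F.suc j} i≢j (y ∷ v) x = lookup-update-≢ (i≢j ∘ cong F.suc) v x

∏-indep : {n : ℕ} (D : List (Fin n)) (g : 𝒳 → ℕ) {e : Fin n} → All (e ≢_) D →
          IndepOf (λ v → ∏ D (λ i → g (lookup v i))) e
∏-indep D g ∉D v x = ∏-cong D (λ i i∈ → cong g (lookup-update-≢ (≢-sym (All.lookup ∉D i∈)) v x))

*-indep : {n : ℕ} {φ ψ : Vec 𝒳 n → ℕ} {e : Fin n} → IndepOf φ e → IndepOf ψ e → IndepOf (λ v → φ v * ψ v) e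
*-indep p q v x = cong₂ _*_ (p v x) (q v x)

∑-density₁ : (xs : List 𝒳) {n : ℕ} (e : Fin n) (φ : Vec 𝒳 n → ℕ) (g : 𝒳 → ℕ) (a b : ℕ) →
  .{{NonZero (length xs)}} → b * ∑ xs g ≡ a * length xs → IndepOf φ e →
  b * ∑ (allVecs xs n) (λ v → φ v * g (lookup v e)) ≡ a * ∑ (allVecs xs n) φ
∑-density₁ xs {n} e φ g a b dens ind = *-cancelˡ-≡ _ _ (length xs) (begin
  L * (b * S) ≡⟨ swap₃ L b S ⟩
  b * (L * S) ≡⟨ cong (b *_) (∑-indep-factor xs e φ g ind) ⟩
  b * (∑ xs g * T) ≡⟨ *-assoc b (∑ xs g) T ⟨
  b * ∑ xs g * T ≡⟨ cong (_* T) dens ⟩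
  a * L * T ≡⟨ rot a L T ⟩
  L * (a * T)            ∎)
  where
  open ≡-Reasoning
  L = length xs
  S = ∑ (allVecs xs n) (λ v → φ v * g (lookup v e))
  T = ∑ (allVecs xs n) φ
  rot : ∀ x y z → x * y * z ≡ y * (x * z)
  rot = solve-∀

-- The hypothesis on `a` and `b` says that `g` has mean a/b. The coordinates in `D` are split off
-- one at a time; the factors at the remaining ones are absorbed into `φ`, which stays independent
-- of the current coordinate because `D` has no repetitions.
∑-density : (xs : List 𝒳) {n : ℕ} (D : List (Fin n)) (φ : Vec 𝒳 n → ℕ) (g : 𝒳 → ℕ) (a b : ℕ) →
  .{{NonZero (length xs)}} → b * ∑ xs g ≡ a * length xs → Unique D → All (IndepOf φ) D →
  b ^ length D * ∑ (allVecs xs n) (λ v → φ v * ∏ D (λ i → g (lookup v i))) ≡ a ^ length D * ∑ (allVecs xs n) φ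
∑-density xs []      φ g a b dens u ind =
  trans (+-identityʳ _) (trans (∑-cong (allVecs xs _) (λ v → *-identityʳ (φ v))) (sym (+-identityʳ _)))
∑-density xs {n} (e ∷ D) φ g a b dens (e∉ ∷ u) (i ∷ ind) = begin
  b * b ^ length D * ∑ V (λ v → φ v * (g (lookup v e) * P v))
    ≡⟨ cong (b * b ^ length D *_) (∑-cong V (λ v → move (φ v) (g (lookup v e)) (P v))) ⟩
  b * b ^ length D * ∑ V (λ v → φ v * P v * g (lookup v e))
    ≡⟨ rot b (b ^ length D) _ ⟩
  b ^ length D * (b * ∑ V (λ v → φ v * P v * g (lookup v e)))
    ≡⟨ cong (b ^ length D *_) (∑-density₁ xs e (λ v → φ v * P v) g a b dens (*-indep i (∏-indep D g e∉))) ⟩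
  b ^ length D * (a * ∑ V (λ v → φ v * P v))
    ≡⟨ swap₃ (b ^ length D) a _ ⟩
  a * (b ^ length D * ∑ V (λ v → φ v * P v))
    ≡⟨ cong (a *_) (∑-density xs D φ g a b dens u ind) ⟩
  a * (a ^ length D * ∑ V φ)
    ≡⟨ *-assoc a _ _ ⟨
  a * a ^ length D * ∑ V φ ∎
  where
  open ≡-Reasoning
  V = allVecs xs n
  P : Vec _ n → ℕ
  P v = ∏ D (λ i → g (lookup v i))
  move : ∀ x y z → x * (y * z) ≡ x * z * y
  move = solve-∀
  rot : ∀ x y z → x * y * z ≡ y * (x * z)
  rot = solve-∀

χ : Bool → ℕ
χ true  = 1
χ false = 0

χ≤1 : ∀ b → χ b ≤ 1
χ≤1 true  = ≤-refl
χ≤1 false = z≤n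

VSet : ℕ → Set
VSet n = Fin n → Bool

card : {n : ℕ} → VSet n → ℕ
card {n} P = ∑ (allFin n) (χ ∘ P)

members : {n : ℕ} → VSet n → List (Fin n)
members {n} P = filter (λ v → P v Bool.≟ true) (allFin n)

∈-members⁺ : {n : ℕ} (P : VSet n) {v : Fin n} → P v ≡ true → v ∈ members P
∈-members⁺ P {v} p = ∈-filter⁺ (λ v → P v Bool.≟ true) (∈-allFin v) p

∈-members⁻ : {n : ℕ} (P : VSet n) {v : Fin n} → v ∈ members P → P v ≡ true
∈-members⁻ {n} P p = proj₂ (∈-filter⁻ (λ v → P v Bool.≟ true) {xs = allFin n} p)

members-unique : {n : ℕ} (P : VSet n) → Unique (members P)
members-unique {n} P = Unique.filter⁺ _ (Unique.allFin⁺ n)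

length-filter-χ : (P : 𝒳 → Bool) (xs : List 𝒳) → length (filter (λ x → P x Bool.≟ true) xs) ≡ ∑ xs (χ ∘ P)
length-filter-χ P []       = refl
length-filter-χ P (x ∷ xs) with P x
... | true  = cong suc (length-filter-χ P xs)
... | false = length-filter-χ P xs

length-members : {n : ℕ} (P : VSet n) → length (members P) ≡ card P
length-members {n} P = length-filter-χ P (allFin n)

length-allFin : ∀ n → length (allFin n) ≡ n
length-allFin n = length-tabulate {n = n} (λ i → i)

∑-χ-∈ : {n : ℕ} (xs : List (Fin n)) (P : VSet n) → Unique xs → (∀ v → P v ≡ true → v ∈ xs) → card P ≤ length xs
∑-χ-∈ {n} xs P u sub = ≤-trans (≤-reflexive (sym (length-members P)))
  (≤-trans (≤-reflexive (length≡∑1 (members P)))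
  (≤-trans (∑-inject (members P) xs (λ v → v) (λ _ → 1) (members-unique P) (λ _ _ e → e) (λ v∈ → sub _ (∈-members⁻ P v∈)))
           (≤-reflexive (sym (length≡∑1 xs)))))

Unique-map : {f : 𝒳 → 𝒴} {xs : List 𝒳} → (∀ {x y} → x ∈ xs → y ∈ xs → f x ≡ f y → x ≡ y) → Unique xs → Unique (map f xs)
Unique-map {xs = []}     inj []       = []
Unique-map {xs = x ∷ xs} inj (x∉ ∷ u) =
  Allₚ.map⁺ (All.tabulate (λ {y} y∈ e → All.lookup x∉ y∈ (inj (here refl) (there y∈) e)))
  ∷ Unique-map (λ p q → inj (there p) (there q)) u

-- The threshold probability

-- Bernoulli's inequality (1 + b/a)^h ≥ 1 + h b/a, multiplied by a^(h+1).
bernoulli⁺ : ∀ a b h → a ^ h * (a + h * b) ≤ (a + b) ^ h * a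
bernoulli⁺ a b zero    = ≤-reflexive (cong (1 *_) (+-identityʳ a))
bernoulli⁺ a b (suc h) = begin
  a * a ^ h * (a + (b + h * b)) ≡⟨ split a (a ^ h) b (h * b) ⟩
  a * (a ^ h * (a + h * b)) + a ^ h * (a * b) ≤⟨ +-mono-≤ (*-monoʳ-≤ a (bernoulli⁺ a b h)) (*-monoˡ-≤ (a * b) (^-monoˡ-≤ h (m≤m+n a b))) ⟩
  a * ((a + b) ^ h * a) + (a + b) ^ h * (a * b) ≡⟨ join a b ((a + b) ^ h) ⟩
  (a + b) * (a + b) ^ h * a ∎
  where
  open ≤-Reasoning
  split : ∀ a x b c → a * x * (a + (b + c)) ≡ a * (x * (a + c)) + x * (a * b)
  split = solve-∀
  join : ∀ a b y → a * (y * a) + y * (a * b) ≡ (a + b) * y * a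
  join = solve-∀

-- Bernoulli's inequality (1 - b/(a+b))^h ≥ 1 - h b/(a+b), multiplied by (a+b)^(h+1), with the
-- negative term moved across.
bernoulli⁻ : ∀ a b h → (a + b) ^ h * (a + b) ≤ a ^ h * (a + b) + h * b * (a + b) ^ h
bernoulli⁻ a b zero    = m≤m+n _ _
bernoulli⁻ a b (suc h) = begin
  (a + b) * (a + b) ^ h * (a + b) ≡⟨ split a b y ⟩
  a * (y * (a + b)) + b * ((a + b) * y) ≤⟨ +-monoˡ-≤ _ (*-monoʳ-≤ a (bernoulli⁻ a b h)) ⟩
  a * (x * (a + b) + h * b * y) + b * ((a + b) * y) ≡⟨ mid a b x y (h * b) ⟩
  a * x * (a + b) + h * b * (a * y) + b * ((a + b) * y) ≤⟨ +-monoˡ-≤ (b * ((a + b) * y)) (+-monoʳ-≤ (a * x * (a + b)) (*-monoʳ-≤ (h * b) (*-monoˡ-≤ y (m≤m+n a b)))) ⟩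
  a * x * (a + b) + h * b * ((a + b) * y) + b * ((a + b) * y) ≡⟨ join (a * x * (a + b)) (h * b) b ((a + b) * y) ⟩
  a * a ^ h * (a + b) + (b + h * b) * ((a + b) * (a + b) ^ h) ∎
  where
  open ≤-Reasoning
  x = a ^ h
  y = (a + b) ^ h
  split : ∀ a b y → (a + b) * y * (a + b) ≡ a * (y * (a + b)) + b * ((a + b) * y)
  split = solve-∀
  mid : ∀ a b x y c → a * (x * (a + b) + c * y) + b * ((a + b) * y) ≡ a * x * (a + b) + c * (a * y) + b * ((a + b) * y)
  mid = solve-∀
  join : ∀ p c b z → p + c * z + b * z ≡ p + (b + c) * z
  join = solve-∀

-- The loss h b/(a+b) in `bernoulli⁻` is at most one half.
^-≤-double : ∀ a b h .{{_ : NonZero (a + b)}} → 2 * (h * b) ≤ a + b → (a + b) ^ h ≤ 2 * a ^ h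
^-≤-double a b h le = *-cancelʳ-≤ _ _ (a + b) (+-cancelʳ-≤ (y * (a + b)) _ _ (begin
  y * (a + b) + y * (a + b) ≡⟨ dbl (y * (a + b)) ⟩
  2 * (y * (a + b)) ≤⟨ *-monoʳ-≤ 2 (bernoulli⁻ a b h) ⟩
  2 * (x * (a + b) + h * b * y) ≡⟨ expand x (a + b) (h * b) y ⟩
  2 * x * (a + b) + y * (2 * (h * b)) ≤⟨ +-monoʳ-≤ _ (*-monoʳ-≤ y le) ⟩
  2 * x * (a + b) + y * (a + b) ∎))
  where
  open ≤-Reasoning
  x = a ^ h
  y = (a + b) ^ h
  dbl : ∀ z → z + z ≡ 2 * z
  dbl = solve-∀
  expand : ∀ x c h y → 2 * (x * c + h * y) ≡ 2 * x * c + y * (2 * h)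
  expand = solve-∀

^-distrib-* : ∀ a b n → (a * b) ^ n ≡ a ^ n * b ^ n
^-distrib-* a b zero    = refl
^-distrib-* a b (suc n) = trans (cong (a * b *_) (^-distrib-* a b n)) (shuffle a b (a ^ n) (b ^ n))
  where
  shuffle : ∀ a b x y → a * b * (x * y) ≡ a * x * (b * y)
  shuffle = solve-∀

-- For a ≤ b the ratio (a/b)^m decreases in m; this is its form without division.
^-ratio-mono : ∀ {a b m n} → a ≤ b → m ≤ n → a ^ n * b ^ m ≤ a ^ m * b ^ n
^-ratio-mono {a} {b} {m} a≤b m≤n with m≤n⇒∃[o]m+o≡n m≤n
... | k , refl = begin
  a ^ (m + k) * b ^ m ≡⟨ cong (_* b ^ m) (^-distribˡ-+-* a m k) ⟩
  a ^ m * a ^ k * b ^ m ≤⟨ *-monoˡ-≤ (b ^ m) (*-monoʳ-≤ (a ^ m) (^-monoˡ-≤ k a≤b)) ⟩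
  a ^ m * b ^ k * b ^ m ≡⟨ shuffle (a ^ m) (b ^ k) (b ^ m) ⟩
  a ^ m * (b ^ m * b ^ k) ≡⟨ cong (a ^ m *_) (^-distribˡ-+-* b m k) ⟨
  a ^ m * b ^ (m + k) ∎
  where
  open ≤-Reasoning
  shuffle : ∀ x y z → x * y * z ≡ x * (z * y)
  shuffle = solve-∀

^-pos : ∀ a n .{{_ : NonZero a}} → NonZero (a ^ n)
^-pos a n = m^n≢0 a n

≤-minimal : (P : ℕ → Set) → (∀ j → Dec (P j)) → ∀ m → P m →
            ∃ λ j → j ≤ m × P j × (∀ i → i < j → ¬ P i)
≤-minimal P P? zero    p = 0 , z≤n , p , λ i ()
≤-minimal P P? (suc m) p with P? 0
... | yes p₀ = 0 , z≤n , p₀ , λ i ()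
... | no ¬p₀ with ≤-minimal (P ∘ suc) (P? ∘ suc) m p
...   | j , j≤ , pj , least = suc j , s≤s j≤ , pj , λ { zero _ → ¬p₀ ; (suc i) (s≤s i<j) → least i i<j }

-- The last hypothesis reads (1 - 1/D)^n' ≥ X₀/n, so that D cannot be too small.
D²-large : ∀ {X₀ n' D'} Z → 1 ≤ X₀ → 4 ≤ n' → Z * Z * 4096 ≤ suc n' →
           X₀ * suc D' ^ n' ≤ suc n' * D' ^ n' → Z * suc n' ≤ suc D' * suc D'
D²-large {X₀} {n'} {D'} Z 1≤X₀ 4≤n' big T1 = ≮⇒≥ λ D²<Zn → <⇒≱ (contra D²<Zn) big
  where
  open ≤-Reasoning
  n = suc n' ; D = suc D'
  -- Bernoulli on blocks of length `s`, raised to the fourth power, gives n³ ≤ 4096 D⁴ and so D² of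
  -- order n^(3/2). A second power would only give D² of order n, without the free factor `Z`.
  s = n' / 4
  n'-div : n' ≡ n' % 4 + s * 4
  n'-div = m≡m%n+[m/n]*n n' 4
  4s≤n' : 4 * s ≤ n'
  4s≤n' = ≤-trans (m≤n+m (4 * s) (n' % 4)) (≤-reflexive (trans (cong (n' % 4 +_) (*-comm 4 s)) (sym n'-div)))
  s≥1 : 1 ≤ s
  s≥1 with n' / 4 | n'-div
  ... | suc _ | _ = s≤s z≤n
  ... | zero  | q = ⊥-elim (<⇒≱ (subst (_< 4) (sym (trans q (+-identityʳ _))) (m%n<n n' 4)) 4≤n')
  n≤8s : n ≤ 8 * s
  n≤8s = begin
    suc n' ≡⟨ cong suc n'-div ⟩
    suc (n' % 4) + s * 4 ≤⟨ +-monoˡ-≤ (s * 4) (m%n<n n' 4) ⟩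
    4 + s * 4 ≤⟨ +-monoˡ-≤ (s * 4) (*-monoʳ-≤ 4 s≥1) ⟩
    4 * s + s * 4 ≡⟨ eq s ⟩
    8 * s ∎
    where
    eq : ∀ s → 4 * s + s * 4 ≡ 8 * s
    eq = solve-∀
  -- (1 + 1/D')^{4s} ≥ (1 + s/D')^4.
  bern : D' ^ (s * 4) * s ^ 4 ≤ D ^ (s * 4) * D ^ 4
  bern = begin
    D' ^ (s * 4) * s ^ 4 ≡⟨ cong (_* s ^ 4) (^-*-assoc D' s 4) ⟨
    (D' ^ s) ^ 4 * s ^ 4 ≡⟨ ^-distrib-* (D' ^ s) s 4 ⟨
    (D' ^ s * s) ^ 4 ≤⟨ ^-monoˡ-≤ 4 (*-monoʳ-≤ (D' ^ s) (≤-trans (≤-reflexive (sym (*-identityʳ s))) (m≤n+m (s * 1) D'))) ⟩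
    (D' ^ s * (D' + s * 1)) ^ 4 ≤⟨ ^-monoˡ-≤ 4 (bernoulli⁺ D' 1 s) ⟩
    ((D' + 1) ^ s * D') ^ 4 ≤⟨ ^-monoˡ-≤ 4 (*-monoʳ-≤ ((D' + 1) ^ s) (n≤1+n D')) ⟩
    ((D' + 1) ^ s * D) ^ 4 ≡⟨ cong (λ z → (z ^ s * D) ^ 4) (+-comm D' 1) ⟩
    (D ^ s * D) ^ 4 ≡⟨ ^-distrib-* (D ^ s) D 4 ⟩
    (D ^ s) ^ 4 * D ^ 4 ≡⟨ cong (_* D ^ 4) (^-*-assoc D s 4) ⟩
    D ^ (s * 4) * D ^ 4 ∎
  s⁴≤ : s ^ 4 ≤ n * D ^ 4
  s⁴≤ = *-cancelˡ-≤ (D ^ n') {{^-pos D n'}} (*-cancelˡ-≤ (D ^ (s * 4)) {{^-pos D (s * 4)}} (begin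
    D ^ (s * 4) * (D ^ n' * s ^ 4) ≤⟨ *-monoʳ-≤ (D ^ (s * 4)) (*-monoˡ-≤ (s ^ 4) (≤-trans (≤-trans (≤-reflexive (sym (*-identityˡ _))) (*-monoˡ-≤ (D ^ n') 1≤X₀)) T1)) ⟩
    D ^ (s * 4) * (n * D' ^ n' * s ^ 4) ≡⟨ e₁ (D ^ (s * 4)) n (D' ^ n') (s ^ 4) ⟩
    n * s ^ 4 * (D' ^ n' * D ^ (s * 4)) ≤⟨ *-monoʳ-≤ (n * s ^ 4) (^-ratio-mono (n≤1+n D') (≤-trans (≤-reflexive (*-comm s 4)) 4s≤n')) ⟩
    n * s ^ 4 * (D' ^ (s * 4) * D ^ n') ≡⟨ e₂ n (s ^ 4) (D' ^ (s * 4)) (D ^ n') ⟩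
    n * D ^ n' * (D' ^ (s * 4) * s ^ 4) ≤⟨ *-monoʳ-≤ (n * D ^ n') bern ⟩
    n * D ^ n' * (D ^ (s * 4) * D ^ 4) ≡⟨ e₃ n (D ^ n') (D ^ (s * 4)) (D ^ 4) ⟩
    D ^ (s * 4) * (D ^ n' * (n * D ^ 4)) ∎))
    where
    e₁ : ∀ a n b c → a * (n * b * c) ≡ n * c * (b * a)
    e₁ = solve-∀
    e₂ : ∀ n c b a → n * c * (b * a) ≡ n * a * (b * c)
    e₂ = solve-∀
    e₃ : ∀ n a b c → n * a * (b * c) ≡ b * (a * (n * c))
    e₃ = solve-∀
  contra : D * D < Z * n → n < Z * Z * 4096
  contra lt = *-cancelʳ-< (n * n * n) n (Z * Z * 4096) (begin-strict
    n * (n * n * n) ≡⟨ q₁ n ⟩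
    n ^ 4 ≤⟨ ^-monoˡ-≤ 4 n≤8s ⟩
    (8 * s) ^ 4 ≡⟨ ^-distrib-* 8 s 4 ⟩
    4096 * s ^ 4 ≤⟨ *-monoʳ-≤ 4096 s⁴≤ ⟩
    4096 * (n * D ^ 4) ≡⟨ cong (λ z → 4096 * (n * z)) (q₂ D) ⟩
    4096 * (n * (D * D * (D * D))) <⟨ *-monoʳ-< 4096 (*-monoʳ-< n (*-mono-< lt lt)) ⟩
    4096 * (n * (Z * n * (Z * n))) ≡⟨ q₃ n Z 4096 ⟩
    Z * Z * 4096 * (n * n * n) ∎)
    where
    q₁ : ∀ n → n * (n * n * n) ≡ n * (n * (n * (n * 1)))
    q₁ = solve-∀
    q₂ : ∀ n → n * (n * (n * (n * 1))) ≡ n * n * (n * n)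
    q₂ = solve-∀
    q₃ : ∀ n z c → c * (n * (z * n * (z * n))) ≡ z * z * c * (n * n * n)
    q₃ = solve-∀

-- (1 - 1/D)^{D/2} ≥ 1/2, hence (1 - 1/D)^{ZD} ≥ 4^{-Z}.
n-large : ∀ {X₀ n' D'} h Z → 2 * h ≡ suc D' → 1 ≤ D' → 2 * X₀ * (2 ^ (2 * Z)) < suc n' →
          suc n' * D' ^ n' ≤ 2 * X₀ * suc D' ^ n' → Z * suc D' ≤ suc n'
n-large {X₀} {n'} {D'} h Z 2h≡D 1≤D' big T2 = ≮⇒≥ λ lt → <⇒≱ big (contra lt)
  where
  open ≤-Reasoning
  instance
    D'≢0 : NonZero D'
    D'≢0 = >-nonZero 1≤D'
  n = suc n' ; D = suc D'
  half : D ^ h ≤ 2 * D' ^ h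
  half = subst (λ z → z ^ h ≤ 2 * D' ^ h) (+-comm D' 1)
    (^-≤-double D' 1 h {{subst NonZero (+-comm 1 D') _}} (≤-reflexive (trans (cong (2 *_) (*-identityʳ h)) (trans 2h≡D (+-comm 1 D')))))
  ZD≡ : h * (2 * Z) ≡ Z * D
  ZD≡ = trans (eq h Z) (cong (Z *_) 2h≡D)
    where
    eq : ∀ h z → h * (2 * z) ≡ z * (2 * h)
    eq = solve-∀
  pow : D ^ (Z * D) ≤ 2 ^ (2 * Z) * D' ^ (Z * D)
  pow = begin
    D ^ (Z * D) ≡⟨ cong (D ^_) ZD≡ ⟨
    D ^ (h * (2 * Z)) ≡⟨ ^-*-assoc D h (2 * Z) ⟨
    (D ^ h) ^ (2 * Z) ≤⟨ ^-monoˡ-≤ (2 * Z) half ⟩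
    (2 * D' ^ h) ^ (2 * Z) ≡⟨ ^-distrib-* 2 (D' ^ h) (2 * Z) ⟩
    2 ^ (2 * Z) * (D' ^ h) ^ (2 * Z) ≡⟨ cong (2 ^ (2 * Z) *_) (trans (^-*-assoc D' h (2 * Z)) (cong (D' ^_) ZD≡)) ⟩
    2 ^ (2 * Z) * D' ^ (Z * D) ∎
  contra : n < Z * D → n ≤ 2 * X₀ * 2 ^ (2 * Z)
  contra lt = *-cancelʳ-≤ _ _ (D' ^ n') {{^-pos D' n'}} (begin
    n * D' ^ n' ≤⟨ T2 ⟩
    2 * X₀ * D ^ n' ≤⟨ *-monoʳ-≤ (2 * X₀) pow' ⟩
    2 * X₀ * (2 ^ (2 * Z) * D' ^ n') ≡⟨ *-assoc (2 * X₀) _ _ ⟨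
    2 * X₀ * 2 ^ (2 * Z) * D' ^ n' ∎)
    where
    pow' : D ^ n' ≤ 2 ^ (2 * Z) * D' ^ n'
    pow' = *-cancelˡ-≤ (D' ^ (Z * D)) {{^-pos D' (Z * D)}} (begin
      D' ^ (Z * D) * D ^ n' ≤⟨ ^-ratio-mono (n≤1+n D') (≤-trans (n≤1+n n') (<⇒≤ lt)) ⟩
      D' ^ n' * D ^ (Z * D) ≤⟨ *-monoʳ-≤ (D' ^ n') pow ⟩
      D' ^ n' * (2 ^ (2 * Z) * D' ^ (Z * D)) ≡⟨ e (D' ^ n') (2 ^ (2 * Z)) (D' ^ (Z * D)) ⟩
      D' ^ (Z * D) * (2 ^ (2 * Z) * D' ^ n') ∎)
      where
      e : ∀ a b c → a * (b * c) ≡ c * (b * a)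
      e = solve-∀

-- With n = `suc n'` and D = `suc D'`, `lower` and `upper` say X₀ ≤ n (1 - 1/D)^(n-1) ≤ 2 X₀. The
-- last two fields place D well above the square root of n and well below n.
record Threshold (X₀ e Z n' : ℕ) : Set where
  field
    d D'   : ℕ
    d≥1    : 1 ≤ d
    D≡ed   : suc D' ≡ e * d
    lower  : X₀ * suc D' ^ n' ≤ suc n' * D' ^ n'
    upper  : suc n' * D' ^ n' ≤ 2 * X₀ * suc D' ^ n'
    D²≥    : Z * suc n' ≤ suc D' * suc D'
    n≥     : Z * suc D' ≤ suc n'

-- The edge probability 1/D is placed at the threshold where the expected number
-- n (1 - 1/D)^{n-1} of isolated vertices lies between X₀ and 2 X₀.
threshold : ∀ X₀ e₂ Z → 1 ≤ X₀ → 1 ≤ e₂ → 16 * e₂ ≤ Z → ∃ λ n₀ → ∀ n' → n₀ ≤ n' → Threshold X₀ (2 * e₂) Z n'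
threshold X₀ e₂ Z 1≤X₀ 1≤e₂ 16e₂≤Z = n₀ , construct
  where
  open ≤-Reasoning
  -- An even `e` makes D/2 the integer `e₂ * suc j` required by `n-large`.
  e = 2 * e₂
  n₀ = 4 + Z * Z * 4096 + 2 * X₀ * 2 ^ (2 * Z) + e * e + 2 * X₀
  construct : ∀ n' → n₀ ≤ n' → Threshold X₀ e Z n'
  construct n' n₀≤n' = finish (≤-minimal P P? n' P-n')
    where
    n = suc n'
    c₁ : 4 ≤ n'
    c₁ = ≤-trans (≤-trans (≤-trans (≤-trans (m≤m+n 4 (Z * Z * 4096)) (m≤m+n _ (2 * X₀ * 2 ^ (2 * Z)))) (m≤m+n _ (e * e))) (m≤m+n _ (2 * X₀))) n₀≤n'
    c₂ : Z * Z * 4096 ≤ n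
    c₂ = ≤-trans (≤-trans (≤-trans (≤-trans (≤-trans (m≤n+m (Z * Z * 4096) 4) (m≤m+n _ (2 * X₀ * 2 ^ (2 * Z)))) (m≤m+n _ (e * e))) (m≤m+n _ (2 * X₀))) n₀≤n') (n≤1+n n')
    c₃ : 2 * X₀ * 2 ^ (2 * Z) < n
    c₃ = s≤s (≤-trans (≤-trans (≤-trans (m≤n+m _ (4 + Z * Z * 4096)) (m≤m+n _ (e * e))) (m≤m+n _ (2 * X₀))) n₀≤n')
    c₄ : e * e < n
    c₄ = s≤s (≤-trans (≤-trans (m≤n+m _ (4 + Z * Z * 4096 + 2 * X₀ * 2 ^ (2 * Z))) (m≤m+n _ (2 * X₀))) n₀≤n')
    c₅ : 2 * X₀ ≤ n
    c₅ = ≤-trans (≤-trans (m≤n+m _ (4 + Z * Z * 4096 + 2 * X₀ * 2 ^ (2 * Z) + e * e)) n₀≤n') (n≤1+n n')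
    1≤e : 1 ≤ e
    1≤e = *-mono-≤ {1} {2} (s≤s z≤n) 1≤e₂
    -- For D = e (j+1) this says that the expected number of isolated vertices is at least X₀; the
    -- least such `j` is taken.
    P : ℕ → Set
    P j = X₀ * (e * suc j) ^ n' ≤ n * (e * suc j ∸ 1) ^ n'
    P? : ∀ j → Dec (P j)
    P? j = _ ≤? _
    D≥1 : ∀ j → 1 ≤ e * suc j
    D≥1 j = *-mono-≤ 1≤e (s≤s (z≤n {j}))
    sucpred : ∀ {x} → 1 ≤ x → suc (x ∸ 1) ≡ x
    sucpred (s≤s _) = refl
    -- At j = n' the value of D is at least 2 n', so (1 - 1/D)^n' is at least 1/2, and 2 X₀ ≤ n
    -- suffices.
    P-n' : P n'
    P-n' with e * suc n' in eq | D≥1 n'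
    ... | suc D' | _ = begin
      X₀ * suc D' ^ n' ≤⟨ *-monoʳ-≤ X₀ (subst (λ z → z ^ n' ≤ 2 * D' ^ n') (+-comm D' 1)
                                  (^-≤-double D' 1 n' {{subst NonZero (+-comm 1 D') _}} 2n'≤)) ⟩
      X₀ * (2 * D' ^ n') ≡⟨ q X₀ (D' ^ n') ⟩
      2 * X₀ * D' ^ n' ≤⟨ *-monoˡ-≤ (D' ^ n') c₅ ⟩
      n * D' ^ n' ∎
      where
      q : ∀ x y → x * (2 * y) ≡ 2 * x * y
      q = solve-∀
      2n'≤ : 2 * (n' * 1) ≤ D' + 1
      2n'≤ = begin
        2 * (n' * 1) ≡⟨ cong (2 *_) (*-identityʳ n') ⟩
        2 * n' ≤⟨ *-mono-≤ {2} {e} (*-monoʳ-≤ 2 1≤e₂) (n≤1+n n') ⟩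
        e * suc n' ≡⟨ eq ⟩
        suc D' ≡⟨ +-comm 1 D' ⟩
        D' + 1 ∎
    finish : (∃ λ j → j ≤ n' × P j × (∀ i → i < j → ¬ P i)) → Threshold X₀ e Z n'
    finish (j , _ , Pj , least) = record
      { d = suc j ; D' = D' ; d≥1 = s≤s z≤n ; D≡ed = D≡ ; lower = lower
      ; upper = upper ; D²≥ = D²≥ ; n≥ = n-large {X₀} (e₂ * suc j) Z (trans (sym (*-assoc 2 e₂ (suc j))) (sym D≡)) 1≤D' c₃ upper }
      where
      D' = e * suc j ∸ 1
      D≡ : suc D' ≡ e * suc j
      D≡ = sucpred (D≥1 j)
      lower : X₀ * suc D' ^ n' ≤ n * D' ^ n'
      lower = subst (λ z → X₀ * z ^ n' ≤ n * D' ^ n') (sym D≡) Pj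
      D²≥ : Z * n ≤ suc D' * suc D'
      D²≥ = D²-large {X₀} Z 1≤X₀ c₁ c₂ lower
      1≤D' : 1 ≤ D'
      1≤D' = s≤s⁻¹ (≤-trans (*-mono-≤ {2} {e} {1} {suc j} (*-monoʳ-≤ 2 1≤e₂) (s≤s z≤n)) (≤-reflexive (sym D≡)))
      upper : n * D' ^ n' ≤ 2 * X₀ * suc D' ^ n'
      upper = go j refl
        where
        go : ∀ i → i ≡ j → n * D' ^ n' ≤ 2 * X₀ * suc D' ^ n'
        -- The least `j` is not 0: D = `e` would contradict D² ≥ Z n, as n exceeds e².
        go zero refl = ⊥-elim (<⇒≱ c₄ (begin
          n ≤⟨ m≤m*n n Z {{>-nonZero (≤-trans (≤-trans (s≤s z≤n) (*-monoʳ-≤ 16 1≤e₂)) 16e₂≤Z)}} ⟩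
          n * Z ≡⟨ *-comm n Z ⟩
          Z * n ≤⟨ D²≥ ⟩
          suc D' * suc D' ≡⟨ cong₂ _*_ D≡ D≡ ⟩
          e * 1 * (e * 1) ≡⟨ cong₂ _*_ (*-identityʳ e) (*-identityʳ e) ⟩
          e * e ∎))
        -- For the preceding value G = D - e the expectation is below X₀. The quotient of the two
        -- expectations is (1 + e/(D G'))^n', at most 2 by `small`, which rests on D² ≥ Z n.
        go (suc i) refl = *-cancelˡ-≤ (G ^ n') {{^-pos G n'}} (begin
          G ^ n' * (n * D' ^ n') ≡⟨ e₁ (G ^ n') n (D' ^ n') ⟩
          n * (D' ^ n' * G ^ n') ≡⟨ cong (n *_) (^-distrib-* D' G n') ⟨
          n * (D' * G) ^ n' ≡⟨ cong (λ z → n * z ^ n') D'G≡ ⟩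
          n * (D * G' + e) ^ n' ≤⟨ *-monoʳ-≤ n (^-≤-double (D * G') e n' {{>-nonZero (≤-trans 1≤e (m≤n+m e (D * G')))}} small) ⟩
          n * (2 * (D * G') ^ n') ≡⟨ cong (λ z → n * (2 * z)) (^-distrib-* D G' n') ⟩
          n * (2 * (D ^ n' * G' ^ n')) ≡⟨ e₂' n (D ^ n') (G' ^ n') ⟩
          2 * D ^ n' * (n * G' ^ n') ≤⟨ *-monoʳ-≤ (2 * D ^ n') (<⇒≤ (≰⇒> (least i ≤-refl))) ⟩
          2 * D ^ n' * (X₀ * (e * suc i) ^ n') ≡⟨ cong (λ z → 2 * D ^ n' * (X₀ * z ^ n')) (sym G≡) ⟩
          2 * D ^ n' * (X₀ * G ^ n') ≡⟨ e₃ (D ^ n') X₀ (G ^ n') ⟩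
          G ^ n' * (2 * X₀ * D ^ n') ∎)
          where
          G' = e * suc i ∸ 1
          G = suc G'
          D = suc D'
          G≡ : G ≡ e * suc i
          G≡ = sucpred (D≥1 i)
          D≡G+e : D ≡ G + e
          D≡G+e = trans D≡ (trans (*-suc e (suc i)) (trans (+-comm e _) (cong (_+ e) (sym G≡))))
          D'≡ : D' ≡ G' + e
          D'≡ = suc-injective D≡G+e
          D'G≡ : D' * G ≡ D * G' + e
          D'G≡ = trans (cong (_* G) D'≡) (trans (id₁ G' e) (cong (λ z → z * G' + e) (sym D≡G+e)))
            where
            id₁ : ∀ g e → (g + e) * suc g ≡ (suc g + e) * g + e
            id₁ = solve-∀
          e₁ : ∀ a b c → a * (b * c) ≡ b * (c * a)
          e₁ = solve-∀
          e₂' : ∀ n b c → n * (2 * (b * c)) ≡ 2 * b * (n * c)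
          e₂' = solve-∀
          e₃ : ∀ a x c → 2 * a * (x * c) ≡ c * (2 * x * a)
          e₃ = solve-∀
          D≤4G' : D ≤ 4 * G'
          D≤4G' = begin
            D ≡⟨ D≡G+e ⟩
            G + e ≤⟨ +-monoʳ-≤ G (≤-trans (m≤m*n e (suc i)) (≤-reflexive (sym G≡))) ⟩
            G + G ≤⟨ +-mono-≤ G≤ G≤ ⟩
            2 * G' + 2 * G' ≡⟨ q G' ⟩
            4 * G' ∎
            where
            q : ∀ g → 2 * g + 2 * g ≡ 4 * g
            q = solve-∀
            G'≥1 : 1 ≤ G'
            G'≥1 = s≤s⁻¹ (≤-trans (*-mono-≤ {2} {e} {1} {suc i} (*-monoʳ-≤ 2 1≤e₂) (s≤s z≤n)) (≤-reflexive (sym G≡)))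
            G≤ : G ≤ 2 * G'
            G≤ = ≤-trans (+-monoˡ-≤ G' G'≥1) (≤-reflexive (cong (G' +_) (sym (+-identityʳ G'))))
          small : 2 * (n' * e) ≤ D * G' + e
          small = *-cancelˡ-≤ 4 (begin
            4 * (2 * (n' * e)) ≤⟨ *-monoʳ-≤ 4 (*-monoʳ-≤ 2 (*-monoˡ-≤ e (n≤1+n n'))) ⟩
            4 * (2 * (n * (2 * e₂))) ≡⟨ q₁ n e₂ ⟩
            16 * e₂ * n ≤⟨ *-monoˡ-≤ n 16e₂≤Z ⟩
            Z * n ≤⟨ D²≥ ⟩
            D * D ≤⟨ *-monoʳ-≤ D D≤4G' ⟩
            D * (4 * G') ≡⟨ q₂ D G' ⟩
            4 * (D * G') ≤⟨ *-monoʳ-≤ 4 (m≤m+n (D * G') e) ⟩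
            4 * (D * G' + e) ∎)
            where
            q₁ : ∀ n e → 4 * (2 * (n * (2 * e))) ≡ 16 * e * n
            q₁ = solve-∀
            q₂ : ∀ d g → d * (4 * g) ≡ 4 * (d * g)
            q₂ = solve-∀

-- Vertex sets, and the removal of non-expanding sets

true≢false : true ≢ false
true≢false ()

χ-true : ∀ {b} → b ≡ true → χ b ≡ 1
χ-true refl = refl

χ≡0⇒ : ∀ {b} → χ b ≡ 0 → b ≡ false
χ≡0⇒ {false} _ = refl

∧-true : ∀ {a b} → a ≡ true → b ≡ true → a ∧ b ≡ true
∧-true refl refl = refl

∧-true⁻ : ∀ a {b} → a ∧ b ≡ true → a ≡ true × b ≡ true
∧-true⁻ true p = refl , p

∨-true⁻ : ∀ a {b} → a ∨ b ≡ true → a ≡ true ⊎ b ≡ true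
∨-true⁻ true  p = inj₁ refl
∨-true⁻ false p = inj₂ p

∨-trueʳ : ∀ a {b} → b ≡ true → a ∨ b ≡ true
∨-trueʳ a refl = ∨-zeroʳ a

∨-trueˡ : ∀ {a b} → a ≡ true → a ∨ b ≡ true
∨-trueˡ refl = refl

not-true : ∀ {a} → a ≡ false → not a ≡ true
not-true refl = refl

not-true⁻ : ∀ a → not a ≡ true → a ≡ false
not-true⁻ false p = refl

module _ {n : ℕ} where

  card-cong : {P Q : VSet n} → (∀ v → P v ≡ Q v) → card P ≡ card Q
  card-cong e = ∑-cong (allFin n) (λ v → cong χ (e v))

  card-cover : (P Q R : VSet n) → (∀ v → P v ≡ true → Q v ≡ true ⊎ R v ≡ true) → card P ≤ card Q + card R
  card-cover P Q R sub = ≤-trans (∑-mono (allFin n) pointwise) (≤-reflexive (∑-+ (allFin n) _ _))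
    where
    pointwise : ∀ v → χ (P v) ≤ χ (Q v) + χ (R v)
    pointwise v with P v | sub v
    ... | false | _ = z≤n
    ... | true  | s with s refl
    ...   | inj₁ q rewrite q = s≤s z≤n
    ...   | inj₂ q rewrite q = m≤n+m 1 (χ (Q v))

  card-mono : (P Q : VSet n) → (∀ v → P v ≡ true → Q v ≡ true) → card P ≤ card Q
  card-mono P Q sub = ∑-mono (allFin n) pointwise
    where
    pointwise : ∀ v → χ (P v) ≤ χ (Q v)
    pointwise v with P v | sub v
    ... | false | _ = z≤n
    ... | true  | s rewrite s refl = ≤-refl

  card-disjoint : (P Q R : VSet n) → (∀ v → P v ≡ true → R v ≡ true) → (∀ v → Q v ≡ true → R v ≡ true) →
                  (∀ v → P v ≡ true → Q v ≡ true → ⊥) → card P + card Q ≤ card R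
  card-disjoint P Q R sub₁ sub₂ dis = ≤-trans (≤-reflexive (sym (∑-+ (allFin n) _ _))) (∑-mono (allFin n) pointwise)
    where
    pointwise : ∀ v → χ (P v) + χ (Q v) ≤ χ (R v)
    pointwise v with P v | Q v | sub₁ v | sub₂ v | dis v
    ... | true  | true  | _ | _ | d = ⊥-elim (d refl refl)
    ... | true  | false | s | _ | _ rewrite s refl = ≤-refl
    ... | false | true  | _ | s | _ rewrite s refl = ≤-refl
    ... | false | false | _ | _ | _ = z≤n

  card-all : card {n} (λ _ → true) ≡ n
  card-all = trans (sym (length≡∑1 (allFin n))) (length-allFin n)

  card-complement : (P : VSet n) → n ≤ card (not ∘ P) + card P
  card-complement P = subst (_≤ card (not ∘ P) + card P) card-all (card-cover (λ _ → true) (not ∘ P) P split)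
    where
    split : ∀ v → true ≡ true → not (P v) ≡ true ⊎ P v ≡ true
    split v _ with P v
    ... | true  = inj₂ refl
    ... | false = inj₁ refl

  card-≤n : (P : VSet n) → card P ≤ n
  card-≤n P = subst (card P ≤_) card-all (card-mono P (λ _ → true) (λ _ _ → refl))

  card-<⇒ : (P Q : VSet n) → card Q < card P → ∃ λ v → P v ≡ true × Q v ≡ false
  card-<⇒ P Q lt with F.any? (λ v → (P v Bool.≟ true) ×-dec (Q v Bool.≟ false))
  ... | yes r = r
  ... | no ¬r = ⊥-elim (<⇒≱ lt (card-mono P Q sub))
    where
    sub : ∀ v → P v ≡ true → Q v ≡ true
    sub v p with Q v in eq
    ... | true  = refl
    ... | false = ⊥-elim (¬r (v , p , eq))

  card-empty : card {n} (λ _ → false) ≡ 0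
  card-empty = trans (∑-const (allFin n) 0) (*-zeroʳ (length (allFin n)))

  mem : List (Fin n) → VSet n
  mem []       v = false
  mem (u ∷ us) v = ⌊ u F.≟ v ⌋ ∨ mem us v

  ∈⇒mem : ∀ {us v} → v ∈ us → mem us v ≡ true
  ∈⇒mem {u ∷ us} {v} (here refl) with u F.≟ u
  ... | yes _ = refl
  ... | no ¬p = ⊥-elim (¬p refl)
  ∈⇒mem {u ∷ us} {v} (there p) = ∨-trueʳ ⌊ u F.≟ v ⌋ (∈⇒mem p)

  mem⇒∈ : ∀ us {v} → mem us v ≡ true → v ∈ us
  mem⇒∈ (u ∷ us) {v} p with u F.≟ v
  ... | yes refl = here refl
  ... | no _     = there (mem⇒∈ us p)

  ∉⇐mem : ∀ {us v} → mem us v ≡ false → v ∉ us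
  ∉⇐mem f p = true≢false (trans (sym (∈⇒mem p)) f)

  card-mem-≤ : (us : List (Fin n)) → card (mem us) ≤ length us
  card-mem-≤ []       = ≤-reflexive card-empty
  card-mem-≤ (u ∷ us) = ≤-trans (card-cover (mem (u ∷ us)) (λ v → ⌊ u F.≟ v ⌋) (mem us) (λ v → ∨-true⁻ ⌊ u F.≟ v ⌋))
    (+-mono-≤ single (card-mem-≤ us))
    where
    single : card (λ v → ⌊ u F.≟ v ⌋) ≤ 1
    single = ∑-χ-∈ (u ∷ []) _ ([] ∷ []) sub
      where
      sub : ∀ v → ⌊ u F.≟ v ⌋ ≡ true → v ∈ u ∷ []
      sub v p with u F.≟ v
      ... | yes refl = here refl

  length≤card : (us : List (Fin n)) (P : VSet n) → Unique us → (∀ {v} → v ∈ us → P v ≡ true) → length us ≤ card P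
  length≤card us P u sub = begin
    length us ≡⟨ length≡∑1 us ⟩
    ∑ us (λ _ → 1) ≤⟨ ∑-inject us (members P) (λ v → v) (λ _ → 1) u (λ _ _ e → e) (∈-members⁺ P ∘ sub) ⟩
    ∑ (members P) (λ _ → 1) ≡⟨ length≡∑1 (members P) ⟨
    length (members P) ≡⟨ length-members P ⟩
    card P ∎
    where open ≤-Reasoning

  anyV : VSet n → Bool
  anyV P = ListAction.any P (allFin n)

any-true⁺ : {X : Set} (P : X → Bool) {xs : List X} {x : X} → x ∈ xs → P x ≡ true → ListAction.any P xs ≡ true
any-true⁺ P (here refl) p = ∨-trueˡ p
any-true⁺ P (there {x = y} x∈) p = ∨-trueʳ (P y) (any-true⁺ P x∈ p)

any-true⁻ : {X : Set} (P : X → Bool) (xs : List X) → ListAction.any P xs ≡ true → ∃ λ x → x ∈ xs × P x ≡ true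
any-true⁻ P (x ∷ xs) p with ∨-true⁻ (P x) p
... | inj₁ q = x , here refl , q
... | inj₂ q = let (y , y∈ , r) = any-true⁻ P xs q in y , there y∈ , r

any-cong : {X : Set} {P Q : X → Bool} (xs : List X) → (∀ x → P x ≡ Q x) → ListAction.any P xs ≡ ListAction.any Q xs
any-cong []       e = refl
any-cong (x ∷ xs) e = cong₂ _∨_ (e x) (any-cong xs e)

∃Vec? : (n : ℕ) (P : Vec Bool n → Set) → (∀ v → Dec (P v)) → Dec (∃ P)
∃Vec? n P P? with Any.any? P? (allVecs (true ∷ false ∷ []) n)
... | yes a = yes (Any.satisfied a)
... | no ¬a = no λ (v , p) → ¬a (lose (∈-allVecs v (λ i → bool∈ (lookup v i))) p)
  where
  bool∈ : ∀ b → b ∈ true ∷ false ∷ []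
  bool∈ true  = here refl
  bool∈ false = there (here refl)

Adjacency : ℕ → ℕ → Set
Adjacency n r = Fin r → Fin n → Fin n → Bool

module _ {n r : ℕ} (adj : Adjacency n r) where

  nbrs : Fin r → VSet n → VSet n
  nbrs c A v = anyV (λ u → A u ∧ adj c u v)

  nbrs⁺ : ∀ c A {u v} → A u ≡ true → adj c u v ≡ true → nbrs c A v ≡ true
  nbrs⁺ c A {u} {v} p q = any-true⁺ (λ u → A u ∧ adj c u v) (∈-allFin u) (∧-true p q)

  nbrs⁻ : ∀ c A {v} → nbrs c A v ≡ true → ∃ λ u → A u ≡ true × adj c u v ≡ true
  nbrs⁻ c A {v} p with any-true⁻ (λ u → A u ∧ adj c u v) (allFin n) p
  ... | u , _ , q = u , ∧-true⁻ (A u) q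

  -- Neighbours are counted inside `W` only, so that a tree grown by expansion stays in `W` and can
  -- be expanded again.
  Expanding : (κ s : ℕ) → VSet n → Set
  Expanding κ s W = ∀ c A → (∀ v → A v ≡ true → W v ≡ true) → 1 ≤ card A → card A ≤ s →
    κ * card A < card (λ v → nbrs c A v ∧ W v)

  NonExpansion : (κ s : ℕ) → VSet n → Fin r → VSet n → Set
  NonExpansion κ s W c A = (∀ v → A v ≡ true → W v ≡ true) × 1 ≤ card A × card A ≤ s ×
    card (λ v → nbrs c A v ∧ W v) ≤ κ * card A

  expanding? : ∀ κ s W → Expanding κ s W ⊎ ∃ λ c → ∃ λ A → NonExpansion κ s W c A
  expanding? κ s W with F.any? (λ c → ∃Vec? n (λ A → NonExpansion κ s W c (lookup A)) (λ A →
      F.all? (λ v → (lookup A v Bool.≟ true) →-dec (W v Bool.≟ true)) ×-dec (1 ≤? _) ×-dec (_ ≤? s) ×-dec (_ ≤? _)))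
  ... | yes (c , A , p) = inj₂ (c , lookup A , p)
  ... | no ¬p = inj₁ λ c A sub pos small → ≰⇒> λ le → ¬p (c , Vec.tabulate A ,
      (λ v a → sub v (trans (sym (lookup∘tabulate A v)) a)) ,
      subst (1 ≤_) (sym (card-cong (lookup∘tabulate A))) pos ,
      subst (_≤ s) (sym (card-cong (lookup∘tabulate A))) small ,
      subst₂ _≤_
        (card-cong (λ v → cong (_∧ W v) (any-cong (allFin n) (λ u → cong (_∧ adj c u v) (sym (lookup∘tabulate A u))))))
        (cong (κ *_) (sym (card-cong (lookup∘tabulate A)))) le)

  -- Repeatedly remove a set that does not expand in some colour.  The removed sets are kept
  -- per colour: each union R c is itself non-expanding, hence stays smaller than u.
  module Core (κ s u K : ℕ) (u≥1 : 1 ≤ u) (2u≤s : 2 * u ≤ s)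
    (K₁ : κ * s + r * u ≤ K) (K₂ : κ * (2 * u) + (r * u + u) ≤ K)
    (exp : ∀ c A → u ≤ card A → card A ≤ s → K < card (nbrs c A)) where

    Removed : (Fin r → VSet n) → VSet n
    Removed R v = ListAction.any (λ c → R c v) (allFin r)

    record Inv (R : Fin r → VSet n) : Set where
      field
        closed : ∀ c → card (λ v → nbrs c (R c) v ∧ not (Removed R v)) ≤ κ * card (R c)
        small  : ∀ c → card (R c) < u

    card-Removed : ∀ R → card (Removed R) ≤ ∑ (allFin r) (λ c → card (R c))
    card-Removed R = ≤-trans (∑-mono (allFin n) (λ v → pointwise v (allFin r))) (≤-reflexive (∑-swap (allFin n) (allFin r) _))
      where
      pointwise : ∀ v cs → χ (ListAction.any (λ c → R c v) cs) ≤ ∑ cs (λ c → χ (R c v))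
      pointwise v [] = z≤n
      pointwise v (c ∷ cs) with R c v
      ... | true  = s≤s z≤n
      ... | false = pointwise v cs

    Inv⇒Removed≤ : ∀ {R} → Inv R → card (Removed R) ≤ r * u
    Inv⇒Removed≤ {R} inv = ≤-trans (card-Removed R) (≤-trans (∑-mono (allFin r) (λ c → <⇒≤ (Inv.small inv c)))
      (≤-reflexive (trans (∑-const (allFin r) u) (cong (_* u) (length-allFin r)))))

    Core : Set
    Core = ∃ λ W → n ≤ card W + r * u × Expanding κ s W

    module Step (R : Fin r → VSet n) (inv : Inv R) (c₀ : Fin r) (A : VSet n)
                (nonexp : NonExpansion κ s (not ∘ Removed R) c₀ A) where
      open Inv inv
      open ≤-Reasoning
      A⊆ = proj₁ nonexp
      A≥1 = proj₁ (proj₂ nonexp)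
      A≤s = proj₁ (proj₂ (proj₂ nonexp))
      A-closed = proj₂ (proj₂ (proj₂ nonexp))

      R′ : Fin r → VSet n
      R′ c v with c F.≟ c₀
      ... | yes _ = R c v ∨ A v
      ... | no _  = R c v

      R⊆R′ : ∀ c v → R c v ≡ true → R′ c v ≡ true
      R⊆R′ c v p with c F.≟ c₀
      ... | yes _ = ∨-trueˡ p
      ... | no _  = p

      A⊆R′ : ∀ v → A v ≡ true → R′ c₀ v ≡ true
      A⊆R′ v p with c₀ F.≟ c₀
      ... | yes _ = ∨-trueʳ (R c₀ v) p
      ... | no ¬e = ⊥-elim (¬e refl)

      R′⁻ : ∀ v → R′ c₀ v ≡ true → R c₀ v ≡ true ⊎ A v ≡ true
      R′⁻ v p with c₀ F.≟ c₀
      ... | yes _ = ∨-true⁻ (R c₀ v) p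
      ... | no ¬e = ⊥-elim (¬e refl)

      Removed⊆ : ∀ v → Removed R v ≡ true → Removed R′ v ≡ true
      Removed⊆ v p with any-true⁻ (λ c → R c v) (allFin r) p
      ... | c , c∈ , q = any-true⁺ (λ c → R′ c v) c∈ (R⊆R′ c v q)

      A⊆Removed : ∀ v → A v ≡ true → Removed R′ v ≡ true
      A⊆Removed v p = any-true⁺ (λ c → R′ c v) (∈-allFin c₀) (A⊆R′ v p)

      A∩Removed : ∀ v → Removed R v ≡ true → A v ≡ true → ⊥
      A∩Removed v p q = true≢false (trans (sym p) (not-true⁻ _ (A⊆ v q)))

      grows : suc (card (Removed R)) ≤ card (Removed R′)
      grows = begin
        1 + card (Removed R) ≤⟨ +-monoˡ-≤ _ A≥1 ⟩
        card A + card (Removed R) ≤⟨ card-disjoint A (Removed R) (Removed R′) A⊆Removed Removed⊆ (λ v p q → A∩Removed v q p) ⟩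
        card (Removed R′) ∎

      notRemoved : ∀ v → not (Removed R′ v) ≡ true → not (Removed R v) ≡ true
      notRemoved v p with Removed R v in eq
      ... | false = refl
      ... | true  = ⊥-elim (true≢false (trans (sym (Removed⊆ v eq)) (not-true⁻ _ p)))

      R+A≤R′ : card (R c₀) + card A ≤ card (R′ c₀)
      R+A≤R′ = card-disjoint (R c₀) A (R′ c₀) (R⊆R′ c₀) A⊆R′
        (λ v p q → A∩Removed v (any-true⁺ (λ c → R c v) (∈-allFin c₀) p) q)

      -- The sets removed for one colour are disjoint, so the bounds for `R c₀` and for `A` add up
      -- to the bound for the union.
      closed₀ : card (λ v → nbrs c₀ (R′ c₀) v ∧ not (Removed R′ v)) ≤ κ * card (R′ c₀)
      closed₀ = begin
        card (λ v → nbrs c₀ (R′ c₀) v ∧ not (Removed R′ v))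
          ≤⟨ card-cover _ (λ v → nbrs c₀ (R c₀) v ∧ not (Removed R v)) (λ v → nbrs c₀ A v ∧ not (Removed R v)) split ⟩
        card (λ v → nbrs c₀ (R c₀) v ∧ not (Removed R v)) + card (λ v → nbrs c₀ A v ∧ not (Removed R v))
          ≤⟨ +-mono-≤ (closed c₀) A-closed ⟩
        κ * card (R c₀) + κ * card A ≡⟨ *-distribˡ-+ κ _ _ ⟨
        κ * (card (R c₀) + card A) ≤⟨ *-monoʳ-≤ κ R+A≤R′ ⟩
        κ * card (R′ c₀) ∎
        where
        split : ∀ v → nbrs c₀ (R′ c₀) v ∧ not (Removed R′ v) ≡ true →
          nbrs c₀ (R c₀) v ∧ not (Removed R v) ≡ true ⊎ nbrs c₀ A v ∧ not (Removed R v) ≡ true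
        split v p with ∧-true⁻ (nbrs c₀ (R′ c₀) v) p
        ... | q , nr with nbrs⁻ c₀ (R′ c₀) q
        ...   | x , x∈ , a with R′⁻ x x∈
        ...     | inj₁ y = inj₁ (∧-true (nbrs⁺ c₀ (R c₀) y a) (notRemoved v nr))
        ...     | inj₂ y = inj₂ (∧-true (nbrs⁺ c₀ A y a) (notRemoved v nr))

      nbrs≤ : ∀ B → card (nbrs c₀ B) ≤ card (λ v → nbrs c₀ B v ∧ not (Removed R v)) + card (Removed R)
      nbrs≤ B = card-cover _ _ _ split
        where
        split : ∀ v → nbrs c₀ B v ≡ true → nbrs c₀ B v ∧ not (Removed R v) ≡ true ⊎ Removed R v ≡ true
        split v p with Removed R v
        ... | true  = inj₂ refl
        ... | false = inj₁ (∧-true p refl)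

      -- If `A` had `u` or more vertices, `exp` would give more than `K` neighbours, whereas at most
      -- κ |A| lie in the current set and at most r u outside it.
      A<u : card A < u
      A<u = ≰⇒> λ u≤A → <⇒≱ (exp c₀ A u≤A A≤s) (begin
        card (nbrs c₀ A) ≤⟨ nbrs≤ A ⟩
        card (λ v → nbrs c₀ A v ∧ not (Removed R v)) + card (Removed R) ≤⟨ +-mono-≤ A-closed (Inv⇒Removed≤ inv) ⟩
        κ * card A + r * u ≤⟨ +-monoˡ-≤ _ (*-monoʳ-≤ κ A≤s) ⟩
        κ * s + r * u ≤⟨ K₁ ⟩
        K ∎)

      R′≤R+A : card (R′ c₀) ≤ card (R c₀) + card A
      R′≤R+A = card-cover (R′ c₀) (R c₀) A R′⁻

      R′≤2u : card (R′ c₀) ≤ 2 * u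
      R′≤2u = ≤-trans R′≤R+A (≤-trans (+-mono-≤ (<⇒≤ (small c₀)) (<⇒≤ A<u)) (≤-reflexive (cong (u +_) (sym (+-identityʳ u)))))

      -- Two sets below `u` have a union of at most 2u ≤ s vertices, so `exp` applies once the union
      -- reaches `u`; but its neighbours are confined to κ · 2u vertices and the removed ones.
      -- Accumulation therefore never passes `u`.
      small₀ : card (R′ c₀) < u
      small₀ = ≰⇒> λ u≤R′ → <⇒≱ (exp c₀ (R′ c₀) u≤R′ (≤-trans R′≤2u 2u≤s)) (begin
        card (nbrs c₀ (R′ c₀)) ≤⟨ card-cover _ (λ v → nbrs c₀ (R′ c₀) v ∧ not (Removed R′ v)) (Removed R′) split ⟩
        card (λ v → nbrs c₀ (R′ c₀) v ∧ not (Removed R′ v)) + card (Removed R′)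
                                        ≤⟨ +-mono-≤ closed₀ (card-cover (Removed R′) (Removed R) A Removed′⁻) ⟩
        κ * card (R′ c₀) + (card (Removed R) + card A)
                                        ≤⟨ +-mono-≤ (*-monoʳ-≤ κ R′≤2u) (+-mono-≤ (Inv⇒Removed≤ inv) (<⇒≤ A<u)) ⟩
        κ * (2 * u) + (r * u + u) ≤⟨ K₂ ⟩
        K ∎)
        where
        split : ∀ v → nbrs c₀ (R′ c₀) v ≡ true → nbrs c₀ (R′ c₀) v ∧ not (Removed R′ v) ≡ true ⊎ Removed R′ v ≡ true
        split v p with Removed R′ v
        ... | true  = inj₂ refl
        ... | false = inj₁ (∧-true p refl)
        Removed′⁻ : ∀ v → Removed R′ v ≡ true → Removed R v ≡ true ⊎ A v ≡ true
        Removed′⁻ v p with any-true⁻ (λ c → R′ c v) (allFin r) p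
        ... | c , c∈ , q with c F.≟ c₀
        ...   | no _ = inj₁ (any-true⁺ (λ c → R c v) c∈ q)
        ...   | yes refl with ∨-true⁻ (R c v) q
        ...     | inj₁ y = inj₁ (any-true⁺ (λ c → R c v) c∈ y)
        ...     | inj₂ y = inj₂ y

      other : ∀ c → c ≢ c₀ → ∀ v → R′ c v ≡ R c v
      other c c≢ v with c F.≟ c₀
      ... | yes e = ⊥-elim (c≢ e)
      ... | no _  = refl

      inv′ : Inv R′
      inv′ = record { closed = closed′ ; small = small′ }
        where
        closed′ : ∀ c → card (λ v → nbrs c (R′ c) v ∧ not (Removed R′ v)) ≤ κ * card (R′ c)
        closed′ c with c F.≟ c₀
        closed′ c | yes refl = subst₂ (λ a b → a ≤ κ * b)
          (card-cong (λ v → cong (_∧ not (Removed R′ v)) (any-cong (allFin n) (λ x → cong (_∧ adj c x v) (at x)))))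
          (card-cong at) closed₀
          where
          at : ∀ x → R′ c₀ x ≡ R c x ∨ A x
          at x with c₀ F.≟ c₀
          ... | yes _ = refl
          ... | no ¬e = ⊥-elim (¬e refl)
        -- For the other colours the neighbours are counted outside a removed set that has only
        -- grown.
        closed′ c | no c≢ = ≤-trans (card-mono _ _ sub) (closed c)
          where
          sub : ∀ v → nbrs c (R c) v ∧ not (Removed R′ v) ≡ true → nbrs c (R c) v ∧ not (Removed R v) ≡ true
          sub v p with ∧-true⁻ (nbrs c (R c) v) p
          ... | q , nr = ∧-true q (notRemoved v nr)
        small′ : ∀ c → card (R′ c) < u
        small′ c with c F.≟ c₀ in eq
        ... | no c≢ = small c
        ... | yes refl = subst (_< u) (card-cong at) small₀
          where
          at : ∀ x → R′ c₀ x ≡ R c x ∨ A x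
          at x rewrite eq = refl

    -- Each set taken out is nonempty and new, so every unit of fuel is paid back by a removed
    -- vertex, and there are only `n` of these.
    loop : ∀ fuel R → Inv R → n < card (Removed R) + fuel → Core
    loop zero R inv lt = ⊥-elim (<⇒≱ lt (subst (_≤ n) (sym (+-identityʳ _)) (card-≤n (Removed R))))
    loop (suc fuel) R inv lt with expanding? κ s (not ∘ Removed R)
    ... | inj₁ ex = not ∘ Removed R ,
            ≤-trans (card-complement (Removed R)) (+-monoʳ-≤ _ (Inv⇒Removed≤ inv)) , ex
    ... | inj₂ (c₀ , A , nonexp) = loop fuel R′ inv′
            (≤-trans lt (≤-trans (≤-reflexive (+-suc _ fuel)) (+-monoˡ-≤ fuel grows)))
      where open Step R inv c₀ A nonexp

    core : Core
    core = loop (suc n) (λ _ _ → false) (record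
      { closed = λ c → ≤-trans (card-mono _ (λ _ → false) (λ v → empty c v)) (≤-trans (≤-reflexive (card-empty {n})) z≤n)
      ; small = λ c → subst (_< u) (sym (card-empty {n})) u≥1 }) (m≤n+m (suc n) _)
      where
      empty : ∀ c v {b} → nbrs c (λ _ → false) v ∧ b ≡ true → false ≡ true
      empty c v p with nbrs⁻ c (λ _ → false) {v} (proj₁ (∧-true⁻ (nbrs c (λ _ → false) v) p))
      ... | _ , () , _

-- Growing pattern-coloured trees

-- `s` is a position in the periodically extended pattern. The relation `R` is kept apart from the
-- Boolean adjacency of G₋, because the first and last edges may belong to G_τ₁ only.
data PatPath {n r : ℕ} (R : Fin r → Fin n → Fin n → Set) (pat : ℕ → Fin r) :
             ℕ → Fin n → Fin n → List (Fin n) → Set where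
  stay : ∀ {s u} → PatPath R pat s u u (u ∷ [])
  edge∷ : ∀ {s u w v vs} → R (pat s) u w → PatPath R pat (suc s) w v vs → u ∉ vs → PatPath R pat s u v (u ∷ vs)

module Grow {n r : ℕ} (adj : Adjacency n r) (ℓ′ : ℕ) where

  ℓ : ℕ
  ℓ = suc ℓ′

  infix 4 _≈_
  _≈_ : ℕ → ℕ → Set
  i ≈ j = i % ℓ ≡ j % ℓ

  ≈-suc : ∀ {i j} → i ≈ j → suc i ≈ suc j
  ≈-suc {i} {j} e = trans (%-distribˡ-+ 1 i ℓ) (trans (cong (λ z → (1 % ℓ + z) % ℓ) e) (sym (%-distribˡ-+ 1 j ℓ)))

  ≈-+ˡ : ∀ k {i j} → i ≈ j → k + i ≈ k + j
  ≈-+ˡ k {i} {j} e = trans (%-distribˡ-+ k i ℓ) (trans (cong (λ z → (k % ℓ + z) % ℓ) e) (sym (%-distribˡ-+ k j ℓ)))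

  ≈-*ˡ : ∀ k {i j} → i ≈ j → k * i ≈ k * j
  ≈-*ˡ k {i} {j} e = trans (%-distribˡ-* k i ℓ) (trans (cong (λ z → (k % ℓ * z) % ℓ) e) (sym (%-distribˡ-* k j ℓ)))

  ≈-multiples : ∀ {i j} k m → i + k * ℓ ≡ j + m * ℓ → i ≈ j
  ≈-multiples {i} {j} k m e = trans (sym ([m+kn]%n≡m%n i k ℓ)) (trans (cong (_% ℓ) e) ([m+kn]%n≡m%n j m ℓ))

  -- A tree is the list of its vertices with their depths, newest first; parents survive only in the
  -- derivation. An edge leaving depth `d` has colour `col d`.
  data Tree (col : ℕ → Fin r) (root : Fin n) : List (Fin n × ℕ) → Set where
    leaf : Tree col root ((root , 0) ∷ [])
    grow : ∀ {t u v d} → Tree col root t → (u , d) ∈ t → adj (col d) u v ≡ true → v ∉ map proj₁ t →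
           Tree col root ((v , suc d) ∷ t)

  verts : List (Fin n × ℕ) → List (Fin n)
  verts = map proj₁

  verts-unique : ∀ {col root t} → Tree col root t → Unique (verts t)
  verts-unique leaf = [] ∷ []
  verts-unique (grow T _ _ v∉) = All.tabulate (λ y∈ e → v∉ (subst (_∈ _) (sym e) y∈)) ∷ verts-unique T

  levelᵇ : ℕ → Fin n × ℕ → Bool
  levelᵇ i (_ , d) = ⌊ d % ℓ ≟ i % ℓ ⌋

  levelᵇ-true : ∀ i vd → levelᵇ i vd ≡ true → proj₂ vd ≈ i
  levelᵇ-true i (_ , d) p with d % ℓ ≟ i % ℓ
  ... | yes e = e

  ≈⇒levelᵇ : ∀ i v d → d ≈ i → levelᵇ i (v , d) ≡ true
  ≈⇒levelᵇ i v d e with d % ℓ ≟ i % ℓ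
  ... | yes _ = refl
  ... | no ¬e = ⊥-elim (¬e e)

  level : ℕ → List (Fin n × ℕ) → List (Fin n × ℕ)
  level i = filter (λ vd → levelᵇ i vd Bool.≟ true)

  -- Vertices whose depths agree modulo ℓ continue with the same colour, so a whole class can be
  -- extended at once, not just one level.
  class : ℕ → List (Fin n × ℕ) → VSet n
  class i t = mem (verts (level i t))

  class⁻ : ∀ i t {u} → class i t u ≡ true → ∃ λ d → (u , d) ∈ t × d ≈ i
  class⁻ i t {u} p with ∈-map⁻ proj₁ (mem⇒∈ (verts (level i t)) p)
  ... | (.u , d) , q , refl with ∈-filter⁻ (λ vd → levelᵇ i vd Bool.≟ true) {xs = t} q
  ...   | ud∈ , lev = d , ud∈ , levelᵇ-true i (u , d) lev

  class⇒verts : ∀ i t {u} → class i t u ≡ true → u ∈ verts t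
  class⇒verts i t p with class⁻ i t p
  ... | d , ud∈ , _ = ∈-map⁺ proj₁ ud∈

  length-level : ∀ i t → length (level i t) ≡ ∑ t (χ ∘ levelᵇ i)
  length-level i t = length-filter-χ (levelᵇ i) t

  level-unique : ∀ i t → Unique (verts t) → Unique (verts (level i t))
  level-unique i []       u = []
  level-unique i (vd ∷ t) (v∉ ∷ u) with levelᵇ i vd
  ... | false = level-unique i t u
  ... | true  = All.tabulate (λ y∈ → All.lookup v∉ (sub y∈)) ∷ level-unique i t u
    where
    sub : ∀ {y} → y ∈ verts (level i t) → y ∈ verts t
    sub p with ∈-map⁻ proj₁ p
    ... | yd , q , refl = ∈-map⁺ proj₁ (proj₁ (∈-filter⁻ (λ vd → levelᵇ i vd Bool.≟ true) {xs = t} q))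

  length-level≤class : ∀ i t → Unique (verts t) → length (level i t) ≤ card (class i t)
  length-level≤class i t u = ≤-trans (≤-reflexive (sym (length-map proj₁ (level i t))))
    (length≤card (verts (level i t)) (class i t) (level-unique i t u) ∈⇒mem)

  class≤length : ∀ i t → card (class i t) ≤ length t
  class≤length i t = ≤-trans (card-mem-≤ (verts (level i t))) (≤-trans (≤-reflexive (length-map proj₁ (level i t)))
    (length-filter _ t))

  largest-level : ∀ t → ∃ λ i → length t ≤ ℓ * length (level i t)
  largest-level t with F.any? (λ (i : Fin ℓ) → length t ≤? ℓ * length (level (toℕ i) t))
  ... | yes (i , p) = toℕ i , p
  ... | no ¬p = ⊥-elim (<-irrefl refl (begin-strict
    ℓ * length t <⟨ m<m+n _ (s≤s z≤n) ⟩
    ℓ * length t + ℓ ≤⟨ +-monoˡ-≤ ℓ (*-monoʳ-≤ ℓ (total t)) ⟩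
    ℓ * ∑ (allFin ℓ) (λ i → length (level (toℕ i) t)) + ℓ ≡⟨ cong₂ _+_ (sym (∑-*ˡ (allFin ℓ) ℓ _)) (sym (trans (∑-const (allFin ℓ) 1) (trans (*-identityʳ _) (length-allFin ℓ)))) ⟩
    ∑ (allFin ℓ) (λ i → ℓ * length (level (toℕ i) t)) + ∑ (allFin ℓ) (λ _ → 1) ≡⟨ ∑-+ (allFin ℓ) (λ i → ℓ * length (level (toℕ i) t)) (λ _ → 1) ⟨
    ∑ (allFin ℓ) (λ i → ℓ * length (level (toℕ i) t) + 1) ≤⟨ ∑-mono (allFin ℓ) (λ i → ≤-trans (≤-reflexive (+-comm _ 1)) (≰⇒> (λ q → ¬p (i , q)))) ⟩
    ∑ (allFin ℓ) (λ _ → length t) ≡⟨ trans (∑-const (allFin ℓ) (length t)) (cong (_* length t) (length-allFin ℓ)) ⟩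
    ℓ * length t ∎))
    where
    open ≤-Reasoning
    total : ∀ t → length t ≤ ∑ (allFin ℓ) (λ i → length (level (toℕ i) t))
    total t = begin
      length t ≡⟨ length≡∑1 t ⟩
      ∑ t (λ _ → 1) ≤⟨ ∑-mono t (λ (v , d) → ≤-trans (≤-reflexive (sym (own v d))) (∈-≤∑ {xs = allFin ℓ} (λ i → χ (levelᵇ (toℕ i) (v , d))) (∈-allFin (d mod ℓ)))) ⟩
      ∑ t (λ vd → ∑ (allFin ℓ) (λ i → χ (levelᵇ (toℕ i) vd))) ≡⟨ ∑-swap t (allFin ℓ) _ ⟩
      ∑ (allFin ℓ) (λ i → ∑ t (χ ∘ levelᵇ (toℕ i))) ≡⟨ ∑-cong (allFin ℓ) (λ i → sym (length-level (toℕ i) t)) ⟩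
      ∑ (allFin ℓ) (λ i → length (level (toℕ i) t)) ∎
      where
      own : ∀ v d → χ (levelᵇ (toℕ (d mod ℓ)) (v , d)) ≡ 1
      own v d = χ-true (≈⇒levelᵇ (toℕ (d mod ℓ)) v d (sym (trans (cong (_% ℓ) (F.toℕ-fromℕ< (m%n<n d ℓ))) (m%n%n≡m%n d ℓ))))

  Periodic : (ℕ → Fin r) → Set
  Periodic col = ∀ {i j} → i ≈ j → col i ≡ col j

  Avoids : List (Fin n) → List (Fin n × ℕ) → Set
  Avoids X t = ∀ {v} → v ∈ verts t → v ∉ X

  Inside : VSet n → List (Fin n × ℕ) → Set
  Inside W t = ∀ {v} → v ∈ verts t → W v ≡ true

  -- The largest class holds at least 1/ℓ of the tree and expands in `W` by more than `κ`; by the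
  -- hypothesis on `κ` this exceeds the tree and `X` together, so some neighbour is new.
  grow-expanding : ∀ {col root t} κ s W (X : List (Fin n)) → Periodic col → Tree col root t → Inside W t →
    Expanding adj κ s W → 1 ≤ length t → length t ≤ s → ℓ * (length t + length X) ≤ κ * length t →
    ∃ λ v → ∃ λ d → Tree col root ((v , suc d) ∷ t) × W v ≡ true × v ∉ X
  grow-expanding {col} {root} {t} κ s W X per T t⊆W expW t≥1 t≤s big
    with largest-level t
  ... | i , large with card-<⇒ (λ v → nbrs adj (col i) (class i t) v ∧ W v) (mem (verts t ++ X)) few
    where
    open ≤-Reasoning
    A≥ : length t ≤ ℓ * card (class i t)
    A≥ = ≤-trans large (*-monoʳ-≤ ℓ (length-level≤class i t (verts-unique T)))
    A≥1 : 1 ≤ card (class i t)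
    A≥1 with card (class i t) | A≥
    ... | suc _ | _ = s≤s z≤n
    ... | zero  | q = ⊥-elim (<⇒≱ t≥1 (subst (length t ≤_) (*-zeroʳ ℓ) q))
    few : card (mem (verts t ++ X)) < card (λ v → nbrs adj (col i) (class i t) v ∧ W v)
    few = ≤-<-trans (*-cancelˡ-≤ ℓ (begin
      ℓ * card (mem (verts t ++ X)) ≤⟨ *-monoʳ-≤ ℓ (card-mem-≤ (verts t ++ X)) ⟩
      ℓ * length (verts t ++ X) ≡⟨ cong (ℓ *_) (trans (length-++ (verts t)) (cong (_+ length X) (length-map proj₁ t))) ⟩
      ℓ * (length t + length X) ≤⟨ big ⟩
      κ * length t ≤⟨ *-monoʳ-≤ κ A≥ ⟩
      κ * (ℓ * card (class i t)) ≡⟨ swap₃ κ ℓ _ ⟩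
      ℓ * (κ * card (class i t)) ∎))
      (expW (col i) (class i t) (λ v p → t⊆W (class⇒verts i t p)) A≥1 (≤-trans (class≤length i t) t≤s))
  ...   | v , p , fresh with ∧-true⁻ (nbrs adj (col i) (class i t) v) p
  ...     | q , Wv with nbrs⁻ adj (col i) (class i t) q
  ...       | u , u∈ , a with class⁻ i t u∈
  ...         | d , ud∈ , d≈i = v , d , grow T ud∈ (subst (λ c → adj c u v ≡ true) (sym (per d≈i)) a)
                  (λ v∈ → ∉⇐mem fresh (∈-++⁺ˡ v∈)) , Wv , (λ v∈ → ∉⇐mem fresh (∈-++⁺ʳ (verts t) v∈))

  module Joined (u₁ b : ℕ) (u₁≤b : u₁ ≤ b)
    (joined : ∀ c A B → (∀ v → A v ≡ true → B v ≡ true → ⊥) → u₁ ≤ card A → b ≤ card B →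
              ∃ λ u → ∃ λ v → A u ≡ true × B v ≡ true × adj c u v ≡ true) where

    -- At least `b` vertices lie outside the tree and `X`, and a class of `u₁` vertices has an edge
    -- of the right colour to them.
    grow-joined : ∀ {col root t} i (X : List (Fin n)) → Periodic col → Tree col root t → u₁ ≤ length (level i t) →
      b + (length t + length X) ≤ n → ∃ λ v → ∃ λ d → Tree col root ((v , suc d) ∷ t) × v ∉ X × d ≈ i
    grow-joined {col} {root} {t} i X per T large room
      with joined (col i) (class i t) (λ v → not (mem (verts t ++ X) v))
             (λ v p q → ∉⇐mem (not-true⁻ _ q) (∈-++⁺ˡ (class⇒verts i t p)))
             (≤-trans large (length-level≤class i t (verts-unique T)))
             (+-cancelʳ-≤ (card (mem (verts t ++ X))) _ _ (begin
               b + card (mem (verts t ++ X)) ≤⟨ +-monoʳ-≤ b (card-mem-≤ (verts t ++ X)) ⟩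
               b + length (verts t ++ X) ≡⟨ cong (b +_) (trans (length-++ (verts t)) (cong (_+ length X) (length-map proj₁ t))) ⟩
               b + (length t + length X) ≤⟨ room ⟩
               n ≤⟨ card-complement (mem (verts t ++ X)) ⟩
               card (not ∘ mem (verts t ++ X)) + card (mem (verts t ++ X)) ∎))
      where open ≤-Reasoning
    ... | u , v , u∈ , v∉ , a with class⁻ i t u∈
    ...   | d , ud∈ , d≈i = v , d , grow T ud∈ (subst (λ c → adj c u v ≡ true) (sym (per d≈i)) a)
              (λ v∈ → ∉⇐mem (not-true⁻ _ v∉) (∈-++⁺ˡ v∈)) , (λ v∈ → ∉⇐mem (not-true⁻ _ v∉) (∈-++⁺ʳ (verts t) v∈)) , d≈i

    level-grow : ∀ i vd t → length (level i t) ≤ length (level i (vd ∷ t))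
    level-grow i vd t with levelᵇ i vd
    ... | true  = n≤1+n _
    ... | false = ≤-refl

    level-hit : ∀ i v d t → d ≈ i → length (level i ((v , d) ∷ t)) ≡ suc (length (level i t))
    level-hit i v d t e rewrite ≈⇒levelᵇ i v d e = refl

    fill-level : ∀ {col root t} m i (X : List (Fin n)) → Periodic col → Tree col root t → Avoids X t → u₁ ≤ length (level i t) →
      m + b + (length t + length X) ≤ n →
      ∃ λ t′ → Tree col root t′ × Avoids X t′ × m ≤ length (level (suc i) t′) × u₁ ≤ length (level i t′) × length t′ ≡ m + length t
    fill-level {t = t} zero i X per T av large room = t , T , av , z≤n , large , refl
    fill-level {t = t} (suc m) i X per T av large room
      with fill-level m i X per T av large (≤-trans (n≤1+n _) room)
    ... | t′ , T′ , av′ , filled , large′ , len with grow-joined i X per T′ large′ (begin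
            b + (length t′ + length X) ≡⟨ cong (λ z → b + (z + length X)) len ⟩
            b + (m + length t + length X) ≡⟨ shuffle b m (length t) (length X) ⟩
            m + b + (length t + length X) ≤⟨ n≤1+n _ ⟩
            suc m + b + (length t + length X) ≤⟨ room ⟩
            n ∎)
      where
      open ≤-Reasoning
      shuffle : ∀ b m x y → b + (m + x + y) ≡ m + b + (x + y)
      shuffle = solve-∀
    ...   | v , d , T″ , v∉X , d≈i = (v , suc d) ∷ t′ , T″ ,
            (λ { (here refl) → v∉X ; (there w∈) → av′ w∈ }) ,
            ≤-trans (s≤s filled) (≤-reflexive (sym (level-hit (suc i) v (suc d) t′ (≈-suc {d} {i} d≈i)))) ,
            ≤-trans large′ (level-grow i (v , suc d) t′) , cong suc len

    -- Since `u₁≤b`, a class filled with `b` vertices is large enough to fill the next one, so the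
    -- large class moves forward one residue per `b` new vertices.
    fill-levels : ∀ {col root t} g i (X : List (Fin n)) → Periodic col → Tree col root t → Avoids X t → u₁ ≤ length (level i t) →
      suc g * b + b + (length t + length X) ≤ n →
      ∃ λ t′ → Tree col root t′ × Avoids X t′ × b ≤ length (level (suc g + i) t′) × length t′ ≡ suc g * b + length t
    fill-levels {t = t} zero i X per T av large room
      with fill-level b i X per T av large (subst (λ z → z + b + (length t + length X) ≤ n) (+-identityʳ b) room)
    ... | t′ , T′ , av′ , filled , _ , len = t′ , T′ , av′ , filled , trans len (cong (_+ length t) (sym (+-identityʳ b)))
    fill-levels {t = t} (suc g) i X per T av large room
      with fill-levels g i X per T av large (≤-trans (+-monoˡ-≤ (length t + length X) (+-monoˡ-≤ b (m≤n+m (suc g * b) b))) room)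
    ... | t′ , T′ , av′ , filled , len with fill-level b (suc g + i) X per T′ av′ (≤-trans u₁≤b filled) (begin
            b + b + (length t′ + length X) ≡⟨ cong (λ z → b + b + (z + length X)) len ⟩
            b + b + (suc g * b + length t + length X) ≡⟨ shuffle b (suc g * b) (length t) (length X) ⟩
            suc (suc g) * b + b + (length t + length X) ≤⟨ room ⟩
            n ∎)
      where
      open ≤-Reasoning
      shuffle : ∀ b m x y → b + b + (m + x + y) ≡ b + m + b + (x + y)
      shuffle = solve-∀
    ...   | t″ , T″ , av″ , filled′ , _ , len′ = t″ , T″ , av″ , filled′ ,
              trans len′ (trans (cong (b +_) len) (sym (+-assoc b (suc g * b) (length t))))

  module Paths (R : Fin r → Fin n → Fin n → Set) (pat : ℕ → Fin r) (pat-mod : Periodic pat)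
    (adj⇒R : ∀ {c u v} → adj c u v ≡ true → R c u v) (adj-sym : ∀ {c u v} → adj c u v ≡ true → adj c v u ≡ true) where

    path-shift : ∀ {s s′ u v vs} → s ≈ s′ → PatPath R pat s u v vs → PatPath R pat s′ u v vs
    path-shift e stay = stay
    path-shift {s} {s′} e (edge∷ a p u∉) = edge∷ (subst (λ c → R c _ _) (pat-mod e) a) (path-shift (≈-suc {s} {s′} e) p) u∉

    -- Induction on the tree from its newest vertex: when that vertex is put in front of the
    -- continuation, the older part of the tree no longer contains it, and the path remains simple.
    descend : ∀ {a root t} → Tree (λ d → pat (a + d)) root t → ∀ {u w y d vs} → (u , d) ∈ t →
      R (pat (a + d)) u w → PatPath R pat (suc (a + d)) w y vs → (∀ {v} → v ∈ vs → v ∉ verts t) →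
      ∃ λ vs′ → PatPath R pat a root y vs′ × (∀ {v} → v ∈ vs′ → v ∈ verts t ⊎ v ∈ vs)
    descend {a} {root} leaf {w = w} {y = y} {vs = vs} (here refl) e p dis = root ∷ vs ,
      edge∷ (subst (λ i → R (pat i) root w) (+-identityʳ a) e) (subst (λ i → PatPath R pat (suc i) w y vs) (+-identityʳ a) p)
        (λ q → dis q (here refl)) ,
      λ { (here refl) → inj₁ (here refl) ; (there q) → inj₂ q }
    descend {a} {root} (grow {t = t} {u = u₀} {v = v} {d = d} T u₀∈ a₀ v∉) {w = w} {y = y} {vs = vs} (here refl) e p dis
      with descend T u₀∈ (adj⇒R a₀) (edge∷ (subst (λ i → R (pat i) v w) (+-suc a d) e)
             (subst (λ i → PatPath R pat (suc i) w y vs) (+-suc a d) p) (λ q → dis q (here refl)))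
             (λ { (here refl) → v∉ ; (there q) r → dis q (there r) })
    ... | vs′ , P , sub = vs′ , P , λ q → [ (λ x → inj₁ (there x)) , (λ { (here refl) → inj₁ (here refl) ; (there x) → inj₂ x }) ]′ (sub q)
    descend (grow T _ _ _) (there ud∈) e p dis with descend T ud∈ e p (λ q r → dis q (there r))
    ... | vs′ , P , sub = vs′ , P , λ q → [ (λ x → inj₁ (there x)) , inj₂ ]′ (sub q)

    -- Walking towards the root of a tree traverses the pattern forwards as the depth decreases;
    -- ℓ′ ≡ -1 (mod ℓ).
    ascend : ∀ {a root t y vs} → Tree (λ d → pat (a + ℓ′ * suc d)) root t → PatPath R pat a root y (root ∷ vs) →
      (∀ {v} → v ∈ vs → v ∉ verts t) → ∀ {u d} → (u , d) ∈ t → ∀ s → s ≈ a + ℓ′ * d →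
      ∃ λ vs′ → PatPath R pat s u y vs′ × (∀ {v} → v ∈ vs′ → v ∈ verts t ⊎ v ∈ vs)
    ascend {a} {root} {vs = vs} leaf p dis (here refl) s e = root ∷ vs ,
      path-shift {a} {s} (sym (trans e (cong (_% ℓ) (trans (cong (a +_) (*-zeroʳ ℓ′)) (+-identityʳ a))))) p ,
      λ { (here refl) → inj₁ (here refl) ; (there q) → inj₂ q }
    ascend {a} (grow {u = u₀} {v = v} {d = d} T u₀∈ a₀ v∉) p dis (here refl) s e
      with ascend T p (λ q r → dis q (there r)) u₀∈ (suc s) (trans (≈-suc {s} {a + ℓ′ * suc d} e)
             (≈-multiples {suc (a + ℓ′ * suc d)} {a + ℓ′ * d} 0 1 (eq a ℓ′ d)))
      where
      eq : ∀ a l d → suc (a + l * suc d) + 0 ≡ a + l * d + (suc l + 0)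
      eq = solve-∀
    ... | vs′ , P , sub = v ∷ vs′ , edge∷ (subst (λ c → R c v u₀) (sym (pat-mod {s} {a + ℓ′ * suc d} e)) (adj⇒R (adj-sym a₀))) P
            (λ q → [ v∉ , (λ r → dis r (here refl)) ]′ (sub q)) ,
            λ { (here refl) → inj₁ (here refl) ; (there q) → [ (λ x → inj₁ (there x)) , inj₂ ]′ (sub q) }
    ascend (grow T _ _ _) p dis (there ud∈) s e with ascend T p (λ q r → dis q (there r)) ud∈ s e
    ... | vs′ , P , sub = vs′ , P , λ q → [ (λ x → inj₁ (there x)) , inj₂ ]′ (sub q)

module Connect {n r : ℕ} (adj : Adjacency n r) (ℓ′ : ℕ) (pat : ℕ → Fin r) (pat-mod : Grow.Periodic adj ℓ′ pat)
  (R : Fin r → Fin n → Fin n → Set) (adj⇒R : ∀ {c u v} → adj c u v ≡ true → R c u v)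
  (adj-sym : ∀ {c u v} → adj c u v ≡ true → adj c v u ≡ true)
  (u₁ b : ℕ) (u₁≥1 : 1 ≤ u₁) (u₁≤b : u₁ ≤ b) (room : suc ℓ′ * b + b + (suc ℓ′ * u₁ + (2 + suc ℓ′ * u₁)) ≤ n)
  (joined : ∀ c A B → (∀ v → A v ≡ true → B v ≡ true → ⊥) → u₁ ≤ card A → b ≤ card B →
            ∃ λ u → ∃ λ v → A u ≡ true × B v ≡ true × adj c u v ≡ true) where

  open Grow adj ℓ′
  open Joined u₁ b u₁≤b joined
  open Paths R pat pat-mod adj⇒R adj-sym

  -- A tree of `a` vertices has to avoid itself, the two ends and a twin of at most a + 1 vertices:
  -- 2a + 3 ≤ 5a in all, while its largest class may have only a/ℓ vertices. At size ℓ u₁ that class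
  -- has `u₁` of them.
  κ s : ℕ
  κ = 5 * ℓ
  s = ℓ * u₁

  -- There are two sets `W` and `W′`, because the cores for the two ends may be computed with
  -- different edges masked.
  module Between {W W′ : VSet n} (expW : Expanding adj κ s W) (expW′ : Expanding adj κ s W′) {x y z z′ : Fin n}
    (Wz : W z ≡ true) (W′z′ : W′ z′ ≡ true) (z≢z′ : z ≢ z′) (z∉ : z ∉ x ∷ y ∷ []) (z′∉ : z′ ∉ x ∷ y ∷ [])
    (x≢y : x ≢ y) (p q : ℕ) (xz : R (pat p) x z) (z′y : R (pat q) z′ y) where

    ends : List (Fin n)
    ends = x ∷ y ∷ []

    -- The edge xz occupies position `p` and z′y position `q`. The forward tree continues from p +
    -- 1; the edge between depths d + 1 and d of the backward tree has position q - (d + 1), where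
    -- ℓ′ stands for -1.
    colF colB : ℕ → Fin r
    colF d = pat (suc p + d)
    colB d = pat (q + ℓ′ * suc d)

    colF-per : Periodic colF
    colF-per {i} {j} e = pat-mod (≈-+ˡ (suc p) {i} {j} e)

    colB-per : Periodic colB
    colB-per {i} {j} e = pat-mod (≈-+ˡ q {ℓ′ * suc i} {ℓ′ * suc j} (≈-*ˡ ℓ′ {suc i} {suc j} (≈-suc {i} {j} e)))

    -- Growing the trees in step keeps the part that each must avoid proportional to its own size.
    record Twins (m : ℕ) : Set where
      field
        {t t′}   : List (Fin n × ℕ)
        T        : Tree colF z t
        T′       : Tree colB z′ t′
        size     : length t ≡ suc m
        size′    : length t′ ≡ suc m
        inside   : Inside W t
        inside′  : Inside W′ t′
        avoids   : Avoids ends t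
        avoids′  : Avoids ends t′
        disjoint : Avoids (verts t) t′

    twins : ∀ m → suc m ≤ s → Twins m
    twins zero _ = record
      { T = leaf ; T′ = leaf ; size = refl ; size′ = refl
      ; inside = λ { (here refl) → Wz } ; inside′ = λ { (here refl) → W′z′ }
      ; avoids = λ { (here refl) → z∉ } ; avoids′ = λ { (here refl) → z′∉ }
      ; disjoint = λ { (here refl) (here e) → z≢z′ (sym e) } }
    twins (suc m) le = extend (twins m (≤-trans (n≤1+n _) le))
      where
      extend : Twins m → Twins (suc m)
      extend tw = first (grow-expanding κ s W (ends ++ verts t′) colF-per T inside expW (subst (1 ≤_) (sym size) (s≤s z≤n))
                           (≤-trans (≤-reflexive size) (≤-trans (n≤1+n _) le)) big)
        where
        open Twins tw
        open ≤-Reasoning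
        len++ : ∀ t → length (ends ++ verts t) ≡ 2 + length t
        len++ t = cong (2 +_) (length-map proj₁ t)
        budget : ∀ a b → b ≤ 2 * a + 3 → 1 ≤ a → ℓ * b ≤ κ * a
        budget a b b≤ 1≤a = begin
          ℓ * b ≤⟨ *-monoʳ-≤ ℓ b≤ ⟩
          ℓ * (2 * a + 3) ≤⟨ *-monoʳ-≤ ℓ (+-monoʳ-≤ (2 * a) (*-monoʳ-≤ 3 1≤a)) ⟩
          ℓ * (2 * a + 3 * a) ≡⟨ eq ℓ a ⟩
          κ * a ∎
          where
          eq : ∀ l a → l * (2 * a + 3 * a) ≡ 5 * l * a
          eq = solve-∀
        big : ℓ * (length t + length (ends ++ verts t′)) ≤ κ * length t
        big = budget (length t) _ (begin
          length t + length (ends ++ verts t′) ≡⟨ cong (length t +_) (trans (len++ t′) (cong (2 +_) (trans size′ (sym size)))) ⟩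
          length t + (2 + length t) ≤⟨ +-monoʳ-≤ (length t) (n≤1+n _) ⟩
          length t + (3 + length t) ≡⟨ eq (length t) ⟩
          2 * length t + 3 ∎) (subst (1 ≤_) (sym size) (s≤s z≤n))
          where
          eq : ∀ a → a + (3 + a) ≡ 2 * a + 3
          eq = solve-∀
        first : (∃ λ v → ∃ λ d → Tree colF z ((v , suc d) ∷ t) × W v ≡ true × v ∉ ends ++ verts t′) → Twins (suc m)
        first (v , d , T⁺ , Wv , v∉) = second (grow-expanding κ s W′ (ends ++ verts ((v , suc d) ∷ t)) colB-per T′ inside′ expW′
            (subst (1 ≤_) (sym size′) (s≤s z≤n)) (≤-trans (≤-reflexive size′) (≤-trans (n≤1+n _) le)) big′)
          where
          big′ : ℓ * (length t′ + length (ends ++ verts ((v , suc d) ∷ t))) ≤ κ * length t′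
          big′ = budget (length t′) _ (≤-reflexive (trans (cong (length t′ +_) (trans (len++ ((v , suc d) ∷ t))
                   (cong (3 +_) (trans size (sym size′))))) (eq (length t′)))) (subst (1 ≤_) (sym size′) (s≤s z≤n))
            where
            eq : ∀ a → a + (3 + a) ≡ 2 * a + 3
            eq = solve-∀
          second : (∃ λ v′ → ∃ λ d′ → Tree colB z′ ((v′ , suc d′) ∷ t′) × W′ v′ ≡ true × v′ ∉ ends ++ verts ((v , suc d) ∷ t)) →
                   Twins (suc m)
          second (v′ , d′ , T′⁺ , W′v′ , v′∉) = record
            { T = T⁺ ; T′ = T′⁺ ; size = cong suc size ; size′ = cong suc size′
            ; inside = λ { (here refl) → Wv ; (there k) → inside k }
            ; inside′ = λ { (here refl) → W′v′ ; (there k) → inside′ k }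
            ; avoids = λ { (here refl) k → v∉ (∈-++⁺ˡ k) ; (there j) → avoids j }
            ; avoids′ = λ { (here refl) k → v′∉ (∈-++⁺ˡ k) ; (there j) → avoids′ j }
            ; disjoint = λ { (here refl) k → v′∉ (∈-++⁺ʳ ends k)
                           ; (there j) (here refl) → v∉ (∈-++⁺ʳ ends j)
                           ; (there j) (there k) → disjoint j k } }

    path : ∃ λ vs → PatPath R pat p x y vs
    path with m , eqs ← pred s , suc-pred s {{>-nonZero (*-mono-≤ {1} {ℓ} {1} {u₁} (s≤s z≤n) u₁≥1)}} = finish (twins m (≤-reflexive eqs))
      where
      finish : Twins m → ∃ λ vs → PatPath R pat p x y vs
      finish tw with largest-level (Twins.t tw) | largest-level (Twins.t′ tw)
      ... | i , large | j , large′ = use-filled (fill-levels g j (ends ++ verts t) colB-per T′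
              (λ v∈ k → [ avoids′ v∈ , disjoint v∈ ]′ (∈-++⁻ ends k)) (big t′ j size′ large′) room′)
        where
        open Twins tw
        open ≤-Reasoning
        big : ∀ t i → length t ≡ suc m → length t ≤ ℓ * length (level i t) → u₁ ≤ length (level i t)
        big t i sz lg = *-cancelˡ-≤ ℓ (≤-trans (≤-reflexive (trans (sym eqs) (sym sz))) lg)
        -- The number of further levels to fill, so that the pattern positions reached by the
        -- two trees fit together modulo ℓ.
        S g₀ g : ℕ
        S  = suc (suc p + i)
        g₀ = q + ℓ′ * (j + S)
        g  = (g₀ + ℓ′) % ℓ
        g≈ : suc g ≈ g₀
        g≈ = trans (≈-suc {g} {g₀ + ℓ′} (m%n%n≡m%n (g₀ + ℓ′) ℓ)) (≈-multiples {suc (g₀ + ℓ′)} {g₀} 0 1 (eq g₀ ℓ′))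
          where
          eq : ∀ a l → suc (a + l) + 0 ≡ a + (suc l + 0)
          eq = solve-∀
        -- `S` is the position after the joining edge, which leaves class `i` of the forward tree.
        -- As `g₀` is q - (j + S) modulo ℓ, a backward vertex of depth class g₀ + j continues at q -
        -- (g₀ + j), that is at `S`.
        match : S ≈ q + ℓ′ * (suc g + j)
        match = trans (sym (≈-multiples {q + ℓ′ * (g₀ + j)} {S} (S + S) (q + ℓ′ * j + ℓ * S) (eq q ℓ′ j S)))
                      (≈-+ˡ q {ℓ′ * (g₀ + j)} {ℓ′ * (suc g + j)} (≈-*ˡ ℓ′ {g₀ + j} {suc g + j} (trans (cong (_% ℓ) (+-comm g₀ j))
                        (trans (≈-+ˡ j {g₀} {suc g} (sym g≈)) (cong (_% ℓ) (+-comm j (suc g)))))))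
          where
          eq : ∀ q l j S → q + l * (q + l * (j + S) + j) + (S + S) * suc l ≡ S + (q + l * j + suc l * S) * suc l
          eq = solve-∀
        room′ : suc g * b + b + (length t′ + length (ends ++ verts t)) ≤ n
        room′ = begin
          suc g * b + b + (length t′ + length (ends ++ verts t))
            ≤⟨ +-mono-≤ (+-monoˡ-≤ b (*-monoˡ-≤ b (m%n<n (g₀ + ℓ′) ℓ)))
                 (≤-reflexive (cong₂ _+_ (trans size′ eqs) (cong (2 +_) (trans (length-map proj₁ t) (trans size eqs))))) ⟩
          ℓ * b + b + (s + (2 + s)) ≤⟨ room ⟩
          n ∎
        use-filled : (∃ λ t″ → Tree colB z′ t″ × Avoids (ends ++ verts t) t″ × b ≤ length (level (suc g + j) t″) ×
                       length t″ ≡ suc g * b + length t′) → ∃ λ vs → PatPath R pat p x y vs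
        use-filled (t″ , T″ , av″ , filled , _)
          with joined (colF i) (class i t) (class (suc g + j) t″)
                 (λ v a c → av″ (class⇒verts (suc g + j) t″ c) (∈-++⁺ʳ ends (class⇒verts i t a)))
                 (≤-trans (big t i size large) (length-level≤class i t (verts-unique T)))
                 (≤-trans filled (length-level≤class (suc g + j) t″ (verts-unique T″)))
        ... | u , u′ , u∈ , u′∈ , a with class⁻ i t u∈ | class⁻ (suc g + j) t″ u′∈
        ...   | d , ud∈ , d≈i | d′ , ud′∈ , d′≈ = assemble
                (ascend T″ (edge∷ z′y stay (λ { (here e) → z′∉ (there (here e)) })) (λ { (here refl) k → av″ k (there (here refl)) })
                  ud′∈ (suc (suc p + d)) meet)
          where
          meet : suc (suc p + d) ≈ q + ℓ′ * d′
          meet = trans (≈-+ˡ (suc (suc p)) {d} {i} d≈i) (trans match (≈-+ˡ q {ℓ′ * (suc g + j)} {ℓ′ * d′} (≈-*ˡ ℓ′ {suc g + j} {d′} (sym d′≈))))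
          assemble : (∃ λ vs′ → PatPath R pat (suc (suc p + d)) u′ y vs′ × (∀ {v} → v ∈ vs′ → v ∈ verts t″ ⊎ v ∈ y ∷ [])) →
                     ∃ λ vs → PatPath R pat p x y vs
          assemble (vs , P , sub)
            with descend T ud∈ (subst (λ c → R c u u′) (colF-per (sym d≈i)) (adj⇒R a)) P
                   (λ k l → [ (λ v∈ → av″ v∈ (∈-++⁺ʳ ends l)) , (λ { (here refl) → avoids l (there (here refl)) }) ]′ (sub k))
          ... | vs′ , P′ , sub′ = x ∷ vs′ , edge∷ xz P′ (λ k → [ (λ l → avoids l (here refl)) ,
                    (λ l → [ (λ v∈ → av″ v∈ (here refl)) , (λ { (here e) → x≢y e }) ]′ (sub l)) ]′ (sub′ k))

-- The random labelled graph

length-cartesianProduct : {X Y : Set} (xs : List X) (ys : List Y) → length (cartesianProduct xs ys) ≡ length xs * length ys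
length-cartesianProduct xs ys = trans (length≡∑1 (cartesianProduct xs ys)) (trans (∑-cartesianProduct xs ys _)
  (trans (∑-cong xs (λ _ → sym (length≡∑1 ys))) (∑-const xs (length ys))))

∏≡0⇐ : {X : Set} {xs : List X} {x : X} (h : X → ℕ) → x ∈ xs → h x ≡ 0 → ∏ xs h ≡ 0
∏≡0⇐ {xs = y ∷ ys} h (here refl) e = cong (_* ∏ ys h) e
∏≡0⇐ {xs = y ∷ ys} h (there x∈) e = trans (cong (h y *_) (∏≡0⇐ h x∈ e)) (*-zeroʳ (h y))

∏-antitone : {X : Set} (xs ys : List X) (h : X → ℕ) → (∀ x → h x ≤ 1) → (∀ {x} → x ∈ ys → x ∈ xs) → ∏ xs h ≤ ∏ ys h
∏-antitone xs ys h h≤1 sub with ∏ ys h in eq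
... | suc _ = ≤-trans (∏≤1 xs h h≤1) (s≤s z≤n)
... | zero with ∏≡0⇒ ys h eq
...   | y , y∈ , e = ≤-reflexive (∏≡0⇐ h (sub y∈) e)

2xy≤x²+y² : ∀ x y → 2 * (x * y) ≤ x * x + y * y
2xy≤x²+y² x y with ≤-total x y
... | inj₁ x≤y with m≤n⇒∃[o]m+o≡n x≤y
...   | k , refl = ≤-trans (m≤m+n _ (k * k)) (≤-reflexive (eq x k))
  where
  eq : ∀ x k → 2 * (x * (x + k)) + k * k ≡ x * x + (x + k) * (x + k)
  eq = solve-∀
2xy≤x²+y² x y | inj₂ y≤x with m≤n⇒∃[o]m+o≡n y≤x
...   | k , refl = ≤-trans (m≤m+n _ (k * k)) (≤-reflexive (eq y k))
  where
  eq : ∀ y k → 2 * ((y + k) * y) + k * k ≡ (y + k) * (y + k) + y * y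
  eq = solve-∀

∑χ-not : {X : Set} (xs : List X) (P : X → Bool) → ∑ xs (χ ∘ P) + ∑ xs (χ ∘ not ∘ P) ≡ length xs
∑χ-not []       P = refl
∑χ-not (x ∷ xs) P with P x
... | true  = cong suc (∑χ-not xs P)
... | false = trans (+-suc _ _) (cong suc (∑χ-not xs P))

density-not : {X : Set} (xs : List X) (P : X → Bool) (a a′ : ℕ) → (a + a′) * ∑ xs (χ ∘ P) ≡ a * length xs →
              (a + a′) * ∑ xs (χ ∘ not ∘ P) ≡ a′ * length xs
density-not xs P a a′ e = +-cancelˡ-≡ (a * length xs) _ _ (begin
  a * length xs + (a + a′) * ∑ xs (χ ∘ not ∘ P) ≡⟨ cong (_+ (a + a′) * ∑ xs (χ ∘ not ∘ P)) e ⟨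
  (a + a′) * ∑ xs (χ ∘ P) + (a + a′) * ∑ xs (χ ∘ not ∘ P) ≡⟨ *-distribˡ-+ (a + a′) _ _ ⟨
  (a + a′) * (∑ xs (χ ∘ P) + ∑ xs (χ ∘ not ∘ P)) ≡⟨ cong ((a + a′) *_) (∑χ-not xs P) ⟩
  (a + a′) * length xs ≡⟨ *-distribʳ-+ (length xs) a a′ ⟩
  a * length xs + a′ * length xs ∎)
  where open ≡-Reasoning

∑-allFin-suc : ∀ n (h : Fin (suc n) → ℕ) → ∑ (allFin (suc n)) h ≡ h F.zero + ∑ (allFin n) (h ∘ F.suc)
∑-allFin-suc n h = cong (h F.zero +_) (trans (cong (λ l → ∑ l h) (sym (map-tabulate (λ i → i) F.suc))) (∑-map F.suc (allFin n) h))

count-below : ∀ M t → t ≤ M → ∑ (allFin M) (λ a → χ (toℕ a <ᵇ t)) ≡ t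
count-below M       zero    t≤M = trans (∑-const (allFin M) 0) (*-zeroʳ (length (allFin M)))
count-below (suc M) (suc t) (s≤s t≤M) = trans (∑-allFin-suc M (λ a → χ (toℕ a <ᵇ suc t))) (cong suc (count-below M t t≤M))

count-equal : ∀ r (c : Fin r) → ∑ (allFin r) (λ c′ → χ ⌊ c F.≟ c′ ⌋) ≡ 1
count-equal (suc r) F.zero = trans (∑-allFin-suc r (λ c′ → χ ⌊ F.zero F.≟ c′ ⌋)) (cong suc (trans (∑-const (allFin r) 0) (*-zeroʳ (length (allFin r)))))
count-equal (suc r) (F.suc c) = trans (∑-allFin-suc r (λ c′ → χ ⌊ F.suc c F.≟ c′ ⌋)) (trans (∑-cong (allFin r) shift) (count-equal r c))
  where
  shift : ∀ c′ → χ ⌊ F.suc c F.≟ F.suc c′ ⌋ ≡ χ ⌊ c F.≟ c′ ⌋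
  shift c′ with c F.≟ c′
  ... | yes _ = refl
  ... | no _  = refl

bools : List Bool
bools = true ∷ false ∷ []

eqᵇ : Bool → Bool → Bool
eqᵇ true  b = b
eqᵇ false b = not b

eqV : {n : ℕ} → Vec Bool n → Vec Bool n → Bool
eqV []      []      = true
eqV (a ∷ v) (b ∷ w) = eqᵇ a b ∧ eqV v w

eqV-sound : {n : ℕ} (v w : Vec Bool n) → eqV v w ≡ true → v ≡ w
eqV-sound []          []          p = refl
eqV-sound (true ∷ v)  (true ∷ w)  p = cong (true ∷_) (eqV-sound v w p)
eqV-sound (false ∷ v) (false ∷ w) p = cong (false ∷_) (eqV-sound v w p)

eqV-refl : {n : ℕ} (v : Vec Bool n) → eqV v v ≡ true
eqV-refl []          = refl
eqV-refl (true ∷ v)  = eqV-refl v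
eqV-refl (false ∷ v) = eqV-refl v

∑-eqV : {n : ℕ} (w : Vec Bool n) → ∑ (allVecs bools n) (λ v → χ (eqV v w)) ≡ 1
∑-eqV []      = refl
∑-eqV {suc n} (true ∷ w)  = trans (∑-allVecs bools n _) (trans (cong₂ _+_ (∑-eqV w)
  (trans (+-identityʳ _) (trans (∑-const (allVecs bools n) 0) (*-zeroʳ (length (allVecs bools n)))))) refl)
∑-eqV {suc n} (false ∷ w) = trans (∑-allVecs bools n _) (trans (cong₂ _+_
  (trans (∑-const (allVecs bools n) 0) (*-zeroʳ (length (allVecs bools n)))) (+-identityʳ _)) (∑-eqV w))

∑-select : {n : ℕ} (w : Vec Bool n) (h : Vec Bool n → ℕ) → ∑ (allVecs bools n) (λ v → χ (eqV v w) * h v) ≡ h w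
∑-select {n} w h = trans (∑-cong (allVecs bools n) at) (trans (∑-*ʳ (allVecs bools n) _ (h w))
  (trans (cong (_* h w) (∑-eqV w)) (+-identityʳ _)))
  where
  at : ∀ v → χ (eqV v w) * h v ≡ χ (eqV v w) * h w
  at v with eqV v w in eq
  ... | false = refl
  ... | true rewrite eqV-sound v w eq = refl

without : {n : ℕ} → List (Fin n) → VSet n → VSet n
without us W v = not (mem us v) ∧ W v

without-∉ : {n : ℕ} (us : List (Fin n)) (W : VSet n) {v : Fin n} → without us W v ≡ true → v ∉ us
without-∉ us W {v} p = ∉⇐mem (not-true⁻ _ (proj₁ (∧-true⁻ (not (mem us v)) p)))

without-∈ : {n : ℕ} (us : List (Fin n)) (W : VSet n) {v : Fin n} → without us W v ≡ true → W v ≡ true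
without-∈ us W {v} p = proj₂ (∧-true⁻ (not (mem us v)) p)

without⁺ : {n : ℕ} (us : List (Fin n)) (W : VSet n) {v : Fin n} → v ∉ us → W v ≡ true → without us W v ≡ true
without⁺ us W {v} v∉ Wv with mem us v in eq
... | true  = ⊥-elim (v∉ (mem⇒∈ us eq))
... | false = Wv

card-without : {n : ℕ} (us : List (Fin n)) (W : VSet n) → card W ≤ card (without us W) + length us
card-without us W = ≤-trans (card-cover W (without us W) (mem us) split) (+-monoʳ-≤ _ (card-mem-≤ us))
  where
  split : ∀ v → W v ≡ true → without us W v ≡ true ⊎ mem us v ≡ true
  split v p with mem us v
  ... | true  = inj₂ refl
  ... | false = inj₁ p

full : {n : ℕ} → VSet n
full _ = true

card-without-full : {n : ℕ} (us : List (Fin n)) → Unique us → card (without us full) + length us ≡ n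
card-without-full {n} us u = ≤-antisym
  (≤-trans (+-monoʳ-≤ _ (length≤card us (mem us) u ∈⇒mem))
    (≤-trans (card-disjoint (without us full) (mem us) full (λ _ _ → refl) (λ _ _ → refl)
               (λ v p q → without-∉ us full p (mem⇒∈ us q))) (≤-reflexive card-all)))
  (≤-trans (≤-reflexive (sym card-all)) (card-without us full))

-- A vector of types encodes an ordered pair of disjoint vertex sets, so a union bound over such
-- pairs is a sum over `allVecs`, where product weights can be used for counting.
data Ty : Set where
  inA inB rest : Ty

isA isB : Ty → Bool
isA inA = true
isA _   = false
isB inB = true
isB _   = false

tys : List Ty
tys = inA ∷ inB ∷ rest ∷ []

∈-tys : ∀ t → t ∈ tys
∈-tys inA  = here refl
∈-tys inB  = there (here refl)
∈-tys rest = there (there (here refl))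

-- Each edge gets a time in Fin M, M = D m, and a colour.  An edge is
-- early if its time is < m (probability 1/D) and soon if its time is < 2m.
module Model (n n′ n″ r D″ m N : ℕ) (n≡ : n ≡ suc n′) (n′≡ : n′ ≡ suc n″) (m≥1 : 1 ≤ m) (r≥1 : 1 ≤ r) (E : Fin n → Fin n → Fin N)
  (E-sym : ∀ u v → E u v ≡ E v u)
  (E-inj : ∀ {u v u′ v′} → u ≢ v → u′ ≢ v′ → E u v ≡ E u′ v′ → (u ≡ u′ × v ≡ v′) ⊎ (u ≡ v′ × v ≡ u′)) where

  D′ D M : ℕ
  D′ = suc D″
  D  = suc D′
  M  = D * m

  Λ : Set
  Λ = Fin M × Fin r

  Λs : List Λ
  Λs = cartesianProduct (allFin M) (allFin r)

  Labelling : Set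
  Labelling = Vec Λ N

  Ω : List Labelling
  Ω = allVecs Λs N

  total : ℕ
  total = ∑ Ω (λ _ → 1)

  #Λ : length Λs ≡ M * r
  #Λ = trans (length-cartesianProduct (allFin M) (allFin r)) (cong₂ _*_ (length-allFin M) (length-allFin r))

  instance
    #Λ≢0 : NonZero (length Λs)
    #Λ≢0 = >-nonZero (subst (1 ≤_) (sym #Λ) (*-mono-≤ {1} {M} {1} {r} (*-mono-≤ {1} {D} {1} {m} (s≤s z≤n) m≥1) r≥1))

  earlyᵇ soonᵇ : Λ → Bool
  earlyᵇ (a , _) = toℕ a <ᵇ m
  soonᵇ  (a , _) = toℕ a <ᵇ 2 * m

  hasᵇ : Fin r → Λ → Bool
  hasᵇ c λc = earlyᵇ λc ∧ ⌊ c F.≟ proj₂ λc ⌋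

  late soon notSoon : Λ → ℕ
  late    = χ ∘ not ∘ earlyᵇ
  soon    = χ ∘ soonᵇ
  notSoon = χ ∘ not ∘ soonᵇ

  lacks : Fin r → Λ → ℕ
  lacks c = χ ∘ not ∘ hasᵇ c

  private
    count-time : ∀ t → t ≤ M → ∑ Λs (λ λc → χ (toℕ (proj₁ λc) <ᵇ t)) ≡ t * r
    count-time t t≤M = trans (∑-cartesianProduct (allFin M) (allFin r) _)
      (trans (∑-cong (allFin M) (λ a → trans (∑-const (allFin r) _) (trans (cong (_* χ (toℕ a <ᵇ t)) (length-allFin r)) (*-comm r _))))
      (trans (∑-*ʳ (allFin M) _ r) (cong (_* r) (count-below M t t≤M))))

    shuffle : ∀ d k m r → d * (k * m * r) ≡ k * (d * m * r)
    shuffle = solve-∀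

  density-early : D * ∑ Λs (χ ∘ earlyᵇ) ≡ 1 * length Λs
  density-early = trans (cong (D *_) (trans (count-time m (m≤m+n m _)) (cong (_* r) (sym (*-identityˡ m)))))
    (trans (shuffle D 1 m r) (cong (1 *_) (sym #Λ)))

  density-soon : D * ∑ Λs soon ≡ 2 * length Λs
  density-soon = trans (cong (D *_) (count-time (2 * m) (*-monoˡ-≤ m (s≤s (s≤s (z≤n {D″}))))))
    (trans (shuffle D 2 m r) (cong (2 *_) (sym #Λ)))

  density-late : D * ∑ Λs late ≡ D′ * length Λs
  density-late = density-not Λs earlyᵇ 1 D′ density-early

  density-notSoon : D * ∑ Λs notSoon ≡ D″ * length Λs
  density-notSoon = density-not Λs soonᵇ 2 D″ density-soon

  -- An edge is early and of a given colour with probability 1/(D r) = 1/(Y + 1).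
  Y : ℕ
  Y = pred (D * r)

  suc-Y : suc Y ≡ D * r
  suc-Y = suc-pred (D * r) {{>-nonZero (*-mono-≤ {1} {D} {1} {r} (s≤s z≤n) r≥1)}}

  density-lacks : ∀ c → suc Y * ∑ Λs (lacks c) ≡ Y * length Λs
  density-lacks c = density-not Λs (hasᵇ c) 1 Y (begin
    suc Y * ∑ Λs (χ ∘ hasᵇ c) ≡⟨ cong₂ _*_ suc-Y count ⟩
    D * r * m ≡⟨ eq D r m ⟩
    1 * (M * r) ≡⟨ cong (1 *_) #Λ ⟨
    1 * length Λs ∎)
    where
    open ≡-Reasoning
    eq : ∀ d r m → d * r * m ≡ 1 * (d * m * r)
    eq = solve-∀
    χ-∧ : ∀ a b → χ (a ∧ b) ≡ χ a * χ b
    χ-∧ true  b = sym (+-identityʳ (χ b))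
    χ-∧ false b = refl
    count : ∑ Λs (χ ∘ hasᵇ c) ≡ m
    count = trans (∑-cartesianProduct (allFin M) (allFin r) _)
      (trans (∑-cong (allFin M) (λ a → trans (∑-cong (allFin r) (λ c′ → χ-∧ (toℕ a <ᵇ m) ⌊ c F.≟ c′ ⌋))
        (trans (∑-*ˡ (allFin r) (χ (toℕ a <ᵇ m)) (λ c′ → χ ⌊ c F.≟ c′ ⌋)) (trans (cong (χ (toℕ a <ᵇ m) *_) (count-equal r c)) (*-identityʳ _)))))
      (count-below M m (m≤m+n m _)))

  late≤1 : ∀ x → late x ≤ 1
  late≤1 x = χ≤1 _

  -- Stars and isolated vertices

  star : Fin n → VSet n → List (Fin N)
  star x W = map (E x) (members W)

  length-star : ∀ x W → length (star x W) ≡ card W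
  length-star x W = trans (length-map (E x) (members W)) (length-members W)

  ∈-star⁻ : ∀ {x W e} → e ∈ star x W → ∃ λ v → W v ≡ true × e ≡ E x v
  ∈-star⁻ {x} {W} p with ∈-map⁻ (E x) p
  ... | v , v∈ , e = v , ∈-members⁻ W v∈ , e

  star-unique : ∀ x W → (∀ {v} → W v ≡ true → x ≢ v) → Unique (star x W)
  star-unique x W x≢ = Unique-map inj (members-unique W)
    where
    inj : ∀ {u v} → u ∈ members W → v ∈ members W → E x u ≡ E x v → u ≡ v
    inj u∈ v∈ e with E-inj (x≢ (∈-members⁻ W u∈)) (x≢ (∈-members⁻ W v∈)) e
    ... | inj₁ (_ , q) = q
    ... | inj₂ (p , q) = trans q p

  others : List (Fin n) → VSet n
  others us = without us full

  others-≢ : ∀ us {u v} → others us v ≡ true → u ∈ us → u ≢ v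
  others-≢ us p u∈ refl = without-∉ us full p u∈

  deg-late : Fin n → VSet n → Labelling → ℕ
  deg-late x W f = ∏ (star x W) (λ e → late (lookup f e))

  isolated : Fin n → Labelling → ℕ
  isolated x f = deg-late x (others (x ∷ [])) f

  card-others₁ : ∀ x → card (others (x ∷ [])) ≡ n′
  card-others₁ x = +-cancelʳ-≡ 1 _ _ (trans (card-without-full (x ∷ []) ([] ∷ [])) (trans n≡ (+-comm 1 n′)))

  card-others₂ : ∀ {x y} → x ≢ y → card (others (x ∷ y ∷ [])) ≡ n″
  card-others₂ x≢y = +-cancelʳ-≡ 2 _ _ (trans (card-without-full (_ ∷ _ ∷ []) ((x≢y ∷ []) ∷ [] ∷ [])) (trans n≡ (trans (cong suc n′≡) (+-comm 2 n″))))

  -- A/B = (1 - 1/D)^(n-1) is the probability that a given vertex is isolated in the early graph.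
  A B : ℕ
  A = D′ ^ n′
  B = D ^ n′

  ∑-density′ : (Es : List (Fin N)) (g : Λ → ℕ) (a b : ℕ) → b * ∑ Λs g ≡ a * length Λs → Unique Es →
    b ^ length Es * ∑ Ω (λ f → ∏ Es (λ e → g (lookup f e))) ≡ a ^ length Es * total
  ∑-density′ Es g a b dens u = trans
    (cong (b ^ length Es *_) (∑-cong Ω (λ f → sym (+-identityʳ (∏ Es (λ e → g (lookup f e)))))))
    (∑-density Λs Es (λ _ → 1) g a b dens u (All.universal (λ _ _ _ → refl) Es))

  isolated-sum : ∀ x → B * ∑ Ω (isolated x) ≡ A * total
  isolated-sum x = subst (λ k → D ^ k * ∑ Ω (isolated x) ≡ D′ ^ k * total) (trans (length-star x W) (card-others₁ x))
    (∑-density′ (star x W) late D′ D density-late (star-unique x W (λ p → others-≢ (x ∷ []) p (here refl))))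
    where W = others (x ∷ [])

  isolated² : ∀ x f → isolated x f * isolated x f ≤ isolated x f
  isolated² x f = ≤-trans (*-monoʳ-≤ (isolated x f) (∏≤1 (star x (others (x ∷ []))) (λ e → late (lookup f e)) (λ e → late≤1 (lookup f e)))) (≤-reflexive (*-identityʳ _))

  -- The two stars share only the edge xy. Dropping it from the second star leaves n′ + n″
  -- independent edges, one fewer than in two full stars; this is the factor D/D′ against (A/B)².
  isolated-pair : ∀ {x y} → x ≢ y → D′ * (B * B) * ∑ Ω (λ f → isolated x f * isolated y f) ≤ D * (A * A) * total
  isolated-pair {x} {y} x≢y = begin
    D′ * (B * B) * ∑ Ω (λ f → isolated x f * isolated y f)
      ≤⟨ *-monoʳ-≤ (D′ * (B * B)) (∑-mono Ω (λ f → ≤-trans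
           (*-monoʳ-≤ (isolated x f) (∏-antitone (star y (others (y ∷ []))) Ey (λ e → late (lookup f e)) (λ e → late≤1 (lookup f e)) sub))
           (≤-reflexive (sym (∏-++ Ex Ey (λ e → late (lookup f e))))))) ⟩
    D′ * (B * B) * S
      ≡⟨ cong (λ k → D′ * (B * D ^ k) * S) n′≡ ⟩
    D′ * (B * (D * D ^ n″)) * S
      ≡⟨ e₁ D′ B D (D ^ n″) S ⟩
    D * D′ * (B * D ^ n″ * S)
      ≡⟨ cong (λ z → D * D′ * (z * S)) (^-distribˡ-+-* D n′ n″) ⟨
    D * D′ * (D ^ (n′ + n″) * S)
      ≡⟨ cong (λ k → D * D′ * (D ^ k * S)) len ⟨
    D * D′ * (D ^ length (Ex ++ Ey) * S)
      ≡⟨ cong (D * D′ *_) (∑-density′ (Ex ++ Ey) late D′ D density-late uniq) ⟩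
    D * D′ * (D′ ^ length (Ex ++ Ey) * total)
      ≡⟨ cong (λ k → D * D′ * (D′ ^ k * total)) len ⟩
    D * D′ * (D′ ^ (n′ + n″) * total)
      ≡⟨ cong (λ z → D * D′ * (z * total)) (^-distribˡ-+-* D′ n′ n″) ⟩
    D * D′ * (A * D′ ^ n″ * total)
      ≡⟨ e₂ D D′ A (D′ ^ n″) total ⟩
    D * (A * D′ ^ suc n″) * total
      ≡⟨ cong (λ k → D * (A * D′ ^ k) * total) n′≡ ⟨
    D * (A * A) * total ∎
    where
    open ≤-Reasoning
    Ex = star x (others (x ∷ []))
    Ey = star y (others (y ∷ x ∷ []))
    S = ∑ Ω (λ f → ∏ (Ex ++ Ey) (λ e → late (lookup f e)))
    sub : ∀ {e} → e ∈ Ey → e ∈ star y (others (y ∷ []))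
    sub p with ∈-map⁻ (E y) p
    ... | v , v∈ , refl = ∈-map⁺ (E y) (∈-members⁺ (others (y ∷ [])) (without⁺ (y ∷ []) full
            (λ { (here e) → without-∉ (y ∷ x ∷ []) full (∈-members⁻ _ v∈) (here e) }) refl))
    len : length (Ex ++ Ey) ≡ n′ + n″
    len = trans (length-++ Ex) (cong₂ _+_ (trans (length-star x _) (card-others₁ x)) (trans (length-star y _) (card-others₂ (≢-sym x≢y))))
    uniq : Unique (Ex ++ Ey)
    uniq = Unique.++⁺ (star-unique x _ (λ p → others-≢ (x ∷ []) p (here refl))) (star-unique y _ (λ p → others-≢ (y ∷ x ∷ []) p (here refl))) dis
      where
      dis : ∀ {e} → e ∈ Ex × e ∈ Ey → ⊥
      dis (p , q) with ∈-star⁻ p | ∈-star⁻ q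
      ... | u , Wu , refl | v , Wv , e with E-inj (others-≢ (x ∷ []) Wu (here refl)) (others-≢ (y ∷ x ∷ []) Wv (here refl)) e
      ...   | inj₁ (xy , _) = x≢y xy
      ...   | inj₂ (xv , _) = others-≢ (y ∷ x ∷ []) Wv (there (here refl)) xv
    e₁ : ∀ d b c k s → d * (b * (c * k)) * s ≡ c * d * (b * k * s)
    e₁ = solve-∀
    e₂ : ∀ c d a k t → c * d * (a * k * t) ≡ c * (a * (d * k)) * t
    e₂ = solve-∀

  #isolated : Labelling → ℕ
  #isolated f = ∑ (allFin n) (λ x → isolated x f)

  -- Since 0 ^ 0 is 1, this is the indicator that no vertex is isolated.
  β₁ : Labelling → ℕ
  β₁ f = 0 ^ #isolated f

  β₁-zero : ∀ f → β₁ f ≡ 0 → ∃ λ x → ∀ v → x ≢ v → earlyᵇ (lookup f (E x v)) ≡ false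
  β₁-zero f z with F.any? (λ x → ¬? (isolated x f ≟ 0))
  ... | no none = ⊥-elim (1+n≢0 (trans (sym (cong (0 ^_) (trans (∑-cong (allFin n) (λ x → decidable-stable (isolated x f ≟ 0) (λ ne → none (x , ne))))
                    (trans (∑-const (allFin n) 0) (*-zeroʳ (length (allFin n))))))) z))
  ... | yes (x , ne) = x , λ v x≢v → is-late (λ le → ne (∏≡0⇐ (λ e → late (lookup f e))
                    (∈-map⁺ (E x) (∈-members⁺ (others (x ∷ [])) (without⁺ (x ∷ []) full (λ { (here e) → x≢v (sym e) }) refl))) le))
    where
    is-late : ∀ {b} → χ (not b) ≢ 0 → b ≡ false
    is-late {false} _ = refl
    is-late {true}  ne = ⊥-elim (ne refl)

  module SecondMoment (X₀ : ℕ) (T1 : X₀ * B ≤ n * A) (X₀≤D′ : X₀ ≤ D′) where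
    open ≤-Reasoning
    a b SX SXX : ℕ
    a = B
    b = n * A
    SX  = ∑ Ω #isolated
    SXX = ∑ Ω (λ f → #isolated f * #isolated f)

    aSX : a * SX ≡ b * total
    aSX = begin-equality
      a * ∑ Ω #isolated ≡⟨ cong (a *_) (∑-swap Ω (allFin n) (λ f x → isolated x f)) ⟩
      a * ∑ (allFin n) (λ x → ∑ Ω (isolated x)) ≡⟨ ∑-*ˡ (allFin n) a _ ⟨
      ∑ (allFin n) (λ x → a * ∑ Ω (isolated x)) ≡⟨ ∑-cong (allFin n) isolated-sum ⟩
      ∑ (allFin n) (λ x → A * total) ≡⟨ trans (∑-const (allFin n) (A * total)) (cong (_* (A * total)) (length-allFin n)) ⟩
      n * (A * total) ≡⟨ *-assoc n A total ⟨
      b * total ∎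

    -- Chebyshev's inequality pointwise. The number X of isolated vertices has mean b/a, and the
    -- indicator of X = 0 is at most (1 - aX/b)²; the square is expanded without subtraction.
    pointwise : ∀ f → b * b * β₁ f + 2 * a * b * #isolated f ≤ b * b + a * a * (#isolated f * #isolated f)
    pointwise f with #isolated f
    ... | zero  = ≤-reflexive (cong₂ _+_ (*-identityʳ (b * b)) (trans (*-zeroʳ (2 * a * b)) (sym (*-zeroʳ (a * a)))))
    ... | suc X = begin
      b * b * 0 + 2 * a * b * suc X ≡⟨ e₁ a b (suc X) ⟩
      2 * (b * (a * suc X)) ≤⟨ 2xy≤x²+y² b (a * suc X) ⟩
      b * b + a * suc X * (a * suc X) ≡⟨ cong (b * b +_) (e₂ a (suc X)) ⟩
      b * b + a * a * (suc X * suc X) ∎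
      where
      e₁ : ∀ a b x → b * b * 0 + 2 * a * b * x ≡ 2 * (b * (a * x))
      e₁ = solve-∀
      e₂ : ∀ a x → a * x * (a * x) ≡ a * a * (x * x)
      e₂ = solve-∀

    summed : b * b * ∑ Ω β₁ + 2 * a * b * SX ≤ b * b * total + a * a * SXX
    summed = begin
      b * b * ∑ Ω β₁ + 2 * a * b * SX ≡⟨ cong₂ _+_ (∑-*ˡ Ω (b * b) β₁) (∑-*ˡ Ω (2 * a * b) #isolated) ⟨
      ∑ Ω (λ f → b * b * β₁ f) + ∑ Ω (λ f → 2 * a * b * #isolated f) ≡⟨ ∑-+ Ω (λ f → b * b * β₁ f) (λ f → 2 * a * b * #isolated f) ⟨
      ∑ Ω (λ f → b * b * β₁ f + 2 * a * b * #isolated f) ≤⟨ ∑-mono Ω pointwise ⟩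
      ∑ Ω (λ f → b * b + a * a * (#isolated f * #isolated f)) ≡⟨ ∑-cong Ω (λ f → cong (_+ a * a * (#isolated f * #isolated f)) (sym (*-identityʳ (b * b)))) ⟩
      ∑ Ω (λ f → b * b * 1 + a * a * (#isolated f * #isolated f)) ≡⟨ ∑-+ Ω (λ _ → b * b * 1) (λ f → a * a * (#isolated f * #isolated f)) ⟩
      ∑ Ω (λ f → b * b * 1) + ∑ Ω (λ f → a * a * (#isolated f * #isolated f)) ≡⟨ cong₂ _+_ (∑-*ˡ Ω (b * b) (λ _ → 1)) (∑-*ˡ Ω (a * a) _) ⟩
      b * b * total + a * a * SXX ∎

    SXX-expand : SXX ≡ ∑ (allFin n) (λ x → ∑ (allFin n) (λ y → ∑ Ω (λ f → isolated x f * isolated y f)))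
    SXX-expand = begin-equality
      ∑ Ω (λ f → #isolated f * #isolated f)
        ≡⟨ ∑-cong Ω (λ f → trans (sym (∑-*ʳ (allFin n) (λ x → isolated x f) (#isolated f))) (∑-cong (allFin n) (λ x → sym (∑-*ˡ (allFin n) (isolated x f) (λ y → isolated y f))))) ⟩
      ∑ Ω (λ f → ∑ (allFin n) (λ x → ∑ (allFin n) (λ y → isolated x f * isolated y f)))
        ≡⟨ ∑-swap Ω (allFin n) _ ⟩
      ∑ (allFin n) (λ x → ∑ Ω (λ f → ∑ (allFin n) (λ y → isolated x f * isolated y f)))
        ≡⟨ ∑-cong (allFin n) (λ x → ∑-swap Ω (allFin n) _) ⟩
      ∑ (allFin n) (λ x → ∑ (allFin n) (λ y → ∑ Ω (λ f → isolated x f * isolated y f))) ∎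

    pair : ∀ x y → D′ * (a * a) * ∑ Ω (λ f → isolated x f * isolated y f) ≤
                   χ ⌊ x F.≟ y ⌋ * (D′ * (a * a) * ∑ Ω (isolated x)) + D * (A * A) * total
    pair x y with x F.≟ y
    ... | yes refl = ≤-trans (*-monoʳ-≤ (D′ * (a * a)) (∑-mono Ω (isolated² x)))
                       (≤-trans (≤-reflexive (sym (+-identityʳ _))) (m≤m+n _ _))
    ... | no x≢y   = isolated-pair x≢y

    -- The diagonal contributes at most the mean, and the pairs of distinct vertices at most D/D′
    -- times its square.
    SXX≤ : D′ * (a * a) * SXX ≤ D′ * a * (b * total) + D * (b * b) * total
    SXX≤ = begin
      D′ * (a * a) * SXX
        ≡⟨ cong (D′ * (a * a) *_) SXX-expand ⟩
      c * ∑ (allFin n) (λ x → ∑ (allFin n) (λ y → P x y))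
        ≡⟨ trans (sym (∑-*ˡ (allFin n) c _)) (∑-cong (allFin n) (λ x → sym (∑-*ˡ (allFin n) c (P x)))) ⟩
      ∑ (allFin n) (λ x → ∑ (allFin n) (λ y → c * P x y))
        ≤⟨ ∑-mono (allFin n) (λ x → ∑-mono (allFin n) (pair x)) ⟩
      ∑ (allFin n) (λ x → ∑ (allFin n) (λ y → χ ⌊ x F.≟ y ⌋ * (c * I x) + q))
        ≡⟨ ∑-cong (allFin n) (λ x → trans (∑-+ (allFin n) (λ y → χ ⌊ x F.≟ y ⌋ * (c * I x)) (λ _ → q))
             (cong₂ _+_ (trans (∑-*ʳ (allFin n) _ (c * I x)) (trans (cong (_* (c * I x)) (count-equal n x)) (+-identityʳ _)))
                        (trans (∑-const (allFin n) q) (cong (_* q) (length-allFin n))))) ⟩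
      ∑ (allFin n) (λ x → c * I x + n * q)
        ≡⟨ trans (∑-+ (allFin n) (λ x → c * I x) (λ _ → n * q)) (cong₂ _+_ (∑-*ˡ (allFin n) c I)
             (trans (∑-const (allFin n) (n * q)) (cong (_* (n * q)) (length-allFin n)))) ⟩
      c * ∑ (allFin n) I + n * (n * q)
        ≡⟨ cong (λ z → c * z + n * (n * q)) (∑-swap (allFin n) Ω isolated) ⟩
      c * SX + n * (n * q)
        ≡⟨ cong₂ _+_ (e₁ D′ a SX) (e₂ n D A total) ⟩
      D′ * a * (a * SX) + D * (b * b) * total
        ≡⟨ cong (λ z → D′ * a * z + D * (b * b) * total) aSX ⟩
      D′ * a * (b * total) + D * (b * b) * total ∎
      where
      c q : ℕ
      c = D′ * (a * a)
      q = D * (A * A) * total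
      P : Fin n → Fin n → ℕ
      P x y = ∑ Ω (λ f → isolated x f * isolated y f)
      I : Fin n → ℕ
      I x = ∑ Ω (isolated x)
      e₁ : ∀ d a s → d * (a * a) * s ≡ d * a * (a * s)
      e₁ = solve-∀
      e₂ : ∀ n d a t → n * (n * (d * (a * a) * t)) ≡ d * (n * a * (n * a)) * t
      e₂ = solve-∀

    -- The variance over the squared mean is at most a/b + 1/D′, and both terms are at most 1/X₀.
    bound : X₀ * ∑ Ω β₁ ≤ 2 * total
    bound = *-cancelˡ-≤ (D′ * (b * b)) {{m*n≢0 D′ (b * b) {{_}} {{m*n≢0 b b {{b≢0}} {{b≢0}}}}}} (begin
      D′ * (b * b) * (X₀ * Z) ≡⟨ e₁ D′ b X₀ Z ⟩
      X₀ * (D′ * (b * b) * Z) ≤⟨ *-monoʳ-≤ X₀ core≤ ⟩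
      X₀ * (D′ * a * (b * total) + b * b * total) ≡⟨ e₂ X₀ D′ a b total ⟩
      D′ * b * total * (X₀ * a) + X₀ * (b * b * total) ≤⟨ +-mono-≤ (*-monoʳ-≤ (D′ * b * total) T1) (*-monoˡ-≤ (b * b * total) X₀≤D′) ⟩
      D′ * b * total * b + D′ * (b * b * total) ≡⟨ e₃ D′ b total ⟩
      D′ * (b * b) * (2 * total) ∎)
      where
      Z : ℕ
      Z = ∑ Ω β₁
      b≢0 : NonZero b
      b≢0 = m*n≢0 n A {{subst NonZero (sym n≡) _}} {{^-pos D′ n′}}
      e₁ : ∀ d b x z → d * (b * b) * (x * z) ≡ x * (d * (b * b) * z)
      e₁ = solve-∀
      e₂ : ∀ x d a b t → x * (d * a * (b * t) + b * b * t) ≡ d * b * t * (x * a) + x * (b * b * t)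
      e₂ = solve-∀
      e₃ : ∀ d b t → d * b * t * b + d * (b * b * t) ≡ d * (b * b) * (2 * t)
      e₃ = solve-∀
      core≤ : D′ * (b * b) * Z ≤ D′ * a * (b * total) + b * b * total
      core≤ = +-cancelʳ-≤ (2 * (D′ * (b * b) * total)) _ _ (begin
        D′ * (b * b) * Z + 2 * (D′ * (b * b) * total) ≡⟨ f₁ D′ b Z total ⟩
        D′ * (b * b * Z + 2 * b * (b * total)) ≡⟨ cong (λ z → D′ * (b * b * Z + 2 * b * z)) aSX ⟨
        D′ * (b * b * Z + 2 * b * (a * SX)) ≡⟨ cong (λ z → D′ * (b * b * Z + z)) (f₀ a b SX) ⟩
        D′ * (b * b * Z + 2 * a * b * SX) ≤⟨ *-monoʳ-≤ D′ summed ⟩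
        D′ * (b * b * total + a * a * SXX) ≡⟨ f₂ D′ b total a SXX ⟩
        D′ * (b * b) * total + D′ * (a * a) * SXX ≤⟨ +-monoʳ-≤ _ SXX≤ ⟩
        D′ * (b * b) * total + (D′ * a * (b * total) + D * (b * b) * total) ≡⟨ f₃ D′ a b total ⟩
        D′ * a * (b * total) + b * b * total + 2 * (D′ * (b * b) * total) ∎)
        where
        f₀ : ∀ a b s → 2 * b * (a * s) ≡ 2 * a * b * s
        f₀ = solve-∀
        f₁ : ∀ d b z t → d * (b * b) * z + 2 * (d * (b * b) * t) ≡ d * (b * b * z + 2 * b * (b * t))
        f₁ = solve-∀
        f₂ : ∀ d b t a s → d * (b * b * t + a * a * s) ≡ d * (b * b) * t + d * (a * a) * s
        f₂ = solve-∀
        f₃ : ∀ d a b t → d * (b * b) * t + (d * a * (b * t) + (suc d) * (b * b) * t) ≡ d * a * (b * t) + b * b * t + 2 * (d * (b * b) * t)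
        f₃ = solve-∀

  β₂ : Labelling → ℕ
  β₂ f = ∑ (allFin n) (λ x → ∏ (star x (others (x ∷ []))) (λ e → notSoon (lookup f e)))

  β₂-zero : ∀ f → β₂ f ≡ 0 → ∀ x → ∃ λ v → x ≢ v × soonᵇ (lookup f (E x v)) ≡ true
  β₂-zero f z x with ∏≡0⇒ (star x (others (x ∷ []))) (λ e → notSoon (lookup f e))
                       (∑≡0⇒ {xs = allFin n} (λ x → ∏ (star x (others (x ∷ []))) (λ e → notSoon (lookup f e))) z (∈-allFin x))
  ... | e , e∈ , q with ∈-star⁻ {x} {others (x ∷ [])} e∈
  ...   | v , Wv , refl = v , others-≢ (x ∷ []) Wv (here refl) , is-soon (χ≡0⇒ q)
    where
    is-soon : ∀ {b} → not b ≡ false → b ≡ true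
    is-soon {true} _ = refl

  -- By 1 - 2/D ≤ (1 - 1/D)² the expectation is at most (n A/B)²/n, hence at most 4 X₀²/n.
  β₂-bound : ∀ X₀ → n * A ≤ 2 * X₀ * B → n * ∑ Ω β₂ ≤ 4 * (X₀ * X₀) * total
  β₂-bound X₀ T2 = *-cancelˡ-≤ (B * B) {{m*n≢0 B B {{^-pos D n′}} {{^-pos D n′}}}} (begin
    B * B * (n * ∑ Ω β₂) ≡⟨ e₁ B n (∑ Ω β₂) ⟩
    n * (B * (B * ∑ Ω β₂)) ≡⟨ cong (λ z → n * (B * z)) sum≡ ⟩
    n * (B * (n * (D″ ^ n′ * total))) ≡⟨ e₂ n B (D″ ^ n′) total ⟩
    n * n * (B * D″ ^ n′) * total ≡⟨ cong (λ z → n * n * z * total) (^-distrib-* D D″ n′) ⟨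
    n * n * (D * D″) ^ n′ * total ≤⟨ *-monoˡ-≤ total (*-monoʳ-≤ (n * n) (^-monoˡ-≤ n′ (≤-trans (n≤1+n _) (≤-reflexive (e₃ D″))))) ⟩
    n * n * (D′ * D′) ^ n′ * total ≡⟨ cong (λ z → n * n * z * total) (^-distrib-* D′ D′ n′) ⟩
    n * n * (A * A) * total ≡⟨ e₄ n A total ⟩
    n * A * (n * A) * total ≤⟨ *-monoˡ-≤ total (*-mono-≤ T2 T2) ⟩
    2 * X₀ * B * (2 * X₀ * B) * total ≡⟨ e₅ X₀ B total ⟩
    B * B * (4 * (X₀ * X₀) * total) ∎)
    where
    open ≤-Reasoning
    sum≡ : B * ∑ Ω β₂ ≡ n * (D″ ^ n′ * total)
    sum≡ = begin-equality
      B * ∑ Ω β₂ ≡⟨ cong (B *_) (∑-swap Ω (allFin n) _) ⟩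
      B * ∑ (allFin n) (λ x → S x) ≡⟨ ∑-*ˡ (allFin n) B S ⟨
      ∑ (allFin n) (λ x → B * S x) ≡⟨ ∑-cong (allFin n) one ⟩
      ∑ (allFin n) (λ x → D″ ^ n′ * total) ≡⟨ trans (∑-const (allFin n) _) (cong (_* (D″ ^ n′ * total)) (length-allFin n)) ⟩
      n * (D″ ^ n′ * total) ∎
      where
      S : Fin n → ℕ
      S x = ∑ Ω (λ f → ∏ (star x (others (x ∷ []))) (λ e → notSoon (lookup f e)))
      one : ∀ x → B * S x ≡ D″ ^ n′ * total
      one x = subst (λ k → D ^ k * S x ≡ D″ ^ k * total) (trans (length-star x _) (card-others₁ x))
        (∑-density′ (star x (others (x ∷ []))) notSoon D″ D density-notSoon (star-unique x _ (λ p → others-≢ (x ∷ []) p (here refl))))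
    e₁ : ∀ b n s → b * b * (n * s) ≡ n * (b * (b * s))
    e₁ = solve-∀
    e₂ : ∀ n b d t → n * (b * (n * (d * t))) ≡ n * n * (b * d) * t
    e₂ = solve-∀
    e₃ : ∀ d → 1 + (2 + d) * d ≡ (1 + d) * (1 + d)
    e₃ = solve-∀
    e₄ : ∀ n a t → n * n * (a * a) * t ≡ n * a * (n * a) * t
    e₄ = solve-∀
    e₅ : ∀ x b t → 2 * x * b * (2 * x * b) * t ≡ b * b * (4 * (x * x) * t)
    e₅ = solve-∀

  -- Pairs of sets without an edge of some colour

  between : VSet n → VSet n → List (Fin N)
  between P Q = map (uncurry E) (cartesianProduct (members P) (members Q))

  length-between : ∀ P Q → length (between P Q) ≡ card P * card Q
  length-between P Q = trans (length-map (uncurry E) (cartesianProduct (members P) (members Q)))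
    (trans (length-cartesianProduct (members P) (members Q)) (cong₂ _*_ (length-members P) (length-members Q)))

  between-unique : ∀ P Q → (∀ v → P v ≡ true → Q v ≡ true → ⊥) → Unique (between P Q)
  between-unique P Q dis = Unique-map inj (Unique.cartesianProduct⁺ (members-unique P) (members-unique Q))
    where
    P≢Q : ∀ {u v} → P u ≡ true → Q v ≡ true → u ≢ v
    P≢Q p q refl = dis _ p q
    inj : ∀ {p q} → p ∈ cartesianProduct (members P) (members Q) → q ∈ cartesianProduct (members P) (members Q) →
          uncurry E p ≡ uncurry E q → p ≡ q
    inj {u , v} {u′ , v′} p q e with ∈-cartesianProduct⁻ (members P) (members Q) p | ∈-cartesianProduct⁻ (members P) (members Q) q
    ... | u∈ , v∈ | u′∈ , v′∈ with E-inj (P≢Q (∈-members⁻ P u∈) (∈-members⁻ Q v∈)) (P≢Q (∈-members⁻ P u′∈) (∈-members⁻ Q v′∈)) e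
    ...   | inj₁ (refl , refl) = refl
    ...   | inj₂ (uv′ , _) = ⊥-elim (P≢Q (∈-members⁻ P u∈) (∈-members⁻ Q v′∈) uv′)

  typeA typeB : Vec Ty n → VSet n
  typeA τ v = isA (lookup τ v)
  typeB τ v = isB (lookup τ v)

  type-disjoint : ∀ τ v → typeA τ v ≡ true → typeB τ v ≡ true → ⊥
  type-disjoint τ v p q with lookup τ v
  type-disjoint τ v () q | inB
  type-disjoint τ v () q | rest
  type-disjoint τ v p () | inA

  -- The test `cnd` selects which pairs of sets must be joined. Two choices of it serve the
  -- expansion of sets of about `d` vertices and the joining of large sets.
  β₃ : (Vec Ty n → Bool) → Labelling → ℕ
  β₃ cnd f = ∑ (allFin r) (λ c → ∑ (allVecs tys n) (λ τ →
    χ (cnd τ) * ∏ (between (typeA τ) (typeB τ)) (λ e → lacks c (lookup f e))))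

  ∑-types : (Vec Ty n → Bool) → ℕ
  ∑-types cnd = ∑ (allVecs tys n) (χ ∘ cnd)

  -- Union bound over colours and pairs. A pair with more than `h` possible edges is even less
  -- likely to lack them all.
  β₃-bound : ∀ cnd h → (∀ τ → cnd τ ≡ true → h ≤ card (typeA τ) * card (typeB τ)) →
             suc Y ^ h * ∑ Ω (β₃ cnd) ≤ r * (∑-types cnd * (Y ^ h * total))
  β₃-bound cnd h size = begin
    suc Y ^ h * ∑ Ω (β₃ cnd)
      ≡⟨ cong (suc Y ^ h *_) (trans (∑-swap Ω (allFin r) _) (∑-cong (allFin r) (λ c → ∑-swap Ω (allVecs tys n) _))) ⟩
    suc Y ^ h * ∑ (allFin r) (λ c → ∑ (allVecs tys n) (S c))
      ≡⟨ trans (sym (∑-*ˡ (allFin r) (suc Y ^ h) _)) (∑-cong (allFin r) (λ c → sym (∑-*ˡ (allVecs tys n) (suc Y ^ h) (S c)))) ⟩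
    ∑ (allFin r) (λ c → ∑ (allVecs tys n) (λ τ → suc Y ^ h * S c τ))
      ≤⟨ ∑-mono (allFin r) (λ c → ∑-mono (allVecs tys n) (one c)) ⟩
    ∑ (allFin r) (λ c → ∑ (allVecs tys n) (λ τ → χ (cnd τ) * (Y ^ h * total)))
      ≡⟨ trans (∑-const (allFin r) _) (cong₂ _*_ (length-allFin r) (∑-*ʳ (allVecs tys n) (χ ∘ cnd) (Y ^ h * total))) ⟩
    r * (∑-types cnd * (Y ^ h * total)) ∎
    where
    open ≤-Reasoning
    S : Fin r → Vec Ty n → ℕ
    S c τ = ∑ Ω (λ f → χ (cnd τ) * ∏ (between (typeA τ) (typeB τ)) (λ e → lacks c (lookup f e)))
    one : ∀ c τ → suc Y ^ h * S c τ ≤ χ (cnd τ) * (Y ^ h * total)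
    one c τ with cnd τ | size τ
    ... | false | _ = ≤-trans (≤-reflexive (cong (suc Y ^ h *_) (trans (∑-const Ω 0) (*-zeroʳ (length Ω))))) (≤-reflexive (*-zeroʳ (suc Y ^ h)))
    ... | true  | h≤ = *-cancelˡ-≤ (suc Y ^ L) {{^-pos (suc Y) L}} (begin
      suc Y ^ L * (suc Y ^ h * S′) ≡⟨ swap₃ (suc Y ^ L) (suc Y ^ h) S′ ⟩
      suc Y ^ h * (suc Y ^ L * S′) ≡⟨ cong (λ z → suc Y ^ h * (suc Y ^ L * z)) (∑-cong Ω (λ f → +-identityʳ _)) ⟩
      suc Y ^ h * (suc Y ^ L * ∑ Ω (λ f → ∏ Es (λ e → lacks c (lookup f e))))
        ≡⟨ cong (suc Y ^ h *_) (∑-density′ Es (lacks c) Y (suc Y) (density-lacks c) (between-unique _ _ (type-disjoint τ))) ⟩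
      suc Y ^ h * (Y ^ L * total) ≡⟨ e₁ (suc Y ^ h) (Y ^ L) total ⟩
      Y ^ L * suc Y ^ h * total ≤⟨ *-monoˡ-≤ total (^-ratio-mono (n≤1+n Y) (≤-trans (h≤ refl) (≤-reflexive (sym (length-between _ _))))) ⟩
      Y ^ h * suc Y ^ L * total ≡⟨ e₂ (Y ^ h) (suc Y ^ L) total ⟩
      suc Y ^ L * (1 * (Y ^ h * total)) ∎)
      where
      Es = between (typeA τ) (typeB τ)
      L = length Es
      S′ = ∑ Ω (λ f → 1 * ∏ Es (λ e → lacks c (lookup f e)))
      e₁ : ∀ x y t → x * (y * t) ≡ y * x * t
      e₁ = solve-∀
      e₂ : ∀ x y t → x * y * t ≡ y * (1 * (x * t))
      e₂ = solve-∀

  adjOf : Labelling → Adjacency n r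
  adjOf f c u v = not ⌊ u F.≟ v ⌋ ∧ hasᵇ c (lookup f (E u v))

  adjOf⁺ : ∀ f c {u v} → u ≢ v → hasᵇ c (lookup f (E u v)) ≡ true → adjOf f c u v ≡ true
  adjOf⁺ f c {u} {v} u≢v p with u F.≟ v
  ... | yes e = ⊥-elim (u≢v e)
  ... | no _  = p

  adjOf⁻ : ∀ f c u v → adjOf f c u v ≡ true → u ≢ v × hasᵇ c (lookup f (E u v)) ≡ true
  adjOf⁻ f c u v p with u F.≟ v
  ... | no u≢v = u≢v , p

  β₃-zero : ∀ cnd f → β₃ cnd f ≡ 0 → ∀ c τ → cnd τ ≡ true →
    ∃ λ u → ∃ λ v → typeA τ u ≡ true × typeB τ v ≡ true × adjOf f c u v ≡ true
  β₃-zero cnd f z c τ ok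
    with ∏≡0⇒ (between (typeA τ) (typeB τ)) (λ e → lacks c (lookup f e))
           (trans (sym (+-identityʳ _)) (subst (λ b → χ b * ∏ (between (typeA τ) (typeB τ)) (λ e → lacks c (lookup f e)) ≡ 0) ok
             (∑≡0⇒ {xs = allVecs tys n} (λ τ → χ (cnd τ) * ∏ (between (typeA τ) (typeB τ)) (λ e → lacks c (lookup f e)))
               (∑≡0⇒ {xs = allFin r} _ z (∈-allFin c)) (∈-allVecs τ (λ i → ∈-tys (lookup τ i))))))
  ... | e , e∈ , q with ∈-map⁻ (uncurry E) e∈
  ...   | (u , v) , uv∈ , refl with ∈-cartesianProduct⁻ (members (typeA τ)) (members (typeB τ)) uv∈
  ...     | u∈ , v∈ = u , v , ∈-members⁻ (typeA τ) u∈ , ∈-members⁻ (typeB τ) v∈ ,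
      adjOf⁺ f c (λ { refl → type-disjoint τ u (∈-members⁻ (typeA τ) u∈) (∈-members⁻ (typeB τ) v∈) }) (has (χ≡0⇒ q))
    where
    has : ∀ {b} → not b ≡ false → b ≡ true
    has {true} _ = refl

  -- Masking and exposing the edges at one or two vertices

  private
    time-m : m < M
    time-m = m<m+n m (*-mono-≤ {1} {D′} {1} {m} (s≤s z≤n) m≥1)

  -- A late label satisfies `hasᵇ` for no colour, so masking an edge deletes it from the early
  -- graph.
  top : Λ
  top = F.fromℕ< time-m , F.fromℕ< r≥1

  top-late : earlyᵇ top ≡ false
  top-late with earlyᵇ top in eq
  ... | false = refl
  ... | true  = ⊥-elim (<-irrefl (F.toℕ-fromℕ< time-m) (<ᵇ⇒< (toℕ (F.fromℕ< time-m)) m (subst Bool.T (sym eq) _)))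

  touching : List (Fin n) → List (Fin N)
  touching S = concatMap (λ s → star s (others (s ∷ []))) S

  -- All edges at S are relabelled, so that mask S f carries no information about them.
  mask : List (Fin n) → Labelling → Labelling
  mask S f = Vec.tabulate (λ e → if mem (touching S) e then top else lookup f e)

  ∈-touching : ∀ S {x v} → x ∈ S → x ≢ v → E x v ∈ touching S
  ∈-touching S {x} {v} x∈ x≢v = ∈-concatMap {f = λ s → star s (others (s ∷ []))} x∈
    (∈-map⁺ (E x) (∈-members⁺ (others (x ∷ [])) (without⁺ (x ∷ []) full (λ { (here e) → x≢v (sym e) }) refl)))

  mask-indep : ∀ S {e} → e ∈ touching S → ∀ f λc → mask S (f [ e ]≔ λc) ≡ mask S f
  mask-indep S {e} e∈ f λc = tabulate-cong at
    where
    at : ∀ i → (if mem (touching S) i then top else lookup (f [ e ]≔ λc) i) ≡ (if mem (touching S) i then top else lookup f i)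
    at i with mem (touching S) i in eq
    ... | true  = refl
    ... | false = lookup-update-≢ (λ { refl → ∉⇐mem eq e∈ }) f λc

  has-mask⁻ : ∀ S f c e → hasᵇ c (lookup (mask S f) e) ≡ true → hasᵇ c (lookup f e) ≡ true
  has-mask⁻ S f c e p rewrite lookup∘tabulate (λ e → if mem (touching S) e then top else lookup f e) e
    with mem (touching S) e
  ... | false = p
  ... | true  = ⊥-elim (true≢false (trans (sym (proj₁ (∧-true⁻ (earlyᵇ top) p))) top-late))

  has-mask⁺ : ∀ S f c e → e ∉ touching S → hasᵇ c (lookup f e) ≡ true → hasᵇ c (lookup (mask S f) e) ≡ true
  has-mask⁺ S f c e e∉ p rewrite lookup∘tabulate (λ e → if mem (touching S) e then top else lookup f e) e
    with mem (touching S) e in eq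
  ... | false = p
  ... | true  = ⊥-elim (e∉ (mem⇒∈ (touching S) eq))

  adj-mask⁻ : ∀ S f c u v → adjOf (mask S f) c u v ≡ true → adjOf f c u v ≡ true
  adj-mask⁻ S f c u v p with adjOf⁻ (mask S f) c u v p
  ... | u≢v , q = adjOf⁺ f c u≢v (has-mask⁻ S f c (E u v) q)

  adj-mask⁺ : ∀ S f c u v → u ∉ S → v ∉ S → adjOf f c u v ≡ true → adjOf (mask S f) c u v ≡ true
  adj-mask⁺ S f c u v u∉ v∉ p with adjOf⁻ f c u v p
  ... | u≢v , q = adjOf⁺ (mask S f) c u≢v (has-mask⁺ S f c (E u v) untouched q)
    where
    untouched : E u v ∉ touching S
    untouched uv∈ with ∈-concatMap⁻ (λ s → star s (others (s ∷ []))) S uv∈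
    ... | s , s∈ , t∈ with ∈-star⁻ {s} {others (s ∷ [])} t∈
    ...   | t , Wt , e with E-inj u≢v (others-≢ (s ∷ []) Wt (here refl)) e
    ...     | inj₁ (refl , _) = u∉ s∈
    ...     | inj₂ (_ , refl) = v∉ s∈

  ∑Ω-bound : {X : Set} (I : List X) (t φ : X → Labelling → ℕ) (c c′ : ℕ) →
    (∀ i → i ∈ I → c * ∑ Ω (t i) ≤ c′ * ∑ Ω (φ i)) →
    c * ∑ Ω (λ f → ∑ I (λ i → t i f)) ≤ c′ * ∑ Ω (λ f → ∑ I (λ i → φ i f))
  ∑Ω-bound I t φ c c′ le = begin
    c * ∑ Ω (λ f → ∑ I (λ i → t i f)) ≡⟨ cong (c *_) (∑-swap Ω I (λ f i → t i f)) ⟩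
    c * ∑ I (λ i → ∑ Ω (t i)) ≡⟨ ∑-*ˡ I c (λ i → ∑ Ω (t i)) ⟨
    ∑ I (λ i → c * ∑ Ω (t i)) ≤⟨ ∑-mono-∈ I le ⟩
    ∑ I (λ i → c′ * ∑ Ω (φ i)) ≡⟨ ∑-*ˡ I c′ (λ i → ∑ Ω (φ i)) ⟩
    c′ * ∑ I (λ i → ∑ Ω (φ i)) ≡⟨ cong (c′ *_) (∑-swap Ω I (λ f i → φ i f)) ⟨
    c′ * ∑ Ω (λ f → ∑ I (λ i → φ i f)) ∎
    where open ≤-Reasoning

  soons lates : List (Fin N) → Labelling → ℕ
  soons Es f = ∏ Es (λ e → soon (lookup f e))
  lates Es f = ∏ Es (λ e → late (lookup f e))

  -- The late factors are summed out first, with `φ` and the soon factors as the independent part;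
  -- this uses that `Es` and `Fs` are disjoint.
  exposed : (φ : Labelling → ℕ) (Es Fs : List (Fin N)) → Unique (Es ++ Fs) → (∀ {e} → e ∈ Es ++ Fs → IndepOf φ e) →
    D ^ length Es * (D ^ length Fs * ∑ Ω (λ f → φ f * soons Es f * lates Fs f)) ≡ 2 ^ length Es * (D′ ^ length Fs * ∑ Ω φ)
  exposed φ Es Fs u ind = begin
    D ^ length Es * (D ^ length Fs * ∑ Ω (λ f → φ f * soons Es f * lates Fs f))
      ≡⟨ cong (D ^ length Es *_) (∑-density Λs Fs (λ f → φ f * soons Es f) late D′ D density-late uF
           (All.tabulate (λ {e} e∈ → *-indep {φ = φ} {ψ = soons Es} (ind (∈-++⁺ʳ Es e∈)) (∏-indep Es soon (All.tabulate (λ {e′} e′∈ eq → dis Es u e′∈ (subst (_∈ Fs) eq e∈))))))) ⟩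
    D ^ length Es * (D′ ^ length Fs * ∑ Ω (λ f → φ f * soons Es f))
      ≡⟨ swap₃ (D ^ length Es) (D′ ^ length Fs) _ ⟩
    D′ ^ length Fs * (D ^ length Es * ∑ Ω (λ f → φ f * soons Es f))
      ≡⟨ cong (D′ ^ length Fs *_) (∑-density Λs Es φ soon 2 D density-soon (uE Es u) (All.tabulate (λ e∈ → ind (∈-++⁺ˡ e∈)))) ⟩
    D′ ^ length Fs * (2 ^ length Es * ∑ Ω φ)
      ≡⟨ swap₃ (D′ ^ length Fs) (2 ^ length Es) _ ⟩
    2 ^ length Es * (D′ ^ length Fs * ∑ Ω φ) ∎
    where
    open ≡-Reasoning
    uE : ∀ Es → Unique (Es ++ Fs) → Unique Es
    uE []       u = []
    uE (e ∷ Es) (e∉ ∷ u) = Allₚ.++⁻ˡ Es e∉ ∷ uE Es u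
    uF′ : ∀ Es → Unique (Es ++ Fs) → Unique Fs
    uF′ []       u = u
    uF′ (e ∷ Es) (_ ∷ u) = uF′ Es u
    uF = uF′ Es u
    dis : ∀ Es → Unique (Es ++ Fs) → ∀ {e} → e ∈ Es → e ∈ Fs → ⊥
    dis (e ∷ Es) (e∉ ∷ u) (here refl) q = All.lookup e∉ (∈-++⁺ʳ Es q) refl
    dis (e ∷ Es) (e∉ ∷ u) (there p)   q = dis Es u p q

  -- Ignoring at most `k` ≤ D/2 edges of a star costs a factor (1 - 1/D)^(-k) ≤ 2 over the
  -- probability A/B.
  ratio : ∀ s k → n′ ≤ s + k → 2 * k ≤ D → D′ ^ s * B ≤ 2 * (A * D ^ s)
  ratio s k n′≤ 2k≤D = *-cancelʳ-≤ _ _ (D′ ^ k) {{^-pos D′ k}} (begin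
    D′ ^ s * B * D′ ^ k ≡⟨ e₁ (D′ ^ s) B (D′ ^ k) ⟩
    D′ ^ s * D′ ^ k * B ≡⟨ cong (_* B) (^-distribˡ-+-* D′ s k) ⟨
    D′ ^ (s + k) * D ^ n′ ≤⟨ ^-ratio-mono (n≤1+n D′) n′≤ ⟩
    A * D ^ (s + k) ≡⟨ cong (A *_) (^-distribˡ-+-* D s k) ⟩
    A * (D ^ s * D ^ k) ≤⟨ *-monoʳ-≤ A (*-monoʳ-≤ (D ^ s) half) ⟩
    A * (D ^ s * (2 * D′ ^ k)) ≡⟨ e₂ A (D ^ s) (D′ ^ k) ⟩
    2 * (A * D ^ s) * D′ ^ k ∎)
    where
    open ≤-Reasoning
    half : D ^ k ≤ 2 * D′ ^ k
    half = subst (λ z → z ^ k ≤ 2 * D′ ^ k) (+-comm D′ 1) (^-≤-double D′ 1 k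
      (≤-trans (≤-reflexive (cong (2 *_) (*-identityʳ k))) (≤-trans 2k≤D (≤-reflexive (+-comm 1 D′)))))
    e₁ : ∀ a b c → a * b * c ≡ a * c * b
    e₁ = solve-∀
    e₂ : ∀ a b c → a * (b * (2 * c)) ≡ 2 * (a * b) * c
    e₂ = solve-∀

  module Exposure (core : Labelling → Vec Bool n) (w : ℕ) (core-big : ∀ f → n ≤ card (lookup (core f)) + w)
                  (2w≤D : 2 * (w + 2) ≤ D) where
    open ≤-Reasoning

    subsets : List (Vec Bool n)
    subsets = allVecs bools n

    ∈-subsets : ∀ W → W ∈ subsets
    ∈-subsets W = ∈-allVecs W (λ i → bool∈ (lookup W i))
      where
      bool∈ : ∀ b → b ∈ bools
      bool∈ true  = here refl
      bool∈ false = there (here refl)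

    -- Summing over all possible values `W` of the core replaces conditioning: for fixed `W` this
    -- indicator is independent of the edges at `S`.
    is : List (Fin n) → Vec Bool n → Labelling → ℕ
    is S W f = χ (eqV W (core (mask S f)))

    is-indep : ∀ S W {e} → e ∈ touching S → IndepOf (is S W) e
    is-indep S W e∈ f λc = cong (λ g → χ (eqV W (core g))) (mask-indep S e∈ f λc)

    is-small : ∀ S W f → ¬ (n ≤ card (lookup W) + w) → is S W f ≡ 0
    is-small S W f small with eqV W (core (mask S f)) in eq
    ... | false = refl
    ... | true  = ⊥-elim (small (subst (λ W → n ≤ card (lookup W) + w) (sym (eqV-sound W _ eq)) (core-big (mask S f))))

    is-self : ∀ S f → is S (core (mask S f)) f ≡ 1
    is-self S f = χ-true (eqV-refl (core (mask S f)))

    -- `x` and `z` are taken out of `W`, so the soon edge and the late edges are distinct; all of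
    -- them are at `x`, where the masked core does not look.
    φ₄ t₄ : Fin n → Fin n → Vec Bool n → Labelling → ℕ
    φ₄ x z W f = is (x ∷ []) W f * χ (not (lookup W z))
    t₄ x z W f = φ₄ x z W f * soons (E x z ∷ []) f * lates (star x (without (x ∷ z ∷ []) (lookup W))) f

    other : Fin n → List (Fin n)
    other x = members (others (x ∷ []))

    β₄ : Labelling → ℕ
    β₄ f = ∑ (allFin n) (λ x → ∑ (other x) (λ z → ∑ subsets (λ W → t₄ x z W f)))

    ≤-size : ∀ (W : Vec Bool n) (us : List (Fin n)) k → length us ≡ suc k → n ≤ card (lookup W) + w → n′ ≤ card (without us (lookup W)) + (w + k)
    ≤-size W us k len big = s≤s⁻¹ (begin
      suc n′ ≡⟨ n≡ ⟨
      n ≤⟨ big ⟩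
      card (lookup W) + w ≤⟨ +-monoˡ-≤ w (card-without us (lookup W)) ⟩
      card (without us (lookup W)) + length us + w ≡⟨ cong (λ z → card (without us (lookup W)) + z + w) len ⟩
      card (without us (lookup W)) + suc k + w ≡⟨ eq (card (without us (lookup W))) k w ⟩
      suc (card (without us (lookup W)) + (w + k)) ∎)
      where
      eq : ∀ a k w → a + suc k + w ≡ suc (a + (w + k))
      eq = solve-∀

    -- A factor 2/D for the soon edge, and at most 2 A/B for the late star by `ratio`. A `W` missing
    -- more than `w` vertices is never a core, so its term vanishes.
    t₄-bound : ∀ x z → x ≢ z → ∀ W → D * B * ∑ Ω (t₄ x z W) ≤ 4 * A * ∑ Ω (φ₄ x z W)
    t₄-bound x z x≢z W with n ≤? card (lookup W) + w
    ... | no small = ≤-trans (≤-reflexive (trans (cong (D * B *_) (trans (∑-cong Ω vanish) (trans (∑-const Ω 0) (*-zeroʳ (length Ω))))) (*-zeroʳ (D * B)))) z≤n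
      where
      vanish : ∀ f → t₄ x z W f ≡ 0
      vanish f rewrite is-small (x ∷ []) W f small = refl
    ... | yes big = *-cancelˡ-≤ (D ^ s) {{^-pos D s}} (begin
      D ^ s * (D * B * S) ≡⟨ e₁ (D ^ s) D B S ⟩
      B * (D ^ 1 * (D ^ s * S)) ≡⟨ cong (λ k → B * (D ^ 1 * (D ^ k * S))) lenF ⟨
      B * (D ^ 1 * (D ^ length Fs * S)) ≡⟨ cong (B *_) (exposed (φ₄ x z W) (E x z ∷ []) Fs uniq ind) ⟩
      B * (2 ^ 1 * (D′ ^ length Fs * Φ)) ≡⟨ cong (λ k → B * (2 ^ 1 * (D′ ^ k * Φ))) lenF ⟩
      B * (2 ^ 1 * (D′ ^ s * Φ)) ≡⟨ e₂ B (D′ ^ s) Φ ⟩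
      2 * Φ * (D′ ^ s * B) ≤⟨ *-monoʳ-≤ (2 * Φ) (ratio s (w + 1) (≤-size W (x ∷ z ∷ []) 1 refl big) (≤-trans (*-monoʳ-≤ 2 (+-monoʳ-≤ w (s≤s z≤n))) 2w≤D)) ⟩
      2 * Φ * (2 * (A * D ^ s)) ≡⟨ e₃ Φ A (D ^ s) ⟩
      D ^ s * (4 * A * Φ) ∎)
      where
      W′ = without (x ∷ z ∷ []) (lookup W)
      Fs = star x W′
      s = card W′
      S = ∑ Ω (t₄ x z W)
      Φ = ∑ Ω (φ₄ x z W)
      lenF : length Fs ≡ s
      lenF = length-star x W′
      x≢ : ∀ {v} → W′ v ≡ true → x ≢ v
      x≢ p refl = without-∉ (x ∷ z ∷ []) (lookup W) p (here refl)
      z≢ : ∀ {v} → W′ v ≡ true → z ≢ v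
      z≢ p refl = without-∉ (x ∷ z ∷ []) (lookup W) p (there (here refl))
      uniq : Unique (E x z ∷ Fs)
      uniq = All.tabulate fresh ∷ star-unique x W′ x≢
        where
        fresh : ∀ {e} → e ∈ Fs → E x z ≢ e
        fresh e∈ eq with ∈-star⁻ {x} {W′} e∈
        ... | v , Wv , refl with E-inj x≢z (x≢ Wv) eq
        ...   | inj₁ (_ , zv) = z≢ Wv zv
        ...   | inj₂ (xv , _) = x≢ Wv xv
      ind : ∀ {e} → e ∈ E x z ∷ Fs → IndepOf (φ₄ x z W) e
      ind {e} e∈ = *-indep {φ = is (x ∷ []) W} {ψ = λ _ → χ (not (lookup W z))} (is-indep (x ∷ []) W (at e∈)) (λ _ _ → refl)
        where
        at : e ∈ E x z ∷ Fs → e ∈ touching (x ∷ [])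
        at (here refl) = ∈-touching (x ∷ []) (here refl) x≢z
        at (there q) with ∈-star⁻ {x} {W′} q
        ... | v , Wv , refl = ∈-touching (x ∷ []) (here refl) (x≢ Wv)
      e₁ : ∀ k d b s → k * (d * b * s) ≡ b * (d * 1 * (k * s))
      e₁ = solve-∀
      e₂ : ∀ b k p → b * (2 * (k * p)) ≡ 2 * p * (k * b)
      e₂ = solve-∀
      e₃ : ∀ p a k → 2 * p * (2 * (a * k)) ≡ k * (4 * a * p)
      e₃ = solve-∀

    ∑-members≤ : ∀ P (h : Fin n → ℕ) → ∑ (members P) h ≤ ∑ (allFin n) h
    ∑-members≤ P h = ∑-inject (members P) (allFin n) (λ v → v) h (members-unique P) (λ _ _ e → e) (λ _ → ∈-allFin _)

    -- For each `x` the sum over `W` selects the actual masked core, and at most `w` vertices `z`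
    -- lie outside it.
    β₄-bound : D * B * ∑ Ω β₄ ≤ 4 * A * (n * w * total)
    β₄-bound = begin
      D * B * ∑ Ω β₄
        ≤⟨ ∑Ω-bound (allFin n) (λ x f → ∑ (other x) (λ z → ∑ subsets (λ W → t₄ x z W f))) (λ x f → ∑ (other x) (λ z → ∑ subsets (λ W → φ₄ x z W f))) (D * B) (4 * A)
             (λ x _ → ∑Ω-bound (other x) (λ z f → ∑ subsets (λ W → t₄ x z W f)) (λ z f → ∑ subsets (λ W → φ₄ x z W f)) (D * B) (4 * A)
               (λ z z∈ → ∑Ω-bound subsets (λ W f → t₄ x z W f) (λ W f → φ₄ x z W f) (D * B) (4 * A)
                 (λ W _ → t₄-bound x z (others-≢ (x ∷ []) (∈-members⁻ (others (x ∷ [])) z∈) (here refl)) W))) ⟩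
      4 * A * ∑ Ω (λ f → ∑ (allFin n) (λ x → ∑ (other x) (λ z → ∑ subsets (λ W → φ₄ x z W f))))
        ≤⟨ *-monoʳ-≤ (4 * A) (∑-mono Ω pointwise) ⟩
      4 * A * ∑ Ω (λ f → n * w * 1)
        ≡⟨ cong (4 * A *_) (∑-*ˡ Ω (n * w) (λ _ → 1)) ⟩
      4 * A * (n * w * total) ∎
      where
      outside≤w : ∀ f → card (not ∘ lookup (core f)) ≤ w
      outside≤w f = +-cancelˡ-≤ (card (lookup (core f))) _ _ (≤-trans (≤-trans
        (card-disjoint (lookup (core f)) (not ∘ lookup (core f)) full (λ _ _ → refl) (λ _ _ → refl)
          (λ v p q → true≢false (trans (sym p) (not-true⁻ _ q)))) (≤-reflexive card-all)) (core-big f))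
      pointwise : ∀ f → ∑ (allFin n) (λ x → ∑ (other x) (λ z → ∑ subsets (λ W → φ₄ x z W f))) ≤ n * w * 1
      pointwise f = begin
        ∑ (allFin n) (λ x → ∑ (other x) (λ z → ∑ subsets (λ W → φ₄ x z W f)))
          ≡⟨ ∑-cong (allFin n) (λ x → ∑-cong (other x) (λ z → ∑-select (core (mask (x ∷ []) f)) (λ W → χ (not (lookup W z))))) ⟩
        ∑ (allFin n) (λ x → ∑ (other x) (λ z → χ (not (lookup (core (mask (x ∷ []) f)) z))))
          ≤⟨ ∑-mono (allFin n) (λ x → ≤-trans (∑-members≤ (others (x ∷ [])) (λ z → χ (not (lookup (core (mask (x ∷ []) f)) z)))) (outside≤w (mask (x ∷ []) f))) ⟩
        ∑ (allFin n) (λ x → w)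
          ≡⟨ trans (∑-const (allFin n) w) (trans (cong (_* w) (length-allFin n)) (sym (*-identityʳ (n * w)))) ⟩
        n * w * 1 ∎

    -- In the term for the actual core all factors but those of the star are 1, so one of the star
    -- edges is not late.
    t₄-zero : ∀ f → β₄ f ≡ 0 → ∀ x z → x ≢ z → lookup (core (mask (x ∷ []) f)) z ≡ false → soonᵇ (lookup f (E x z)) ≡ true →
      ∃ λ v → lookup (core (mask (x ∷ []) f)) v ≡ true × x ≢ v × earlyᵇ (lookup f (E x v)) ≡ true
    t₄-zero f zero₄ x z x≢z Wz sn with ∏≡0⇒ (star x W′) (λ e → late (lookup f e)) prod≡0
      where
      W = core (mask (x ∷ []) f)
      W′ = without (x ∷ z ∷ []) (lookup W)
      t≡0 : t₄ x z W f ≡ 0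
      t≡0 = ∑≡0⇒ {xs = subsets} (λ W → t₄ x z W f) (∑≡0⇒ {xs = other x} (λ z → ∑ subsets (λ W → t₄ x z W f))
        (∑≡0⇒ {xs = allFin n} (λ x → ∑ (other x) (λ z → ∑ subsets (λ W → t₄ x z W f))) zero₄ (∈-allFin x))
        (∈-members⁺ (others (x ∷ [])) (without⁺ (x ∷ []) full (λ { (here e) → x≢z (sym e) }) refl))) (∈-subsets W)
      prod≡0 : lates (star x W′) f ≡ 0
      prod≡0 = trans (sym (+-identityʳ _)) (trans (cong (_* lates (star x W′) f)
        (sym (cong₂ _*_ (cong₂ _*_ (is-self (x ∷ []) f) (χ-true (not-true Wz))) (trans (*-identityʳ _) (χ-true sn))))) t≡0)
    ... | e , e∈ , le with ∈-star⁻ {x} {without (x ∷ z ∷ []) (lookup (core (mask (x ∷ []) f)))} e∈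
    ...   | v , Wv , refl = v , without-∈ (x ∷ z ∷ []) (lookup (core (mask (x ∷ []) f))) Wv ,
              (λ { refl → without-∉ (x ∷ z ∷ []) (lookup (core (mask (x ∷ []) f))) Wv (here refl) }) , early (χ≡0⇒ le)
      where
      early : ∀ {b} → not b ≡ false → b ≡ true
      early {true} _ = refl

    rest₅ : Fin n → Fin n → Fin n → Vec Bool n → VSet n
    rest₅ x y z W = without (x ∷ y ∷ z ∷ []) (lookup W)

    stars₅ : Fin n → Fin n → Fin n → Vec Bool n → List (Fin N)
    stars₅ x y z W = star x (rest₅ x y z W) ++ star y (rest₅ x y z W)

    -- Here `z` is any common neighbour: two soon edges cost 4/D², which outweighs the n choices of
    -- `z`.
    t₅ : Fin n → Fin n → Fin n → Vec Bool n → Labelling → ℕ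
    t₅ x y z W f = is (x ∷ y ∷ []) W f * soons (E x z ∷ E y z ∷ []) f * lates (stars₅ x y z W) f

    other₂ : Fin n → Fin n → List (Fin n)
    other₂ x y = members (others (x ∷ y ∷ []))

    β₅ : Labelling → ℕ
    β₅ f = ∑ (allFin n) (λ x → ∑ (other x) (λ y → ∑ (other₂ x y) (λ z → ∑ subsets (λ W → t₅ x y z W f))))

    t₅-bound : ∀ x y z → x ≢ y → x ≢ z → y ≢ z → ∀ W → D * D * (B * B) * ∑ Ω (t₅ x y z W) ≤ 16 * (A * A) * ∑ Ω (is (x ∷ y ∷ []) W)
    t₅-bound x y z x≢y x≢z y≢z W with n ≤? card (lookup W) + w
    ... | no small = ≤-trans (≤-reflexive (trans (cong (D * D * (B * B) *_) (trans (∑-cong Ω vanish) (trans (∑-const Ω 0) (*-zeroʳ (length Ω))))) (*-zeroʳ (D * D * (B * B))))) z≤n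
      where
      vanish : ∀ f → t₅ x y z W f ≡ 0
      vanish f rewrite is-small (x ∷ y ∷ []) W f small = refl
    ... | yes big = *-cancelˡ-≤ (D ^ s * D ^ s) {{m*n≢0 _ _ {{^-pos D s}} {{^-pos D s}}}} (begin
      D ^ s * D ^ s * (D * D * (B * B) * S) ≡⟨ e₁ (D ^ s) D B S ⟩
      B * B * (D ^ 2 * (D ^ s * D ^ s * S)) ≡⟨ cong (λ k → B * B * (D ^ 2 * (k * S))) (trans (cong (D ^_) lenF) (^-distribˡ-+-* D s s)) ⟨
      B * B * (D ^ 2 * (D ^ length Fs * S)) ≡⟨ cong (B * B *_) (exposed (is (x ∷ y ∷ []) W) (E x z ∷ E y z ∷ []) Fs uniq ind) ⟩
      B * B * (2 ^ 2 * (D′ ^ length Fs * Φ)) ≡⟨ cong (λ k → B * B * (2 ^ 2 * (k * Φ))) (trans (cong (D′ ^_) lenF) (^-distribˡ-+-* D′ s s)) ⟩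
      B * B * (2 ^ 2 * (D′ ^ s * D′ ^ s * Φ)) ≡⟨ e₂ B (D′ ^ s) Φ ⟩
      4 * Φ * (D′ ^ s * B * (D′ ^ s * B)) ≤⟨ *-monoʳ-≤ (4 * Φ) (*-mono-≤ rat rat) ⟩
      4 * Φ * (2 * (A * D ^ s) * (2 * (A * D ^ s))) ≡⟨ e₃ Φ A (D ^ s) ⟩
      D ^ s * D ^ s * (16 * (A * A) * Φ) ∎)
      where
      W′ = rest₅ x y z W
      Fs = stars₅ x y z W
      s = card W′
      S = ∑ Ω (t₅ x y z W)
      Φ = ∑ Ω (is (x ∷ y ∷ []) W)
      rat : D′ ^ s * B ≤ 2 * (A * D ^ s)
      rat = ratio s (w + 2) (≤-size W (x ∷ y ∷ z ∷ []) 2 refl big) 2w≤D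
      lenF : length Fs ≡ s + s
      lenF = trans (length-++ (star x W′)) (cong₂ _+_ (length-star x W′) (length-star y W′))
      x≢ : ∀ {v} → W′ v ≡ true → x ≢ v
      x≢ p refl = without-∉ (x ∷ y ∷ z ∷ []) (lookup W) p (here refl)
      y≢ : ∀ {v} → W′ v ≡ true → y ≢ v
      y≢ p refl = without-∉ (x ∷ y ∷ z ∷ []) (lookup W) p (there (here refl))
      z≢ : ∀ {v} → W′ v ≡ true → z ≢ v
      z≢ p refl = without-∉ (x ∷ y ∷ z ∷ []) (lookup W) p (there (there (here refl)))
      uniq : Unique (E x z ∷ E y z ∷ Fs)
      uniq = (xz≢yz ∷ All.tabulate (λ e∈ → fresh e∈ x≢z x≢ z≢))
           ∷ All.tabulate (λ e∈ → fresh e∈ y≢z y≢ z≢)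
           ∷ Unique.++⁺ (star-unique x W′ x≢) (star-unique y W′ y≢) dis
        where
        xz≢yz : E x z ≢ E y z
        xz≢yz eq with E-inj x≢z y≢z eq
        ... | inj₁ (xy , _) = x≢y xy
        ... | inj₂ (xz , _) = x≢z xz
        fresh : ∀ {u e} → e ∈ Fs → u ≢ z → (∀ {v} → W′ v ≡ true → u ≢ v) → (∀ {v} → W′ v ≡ true → z ≢ v) →
                E u z ≢ e
        fresh e∈ u≢z u≢ z≢ eq with ∈-++⁻ (star x W′) e∈
        ... | inj₁ q with ∈-star⁻ {x} {W′} q
        ...   | v , Wv , refl with E-inj u≢z (x≢ Wv) eq
        ...     | inj₁ (_ , zv) = z≢ Wv zv
        ...     | inj₂ (uv , _) = u≢ Wv uv
        fresh e∈ u≢z u≢ z≢ eq | inj₂ q with ∈-star⁻ {y} {W′} q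
        ...   | v , Wv , refl with E-inj u≢z (y≢ Wv) eq
        ...     | inj₁ (_ , zv) = z≢ Wv zv
        ...     | inj₂ (uv , _) = u≢ Wv uv
        dis : ∀ {e} → e ∈ star x W′ × e ∈ star y W′ → ⊥
        dis (p , q) with ∈-star⁻ {x} {W′} p | ∈-star⁻ {y} {W′} q
        ... | u , Wu , refl | v , Wv , eq with E-inj (x≢ Wu) (y≢ Wv) eq
        ...   | inj₁ (xy , _) = x≢y xy
        ...   | inj₂ (xv , _) = x≢ Wv xv
      ind : ∀ {e} → e ∈ E x z ∷ E y z ∷ Fs → IndepOf (is (x ∷ y ∷ []) W) e
      ind {e} e∈ = is-indep (x ∷ y ∷ []) W (at e∈)
        where
        at : e ∈ E x z ∷ E y z ∷ Fs → e ∈ touching (x ∷ y ∷ [])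
        at (here refl) = ∈-touching (x ∷ y ∷ []) (here refl) x≢z
        at (there (here refl)) = ∈-touching (x ∷ y ∷ []) (there (here refl)) y≢z
        at (there (there q)) with ∈-++⁻ (star x W′) q
        ... | inj₁ q′ with ∈-star⁻ {x} {W′} q′
        ...   | v , Wv , refl = ∈-touching (x ∷ y ∷ []) (here refl) (x≢ Wv)
        at (there (there q)) | inj₂ q′ with ∈-star⁻ {y} {W′} q′
        ...   | v , Wv , refl = ∈-touching (x ∷ y ∷ []) (there (here refl)) (y≢ Wv)
      e₁ : ∀ k d b s → k * k * (d * d * (b * b) * s) ≡ b * b * (d * (d * 1) * (k * k * s))
      e₁ = solve-∀
      e₂ : ∀ b k p → b * b * (4 * (k * k * p)) ≡ 4 * p * (k * b * (k * b))
      e₂ = solve-∀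
      e₃ : ∀ p a k → 4 * p * (2 * (a * k) * (2 * (a * k))) ≡ k * k * (16 * (a * a) * p)
      e₃ = solve-∀

    β₅-bound : D * D * (B * B) * ∑ Ω β₅ ≤ 16 * (A * A) * (n * n * n * total)
    β₅-bound = begin
      c * ∑ Ω β₅
        ≤⟨ ∑Ω-bound (allFin n) (λ x f → ∑ (other x) (λ y → ∑ (other₂ x y) (λ z → ∑ subsets (λ W → t₅ x y z W f))))
                               (λ x f → ∑ (other x) (λ y → ∑ (other₂ x y) (λ z → ∑ subsets (λ W → φ x y W f)))) c c′
             (λ x _ → ∑Ω-bound (other x) (λ y f → ∑ (other₂ x y) (λ z → ∑ subsets (λ W → t₅ x y z W f)))
                                         (λ y f → ∑ (other₂ x y) (λ z → ∑ subsets (λ W → φ x y W f))) c c′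
               (λ y y∈ → ∑Ω-bound (other₂ x y) (λ z f → ∑ subsets (λ W → t₅ x y z W f)) (λ z f → ∑ subsets (λ W → φ x y W f)) c c′
                 (λ z z∈ → ∑Ω-bound subsets (λ W f → t₅ x y z W f) (λ W f → φ x y W f) c c′
                   (λ W _ → t₅-bound x y z (others-≢ (x ∷ []) (∈-members⁻ (others (x ∷ [])) y∈) (here refl))
                     (others-≢ (x ∷ y ∷ []) (∈-members⁻ (others (x ∷ y ∷ [])) z∈) (here refl))
                     (others-≢ (x ∷ y ∷ []) (∈-members⁻ (others (x ∷ y ∷ [])) z∈) (there (here refl))) W)))) ⟩
      c′ * ∑ Ω (λ f → ∑ (allFin n) (λ x → ∑ (other x) (λ y → ∑ (other₂ x y) (λ z → ∑ subsets (λ W → φ x y W f)))))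
        ≤⟨ *-monoʳ-≤ c′ (∑-mono Ω pointwise) ⟩
      c′ * ∑ Ω (λ f → n * n * n * 1)
        ≡⟨ cong (c′ *_) (∑-*ˡ Ω (n * n * n) (λ _ → 1)) ⟩
      c′ * (n * n * n * total) ∎
      where
      c c′ : ℕ
      c = D * D * (B * B)
      c′ = 16 * (A * A)
      φ : Fin n → Fin n → Vec Bool n → Labelling → ℕ
      φ x y W f = is (x ∷ y ∷ []) W f
      all-n : ∀ k → ∑ (allFin n) (λ _ → k) ≡ n * k
      all-n k = trans (∑-const (allFin n) k) (cong (_* k) (length-allFin n))
      pointwise : ∀ f → ∑ (allFin n) (λ x → ∑ (other x) (λ y → ∑ (other₂ x y) (λ z → ∑ subsets (λ W → φ x y W f)))) ≤ n * n * n * 1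
      pointwise f = begin
        ∑ (allFin n) (λ x → ∑ (other x) (λ y → ∑ (other₂ x y) (λ z → ∑ subsets (λ W → φ x y W f))))
          ≡⟨ ∑-cong (allFin n) (λ x → ∑-cong (other x) (λ y → ∑-cong (other₂ x y) (λ z → ∑-eqV (core (mask (x ∷ y ∷ []) f))))) ⟩
        ∑ (allFin n) (λ x → ∑ (other x) (λ y → ∑ (other₂ x y) (λ z → 1)))
          ≤⟨ ∑-mono (allFin n) (λ x → ≤-trans (∑-mono (other x) (λ y → ≤-trans (∑-members≤ (others (x ∷ y ∷ [])) (λ _ → 1)) (≤-reflexive (all-n 1))))
               (≤-trans (∑-members≤ (others (x ∷ [])) (λ _ → n * 1)) (≤-reflexive (all-n (n * 1))))) ⟩
        ∑ (allFin n) (λ x → n * (n * 1))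
          ≡⟨ trans (all-n (n * (n * 1))) (eq n) ⟩
        n * n * n * 1 ∎
        where
        eq : ∀ n → n * (n * (n * 1)) ≡ n * n * n * 1
        eq = solve-∀

    t₅-zero : ∀ f → β₅ f ≡ 0 → ∀ x y z → x ≢ y → x ≢ z → y ≢ z →
      soonᵇ (lookup f (E x z)) ≡ true → soonᵇ (lookup f (E y z)) ≡ true →
      ∃ λ v → lookup (core (mask (x ∷ y ∷ []) f)) v ≡ true × v ≢ x × v ≢ y × v ≢ z ×
        (earlyᵇ (lookup f (E x v)) ≡ true ⊎ earlyᵇ (lookup f (E y v)) ≡ true)
    t₅-zero f zero₅ x y z x≢y x≢z y≢z sx sy with ∏≡0⇒ (stars₅ x y z W) (λ e → late (lookup f e)) prod≡0
      where
      W = core (mask (x ∷ y ∷ []) f)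
      t≡0 : t₅ x y z W f ≡ 0
      t≡0 = ∑≡0⇒ {xs = subsets} (λ W → t₅ x y z W f) (∑≡0⇒ {xs = other₂ x y} (λ z → ∑ subsets (λ W → t₅ x y z W f))
        (∑≡0⇒ {xs = other x} (λ y → ∑ (other₂ x y) (λ z → ∑ subsets (λ W → t₅ x y z W f)))
          (∑≡0⇒ {xs = allFin n} (λ x → ∑ (other x) (λ y → ∑ (other₂ x y) (λ z → ∑ subsets (λ W → t₅ x y z W f)))) zero₅ (∈-allFin x))
          (∈-members⁺ (others (x ∷ [])) (without⁺ (x ∷ []) full (λ { (here e) → x≢y (sym e) }) refl)))
        (∈-members⁺ (others (x ∷ y ∷ [])) (without⁺ (x ∷ y ∷ []) full (λ { (here e) → x≢z (sym e) ; (there (here e)) → y≢z (sym e) }) refl))) (∈-subsets W)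
      prod≡0 : lates (stars₅ x y z W) f ≡ 0
      prod≡0 = trans (sym (+-identityʳ _)) (trans (cong (_* lates (stars₅ x y z W) f)
        (sym (cong₂ _*_ (is-self (x ∷ y ∷ []) f) (cong₂ _*_ (χ-true sx) (trans (*-identityʳ _) (χ-true sy)))))) t≡0)
    ... | e , e∈ , le = found (∈-++⁻ (star x W′) e∈)
      where
      W′ = rest₅ x y z (core (mask (x ∷ y ∷ []) f))
      early : ∀ {b} → not b ≡ false → b ≡ true
      early {true} _ = refl
      avoid : ∀ {v} → W′ v ≡ true → v ≢ x × v ≢ y × v ≢ z
      avoid Wv = (λ { refl → out (here refl) }) , (λ { refl → out (there (here refl)) }) , (λ { refl → out (there (there (here refl))) })
        where out = without-∉ (x ∷ y ∷ z ∷ []) (lookup (core (mask (x ∷ y ∷ []) f))) Wv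
      found : e ∈ star x W′ ⊎ e ∈ star y W′ → _
      found (inj₁ q) with ∈-star⁻ {x} {W′} q
      ... | v , Wv , refl = let (a , b , c) = avoid Wv in
              v , without-∈ (x ∷ y ∷ z ∷ []) (lookup (core (mask (x ∷ y ∷ []) f))) Wv , a , b , c , inj₁ (early (χ≡0⇒ le))
      found (inj₂ q) with ∈-star⁻ {y} {W′} q
      ... | v , Wv , refl = let (a , b , c) = avoid Wv in
              v , without-∈ (x ∷ y ∷ z ∷ []) (lookup (core (mask (x ∷ y ∷ []) f))) Wv , a , b , c , inj₂ (early (χ≡0⇒ le))

-- Entropy against exponential decay

-- The threshold data with D written as 2 + `D″`, so that 1 - 2/D has the numerator `D″`.
record Scale (X₀ e Z n′ : ℕ) : Set where
  field
    d D″   : ℕ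
    d≥1    : 1 ≤ d
    D≡ed   : 2 + D″ ≡ e * d
    lower  : X₀ * (2 + D″) ^ n′ ≤ suc n′ * (1 + D″) ^ n′
    upper  : suc n′ * (1 + D″) ^ n′ ≤ 2 * X₀ * (2 + D″) ^ n′
    D²≥    : Z * suc n′ ≤ (2 + D″) * (2 + D″)
    n≥     : Z * (2 + D″) ≤ suc n′

toScale : ∀ {X₀ e Z n′} → 2 ≤ e → Threshold X₀ e Z n′ → Scale X₀ e Z n′
toScale 2≤e record { d = d ; D' = zero ; d≥1 = d≥1 ; D≡ed = D≡ed } =
  ⊥-elim (<⇒≱ (*-mono-≤ 2≤e d≥1) (≤-reflexive (sym D≡ed)))
toScale 2≤e record { d = d ; D' = suc D″ ; d≥1 = d≥1 ; D≡ed = D≡ed ; lower = l ; upper = u ; D²≥ = q ; n≥ = n≥ } =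
  record { d = d ; D″ = D″ ; d≥1 = d≥1 ; D≡ed = D≡ed ; lower = l ; upper = u ; D²≥ = q ; n≥ = n≥ }

-- (1 + 2/p)^(p c) ≥ 1 + 2c ≥ c, and `g` has room for `j` such blocks.
pow-dominates : ∀ p c j g → 1 ≤ p → p * c * j ≤ g → c ^ j * p ^ g ≤ (p + 2) ^ g
pow-dominates p c j g p≥1 le = *-cancelˡ-≤ (p ^ (h * j)) {{^-pos p (h * j) {{p≢0}}}} (begin
  p ^ (h * j) * (c ^ j * p ^ g) ≡⟨ e₁ (p ^ (h * j)) (c ^ j) (p ^ g) ⟩
  c ^ j * p ^ (h * j) * p ^ g ≤⟨ *-monoˡ-≤ (p ^ g) block ⟩
  (p + 2) ^ (h * j) * p ^ g ≡⟨ *-comm _ (p ^ g) ⟩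
  p ^ g * (p + 2) ^ (h * j) ≤⟨ ^-ratio-mono (m≤m+n p 2) le ⟩
  p ^ (h * j) * (p + 2) ^ g ∎)
  where
  open ≤-Reasoning
  h = p * c
  p≢0 : NonZero p
  p≢0 = >-nonZero p≥1
  e₁ : ∀ a b c → a * (b * c) ≡ b * a * c
  e₁ = solve-∀
  one : c * p ^ h ≤ (p + 2) ^ h
  one = *-cancelʳ-≤ _ _ p {{p≢0}} (begin
    c * p ^ h * p ≡⟨ e₂ c (p ^ h) p ⟩
    p ^ h * (p * c) ≤⟨ *-monoʳ-≤ (p ^ h) (≤-trans (m≤m*n (p * c) 2) (m≤n+m _ p)) ⟩
    p ^ h * (p + h * 2) ≤⟨ bernoulli⁺ p 2 h ⟩
    (p + 2) ^ h * p ∎)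
    where
    e₂ : ∀ c x p → c * x * p ≡ x * (p * c)
    e₂ = solve-∀
  block : c ^ j * p ^ (h * j) ≤ (p + 2) ^ (h * j)
  block = begin
    c ^ j * p ^ (h * j) ≡⟨ cong (c ^ j *_) (^-*-assoc p h j) ⟨
    c ^ j * (p ^ h) ^ j ≡⟨ ^-distrib-* c (p ^ h) j ⟨
    (c * p ^ h) ^ j ≤⟨ ^-monoˡ-≤ j one ⟩
    ((p + 2) ^ h) ^ j ≡⟨ ^-*-assoc (p + 2) h j ⟩
    (p + 2) ^ (h * j) ∎

-- Entropy against decay: with p = 8y, a factor (1 + 1/p) per vertex, the constant c and the
-- factor (2p)^K' are together beaten by (1 + 1/y)^g.
entropy-decay : ∀ y c K′ n g → 1 ≤ y → n ≤ 2 * g → 8 * y * (16 * y) * K′ ≤ g → 8 * y * c ≤ g →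
  c * ((16 * y) ^ K′ * (16 * y + 2) ^ n) * y ^ g ≤ (16 * y) ^ n * suc y ^ g
entropy-decay y c K′ n g y≥1 n≤2g hK hc = *-cancelˡ-≤ (8 ^ g * (p ^ g * (p ^ n * (p ^ (2 * g))) * p ^ g)) {{nz}} (begin
  8 ^ g * (p ^ g * (p ^ n * p ^ (2 * g)) * p ^ g) * (c * ((16 * y) ^ K′ * (16 * y + 2) ^ n) * y ^ g)
    ≡⟨ cong (λ z → 8 ^ g * (p ^ g * (p ^ n * p ^ (2 * g)) * p ^ g) * (c * ((16 * y) ^ K′ * z) * y ^ g)) (trans (cong (_^ n) (x+2 y)) (^-distrib-* 2 (p + 1) n)) ⟩
  8 ^ g * (p ^ g * (p ^ n * p ^ (2 * g)) * p ^ g) * (c * ((16 * y) ^ K′ * (2 ^ n * (p + 1) ^ n)) * y ^ g)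
    ≡⟨ e₁ (8 ^ g) (p ^ g) (p ^ n) (p ^ (2 * g)) c ((16 * y) ^ K′) (2 ^ n) ((p + 1) ^ n) (y ^ g) ⟩
  c * p ^ g * ((16 * y) ^ K′ * p ^ g) * ((p ^ (2 * g) * (p + 1) ^ n) * (2 ^ n * p ^ n * (8 ^ g * y ^ g)))
    ≤⟨ *-mono-≤ (*-mono-≤ dom-c dom-X) (*-monoˡ-≤ (2 ^ n * p ^ n * (8 ^ g * y ^ g)) grow-n) ⟩
  (p + 2) ^ g * (p + 2) ^ g * ((p ^ n * (p + 1) ^ (2 * g)) * (2 ^ n * p ^ n * (8 ^ g * y ^ g)))
    ≡⟨ cong₂ (λ a b → (p + 2) ^ g * (p + 2) ^ g * ((p ^ n * a) * (2 ^ n * p ^ n * b)))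
         (trans (cong ((p + 1) ^_) (cong (g +_) (+-identityʳ g))) (^-distribˡ-+-* (p + 1) g g)) (sym (^-distrib-* 8 y g)) ⟩
  (p + 2) ^ g * (p + 2) ^ g * ((p ^ n * ((p + 1) ^ g * (p + 1) ^ g)) * (2 ^ n * p ^ n * p ^ g))
    ≡⟨ e₂ ((p + 2) ^ g) ((p + 1) ^ g) (p ^ n) (2 ^ n) (p ^ g) ⟩
  ((p + 2) ^ g * (p + 2) ^ g * ((p + 1) ^ g * (p + 1) ^ g)) * (p ^ g * (p ^ n * (2 ^ n * p ^ n)))
    ≡⟨ cong (_* (p ^ g * (p ^ n * (2 ^ n * p ^ n)))) (trans (cong₂ _*_ (sym (^-distrib-* (p + 2) (p + 2) g)) (sym (^-distrib-* (p + 1) (p + 1) g))) (sym (^-distrib-* ((p + 2) * (p + 2)) ((p + 1) * (p + 1)) g))) ⟩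
  ((p + 2) * (p + 2) * ((p + 1) * (p + 1))) ^ g * (p ^ g * (p ^ n * (2 ^ n * p ^ n)))
    ≤⟨ *-monoˡ-≤ _ (^-monoˡ-≤ g poly) ⟩
  (p * p * p * (8 * suc y)) ^ g * (p ^ g * (p ^ n * (2 ^ n * p ^ n)))
    ≡⟨ cong₂ _*_ (trans (^-distrib-* (p * p * p) (8 * suc y) g) (cong₂ _*_ (trans (^-distrib-* (p * p) p g) (cong (_* p ^ g) (^-distrib-* p p g))) (^-distrib-* 8 (suc y) g)))
         (cong (λ z → p ^ g * (p ^ n * z)) (trans (sym (^-distrib-* 2 p n)) (cong (_^ n) (x≡ y)))) ⟩
  p ^ g * p ^ g * p ^ g * (8 ^ g * suc y ^ g) * (p ^ g * (p ^ n * (16 * y) ^ n))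
    ≡⟨ e₃ (p ^ g) (8 ^ g) (suc y ^ g) (p ^ n) ((16 * y) ^ n) ⟩
  8 ^ g * (p ^ g * (p ^ n * (p ^ g * p ^ g)) * p ^ g) * ((16 * y) ^ n * suc y ^ g)
    ≡⟨ cong (λ z → 8 ^ g * (p ^ g * (p ^ n * z) * p ^ g) * ((16 * y) ^ n * suc y ^ g)) (trans (sym (^-distribˡ-+-* p g g)) (cong (λ z → p ^ (g + z)) (sym (+-identityʳ g)))) ⟩
  8 ^ g * (p ^ g * (p ^ n * p ^ (2 * g)) * p ^ g) * ((16 * y) ^ n * suc y ^ g) ∎)
  where
  open ≤-Reasoning
  p = 8 * y
  p≥8 : 8 ≤ p
  p≥8 = *-monoʳ-≤ 8 y≥1
  p≥1 : 1 ≤ p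
  p≥1 = ≤-trans (s≤s z≤n) p≥8
  p≢0 : NonZero p
  p≢0 = >-nonZero p≥1
  nz : NonZero (8 ^ g * (p ^ g * (p ^ n * p ^ (2 * g)) * p ^ g))
  nz = m*n≢0 (8 ^ g) _ {{^-pos 8 g}} {{m*n≢0 _ (p ^ g) {{m*n≢0 (p ^ g) _ {{^-pos p g {{p≢0}}}} {{m*n≢0 (p ^ n) _ {{^-pos p n {{p≢0}}}} {{^-pos p (2 * g) {{p≢0}}}}}}}} {{^-pos p g {{p≢0}}}}}}
  x≡ : ∀ y → 2 * (8 * y) ≡ 16 * y
  x≡ = solve-∀
  x+2 : ∀ y → 16 * y + 2 ≡ 2 * (8 * y + 1)
  x+2 = solve-∀
  dom-c : c * p ^ g ≤ (p + 2) ^ g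
  dom-c = subst (λ z → z * p ^ g ≤ (p + 2) ^ g) (*-identityʳ c) (pow-dominates p c 1 g p≥1 (≤-trans (≤-reflexive (*-identityʳ (p * c))) hc))
  dom-X : (16 * y) ^ K′ * p ^ g ≤ (p + 2) ^ g
  dom-X = pow-dominates p (16 * y) K′ g p≥1 hK
  grow-n : p ^ (2 * g) * (p + 1) ^ n ≤ p ^ n * (p + 1) ^ (2 * g)
  grow-n = ^-ratio-mono (m≤m+n p 1) n≤2g
  -- This is (1 + 2/p)² (1 + 1/p)² ≤ 1 + 8/p = 1 + 1/y. The factors 1 + 2/p pay for `c` and for
  -- (2p)^K′; the factors 1 + 1/p pay for the n ≤ 2g vertices.
  poly : (p + 2) * (p + 2) * ((p + 1) * (p + 1)) ≤ p * p * p * (8 * suc y)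
  poly = begin
    (p + 2) * (p + 2) * ((p + 1) * (p + 1)) ≡⟨ q₁ p ⟩
    p * p * p * p + 6 * (p * p * p) + (13 * (p * p) + 12 * p + 4) ≤⟨ +-monoʳ-≤ (p * p * p * p + 6 * (p * p * p)) tail ⟩
    p * p * p * p + 6 * (p * p * p) + 2 * (p * p * p) ≡⟨ q₂ p ⟩
    p * p * p * (8 + p) ≡⟨ cong (p * p * p *_) (sym (*-suc 8 y)) ⟩
    p * p * p * (8 * suc y) ∎
    where
    q₁ : ∀ p → (p + 2) * (p + 2) * ((p + 1) * (p + 1)) ≡ p * p * p * p + 6 * (p * p * p) + (13 * (p * p) + 12 * p + 4)
    q₁ = solve-∀
    q₂ : ∀ p → p * p * p * p + 6 * (p * p * p) + 2 * (p * p * p) ≡ p * p * p * (8 + p)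
    q₂ = solve-∀
    tail : 13 * (p * p) + 12 * p + 4 ≤ 2 * (p * p * p)
    tail = begin
      13 * (p * p) + 12 * p + 4 ≤⟨ +-mono-≤ (+-monoʳ-≤ (13 * (p * p)) (≤-trans (*-monoˡ-≤ p (m≤m+n 12 4)) (≤-trans (≤-reflexive (q₄ p)) (*-monoʳ-≤ 2 (*-monoˡ-≤ p p≥8)))))
                                                          (≤-trans (m≤m+n 4 4) (≤-trans p≥8 (m≤m*n p p {{p≢0}}))) ⟩
      13 * (p * p) + 2 * (p * p) + p * p ≡⟨ q₃ p ⟩
      2 * (8 * (p * p)) ≤⟨ *-monoʳ-≤ 2 (*-monoˡ-≤ (p * p) p≥8) ⟩
      2 * (p * (p * p)) ≡⟨ cong (2 *_) (*-assoc p p p) ⟨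
      2 * (p * p * p) ∎
      where
      q₃ : ∀ p → 13 * (p * p) + 2 * (p * p) + p * p ≡ 2 * (8 * (p * p))
      q₃ = solve-∀
      q₄ : ∀ p → 16 * p ≡ 2 * (8 * p)
      q₄ = solve-∀
  e₁ : ∀ a b c d k x t n y → a * (b * (c * d) * b) * (k * (x * (t * n)) * y) ≡ k * b * (x * b) * ((d * n) * (t * c * (a * y)))
  e₁ = solve-∀
  e₂ : ∀ a b c t g → a * a * ((c * (b * b)) * (t * c * g)) ≡ (a * a * (b * b)) * (g * (c * (t * c)))
  e₂ = solve-∀
  e₃ : ∀ g a s n x → g * g * g * (a * s) * (g * (n * x)) ≡ a * (g * (n * (g * g)) * g) * (x * s)
  e₃ = solve-∀

-- The weight X^{#inB} turns the constraint "all but K′ vertices have type B" into a product measure.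
types-entropy : ∀ n X K′ (cnd : Vec Ty n → Bool) → 1 ≤ X →
  (∀ τ → cnd τ ≡ true → n ≤ card (isB ∘ lookup τ) + K′) →
  X ^ n * ∑ (allVecs tys n) (χ ∘ cnd) ≤ X ^ K′ * (X + 2) ^ n
types-entropy n X K′ cnd X≥1 size = begin
  X ^ n * ∑ (allVecs tys n) (χ ∘ cnd) ≡⟨ ∑-*ˡ (allVecs tys n) (X ^ n) (χ ∘ cnd) ⟨
  ∑ (allVecs tys n) (λ τ → X ^ n * χ (cnd τ)) ≤⟨ ∑-mono (allVecs tys n) pointwise ⟩
  ∑ (allVecs tys n) (λ τ → X ^ K′ * ∏ (Vec.toList τ) weight) ≡⟨ ∑-*ˡ (allVecs tys n) (X ^ K′) _ ⟩
  X ^ K′ * ∑ (allVecs tys n) (λ τ → ∏ (Vec.toList τ) weight) ≡⟨ cong (X ^ K′ *_) (∑-∏-allVecs tys n weight) ⟩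
  X ^ K′ * ∑ tys weight ^ n ≡⟨ cong (λ z → X ^ K′ * z ^ n) (eq X) ⟩
  X ^ K′ * (X + 2) ^ n ∎
  where
  open ≤-Reasoning
  X≢0 : NonZero X
  X≢0 = >-nonZero X≥1
  weight : Ty → ℕ
  weight inB = X
  weight _   = 1
  eq : ∀ x → 1 + (x + (1 + 0)) ≡ x + 2
  eq = solve-∀
  weights : ∀ {n} (τ : Vec Ty n) → ∏ (Vec.toList τ) weight ≡ X ^ card (isB ∘ lookup τ)
  weights []      = refl
  weights {suc n} (t ∷ τ) = trans (cong₂ _*_ (head t) (weights τ)) (trans (sym (^-distribˡ-+-* X (χ (isB t)) _))
    (cong (X ^_) (sym (∑-allFin-suc n (λ i → χ (isB (lookup (t ∷ τ) i)))))))
    where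
    head : ∀ t → weight t ≡ X ^ χ (isB t)
    head inA  = refl
    head inB  = sym (*-identityʳ X)
    head rest = refl
  pointwise : ∀ τ → X ^ n * χ (cnd τ) ≤ X ^ K′ * ∏ (Vec.toList τ) weight
  pointwise τ with cnd τ | size τ
  ... | false | _ = ≤-trans (≤-reflexive (*-zeroʳ (X ^ n))) z≤n
  ... | true  | s = begin
    X ^ n * 1 ≡⟨ *-identityʳ _ ⟩
    X ^ n ≤⟨ ^-monoʳ-≤ X {{X≢0}} (≤-trans (s refl) (≤-reflexive (+-comm _ K′))) ⟩
    X ^ (K′ + card (isB ∘ lookup τ)) ≡⟨ ^-distribˡ-+-* X K′ _ ⟩
    X ^ K′ * X ^ card (isB ∘ lookup τ) ≡⟨ cong (X ^ K′ *_) (weights τ) ⟨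
    X ^ K′ * ∏ (Vec.toList τ) weight ∎

-- Choice of the constants

module Parameters (k r ℓ′ : ℕ) (r≥1 : 1 ≤ r) where

  -- Each of the six bad events will have probability at most 1/Q.  The expected number of isolated
  -- vertices is between X₀ and 2 X₀, the edge probability is 1/D = 1/(e d), and d and u₁ = c₁ D are
  -- the sizes from which sets expand and from which they are joined to all sets of b vertices.
  opaque
    Q X₀ e₂ c₁ : ℕ
    -- Six events of probability 1/Q add up to 1/(2 (k + 1)); the remaining factor 2 covers
    -- labellings with repeated times. The second moment bound 2/X₀ explains X₀ = 2 Q.
    Q  = 12 * suc k
    X₀ = 2 * Q
    -- This makes D = 24 X₀ r Q d, which is what `bound₄` needs for a core missing 3 r d vertices.
    e₂ = 12 * (X₀ * r * Q)
    -- Sets of sizes `u₁` and `b` then have at least 2 n D r possible edges between them, so lacking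
    -- a colour has probability at most 4^(-n), against 3^n pairs of sets.
    c₁ = 32 * suc ℓ′ * r

    Q≡ : Q ≡ 12 * suc k
    Q≡ = refl
    X₀≡ : X₀ ≡ 2 * Q
    X₀≡ = refl
    e₂≡ : e₂ ≡ 12 * (X₀ * r * Q)
    e₂≡ = refl
    c₁≡ : c₁ ≡ 32 * suc ℓ′ * r
    c₁≡ = refl

  ℓ e y κ cₛ : ℕ
  ℓ  = suc ℓ′
  e  = 2 * e₂
  y  = e * r
  κ  = 5 * ℓ
  cₛ = ℓ * c₁

  opaque
    c_K P Z large : ℕ
    c_K   = cₛ + (κ * cₛ + (2 * κ + r + 1) * 3) + 2
    P     = 8 * y * (16 * y)
    -- The summands serve, in order, the hypothesis of `threshold`, `bound₅`, (P + 4) K′ ≤ n and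
    -- `u₁≤b`. Those of `large` serve `bound₂`, `three-four`, `8yQr≤g` and `b≥1`.
    Z     = 16 * e₂ + 64 * (X₀ * X₀) * Q + (P + 4) * c_K + 16 * ℓ * c₁
    large = 4 * (X₀ * X₀) * Q + 3 * (Q * r) + 2 * (8 * y * (Q * r)) + 8 * ℓ

    c_K≡ : c_K ≡ cₛ + (κ * cₛ + (2 * κ + r + 1) * 3) + 2
    c_K≡ = refl
    P≡ : P ≡ 8 * y * (16 * y)
    P≡ = refl

  Q≥1 : 1 ≤ Q
  Q≥1 = subst (1 ≤_) (sym Q≡) (s≤s z≤n)
  X₀≥1 : 1 ≤ X₀
  X₀≥1 = subst (1 ≤_) (sym X₀≡) (*-mono-≤ {1} {2} (s≤s z≤n) Q≥1)
  X₀rQ≥1 : 1 ≤ X₀ * r * Q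
  X₀rQ≥1 = *-mono-≤ {1} {X₀ * r} {1} {Q} (*-mono-≤ {1} {X₀} {1} {r} X₀≥1 r≥1) Q≥1
  e₂≥1 : 1 ≤ e₂
  e₂≥1 = subst (1 ≤_) (sym e₂≡) (*-mono-≤ {1} {12} (s≤s z≤n) X₀rQ≥1)
  e≥2 : 2 ≤ e
  e≥2 = *-monoʳ-≤ 2 e₂≥1
  y≥1 : 1 ≤ y
  y≥1 = *-mono-≤ {1} {e} {1} {r} (≤-trans (s≤s z≤n) e≥2) r≥1

  private
    Z₁ Z₂ Z₃ Z₄ : ℕ
    Z₁ = 16 * e₂
    Z₂ = 64 * (X₀ * X₀) * Q
    Z₃ = (P + 4) * c_K
    Z₄ = 16 * ℓ * c₁

  opaque
    unfolding Z large

    Z≥₁ : Z₁ ≤ Z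
    Z≥₁ = ≤-trans (m≤m+n Z₁ Z₂) (≤-trans (m≤m+n (Z₁ + Z₂) Z₃) (m≤m+n (Z₁ + Z₂ + Z₃) Z₄))
    Z≥₂ : Z₂ ≤ Z
    Z≥₂ = ≤-trans (m≤n+m Z₂ Z₁) (≤-trans (m≤m+n (Z₁ + Z₂) Z₃) (m≤m+n (Z₁ + Z₂ + Z₃) Z₄))
    Z≥₃ : Z₃ ≤ Z
    Z≥₃ = ≤-trans (m≤n+m Z₃ (Z₁ + Z₂)) (m≤m+n (Z₁ + Z₂ + Z₃) Z₄)
    Z≥₄ : Z₄ ≤ Z
    Z≥₄ = m≤n+m Z₄ (Z₁ + Z₂ + Z₃)

    large≥₁ : 4 * (X₀ * X₀) * Q ≤ large
    large≥₁ = ≤-trans (m≤m+n _ (3 * (Q * r))) (≤-trans (m≤m+n _ (2 * (8 * y * (Q * r)))) (m≤m+n _ (8 * ℓ)))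
    large≥₂ : 3 * (Q * r) ≤ large
    large≥₂ = ≤-trans (m≤n+m _ (4 * (X₀ * X₀) * Q)) (≤-trans (m≤m+n _ (2 * (8 * y * (Q * r)))) (m≤m+n _ (8 * ℓ)))
    large≥₃ : 2 * (8 * y * (Q * r)) ≤ large
    large≥₃ = ≤-trans (m≤n+m _ (4 * (X₀ * X₀) * Q + 3 * (Q * r))) (m≤m+n _ (8 * ℓ))
    large≥₄ : 8 * ℓ ≤ large
    large≥₄ = m≤n+m _ (4 * (X₀ * X₀) * Q + 3 * (Q * r) + 2 * (8 * y * (Q * r)))

  module Sizes (n n′ : ℕ) (n≡ : n ≡ suc n′) (sc : Scale X₀ e Z n′) (n-large : large ≤ n) where
    open Scale sc public
    open ≤-Reasoning

    D u u₁ s K K′ w b g : ℕ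
    D  = 2 + D″
    -- Removing the at most two masked vertices from a set of 3d vertices still leaves `d`.
    u  = 3 * d
    u₁ = c₁ * D
    s  = ℓ * u₁
    -- `K` is large enough for both hypotheses `K₁` and `K₂` of the removal process. `K′` adds the
    -- set itself and two masked vertices: it bounds everything outside the part that a
    -- non-expanding set cannot reach.
    K  = κ * s + (2 * κ + r + 1) * u
    K′ = s + K + 2
    w  = r * u
    -- Filling at most ℓ classes with `b` vertices and keeping `b` more free takes at most n/4
    -- vertices; two trees of size `s` and the two ends take at most n/2.
    b  = n / (8 * ℓ)
    g  = n ∸ K′

    ZD≤n : Z * D ≤ n
    ZD≤n = subst (Z * D ≤_) (sym n≡) n≥

    Zn≤DD : Z * n ≤ D * D
    Zn≤DD = subst (λ z → Z * z ≤ D * D) (sym n≡) D²≥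

    d≤D : d ≤ D
    d≤D = ≤-trans (m≤n*m d e {{>-nonZero (≤-trans (s≤s z≤n) e≥2)}}) (≤-reflexive (sym D≡ed))

    s≡ : s ≡ cₛ * D
    s≡ = sym (*-assoc ℓ c₁ D)

    K′≤ : K′ ≤ c_K * D
    K′≤ = begin
      s + (κ * s + (2 * κ + r + 1) * (3 * d)) + 2
        ≤⟨ +-mono-≤ (+-monoʳ-≤ s (+-monoʳ-≤ (κ * s) (*-monoʳ-≤ (2 * κ + r + 1) (*-monoʳ-≤ 3 d≤D)))) (≤-trans (≤-reflexive (sym (*-identityʳ 2))) (*-monoʳ-≤ 2 (s≤s (z≤n {suc D″})))) ⟩
      s + (κ * s + (2 * κ + r + 1) * (3 * D)) + 2 * D
        ≡⟨ cong (λ z → z + (κ * z + (2 * κ + r + 1) * (3 * D)) + 2 * D) s≡ ⟩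
      cₛ * D + (κ * (cₛ * D) + (2 * κ + r + 1) * (3 * D)) + 2 * D
        ≡⟨ trans (eq cₛ κ (2 * κ + r + 1) D) (cong (_* D) (sym c_K≡)) ⟩
      c_K * D ∎
      where
      eq : ∀ c k q d → c * d + (k * (c * d) + q * (3 * d)) + 2 * d ≡ (c + (k * c + q * 3) + 2) * d
      eq = solve-∀

    PK′≤n : (P + 4) * K′ ≤ n
    PK′≤n = begin
      (P + 4) * K′ ≤⟨ *-monoʳ-≤ (P + 4) K′≤ ⟩
      (P + 4) * (c_K * D) ≡⟨ *-assoc (P + 4) c_K D ⟨
      (P + 4) * c_K * D ≤⟨ *-monoˡ-≤ D Z≥₃ ⟩
      Z * D ≤⟨ ZD≤n ⟩
      n ∎

    4K′≤n : 4 * K′ ≤ n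
    4K′≤n = ≤-trans (*-monoˡ-≤ K′ (m≤n+m 4 P)) PK′≤n

    K′≤n : K′ ≤ n
    K′≤n = ≤-trans (m≤n*m K′ 4) 4K′≤n

    g+K′ : g + K′ ≡ n
    g+K′ = m∸n+n≡m K′≤n

    PK′≤g : P * K′ ≤ g
    PK′≤g = m+n≤o⇒m≤o∸n (P * K′) (≤-trans (≤-trans (+-monoʳ-≤ (P * K′) (m≤n*m K′ 4)) (≤-reflexive (sym (*-distribʳ-+ K′ P 4)))) PK′≤n)

    n≤2g : n ≤ 2 * g
    n≤2g = +-cancelʳ-≤ (2 * K′) _ _ (begin
      n + 2 * K′ ≤⟨ +-monoʳ-≤ n (≤-trans (*-monoˡ-≤ K′ (s≤s (s≤s (z≤n {2})))) 4K′≤n) ⟩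
      n + n ≡⟨ cong (λ z → z + z) g+K′ ⟨
      g + K′ + (g + K′) ≡⟨ eq g K′ ⟩
      2 * g + 2 * K′ ∎)
      where
      eq : ∀ g k → g + k + (g + k) ≡ 2 * g + 2 * k
      eq = solve-∀

    8yQr≤g : 8 * y * (Q * r) ≤ g
    8yQr≤g = *-cancelˡ-≤ 2 (≤-trans large≥₃ (≤-trans n-large n≤2g))

    8ℓb≤n : 8 * ℓ * b ≤ n
    8ℓb≤n = ≤-trans (≤-reflexive (*-comm (8 * ℓ) b)) (≤-trans (m≤n+m (b * (8 * ℓ)) (n % (8 * ℓ))) (≤-reflexive (sym (m≡m%n+[m/n]*n n (8 * ℓ)))))

    b≥1 : 1 ≤ b
    b≥1 with n / (8 * ℓ) | m≡m%n+[m/n]*n n (8 * ℓ)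
    ... | suc _ | _ = s≤s z≤n
    ... | zero  | q = ⊥-elim (<⇒≱ (subst (_< 8 * ℓ) (sym (trans q (+-identityʳ _))) (m%n<n n (8 * ℓ))) (≤-trans large≥₄ n-large))

    n≤16ℓb : n ≤ 16 * ℓ * b
    n≤16ℓb = begin
      n ≡⟨ m≡m%n+[m/n]*n n (8 * ℓ) ⟩
      n % (8 * ℓ) + b * (8 * ℓ) ≤⟨ +-monoˡ-≤ (b * (8 * ℓ)) (≤-trans (<⇒≤ (m%n<n n (8 * ℓ))) (m≤n*m (8 * ℓ) b {{>-nonZero b≥1}})) ⟩
      b * (8 * ℓ) + b * (8 * ℓ) ≡⟨ eq b ℓ ⟩
      16 * ℓ * b ∎
      where
      eq : ∀ b l → b * (8 * l) + b * (8 * l) ≡ 16 * l * b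
      eq = solve-∀

    u₁≥1 : 1 ≤ u₁
    u₁≥1 = *-mono-≤ {1} {c₁} {1} {D} (subst (1 ≤_) (sym c₁≡) (*-mono-≤ {1} {32 * ℓ} {1} {r} (*-mono-≤ {1} {32} {1} {ℓ} (s≤s z≤n) (s≤s z≤n)) r≥1)) (s≤s z≤n)

    u₁≤b : u₁ ≤ b
    u₁≤b = *-cancelˡ-≤ (16 * ℓ) (begin
      16 * ℓ * (c₁ * D) ≡⟨ *-assoc (16 * ℓ) c₁ D ⟨
      16 * ℓ * c₁ * D ≤⟨ *-monoˡ-≤ D Z≥₄ ⟩
      Z * D ≤⟨ ZD≤n ⟩
      n ≤⟨ n≤16ℓb ⟩
      16 * ℓ * b ∎)

    room : ℓ * b + b + (s + (2 + s)) ≤ n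
    room = *-cancelˡ-≤ 4 (begin
      4 * (ℓ * b + b + (s + (2 + s))) ≡⟨ e₁ (ℓ * b) b s ⟩
      4 * (ℓ * b) + 4 * b + (8 * s + 8) ≤⟨ +-mono-≤ (+-monoʳ-≤ (4 * (ℓ * b)) (*-monoʳ-≤ 4 (m≤n*m b ℓ))) s-part ⟩
      4 * (ℓ * b) + 4 * (ℓ * b) + 2 * n ≡⟨ cong (_+ 2 * n) (e₂′ ℓ b) ⟩
      8 * ℓ * b + 2 * n ≤⟨ +-monoˡ-≤ (2 * n) 8ℓb≤n ⟩
      n + 2 * n ≤⟨ ≤-trans (m≤m+n _ n) (≤-reflexive (e₃ n)) ⟩
      4 * n ∎)
      where
      e₁ : ∀ l b s → 4 * (l + b + (s + (2 + s))) ≡ 4 * l + 4 * b + (8 * s + 8)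
      e₁ = solve-∀
      e₂′ : ∀ l b → 4 * (l * b) + 4 * (l * b) ≡ 8 * l * b
      e₂′ = solve-∀
      e₃ : ∀ n → n + 2 * n + n ≡ 4 * n
      e₃ = solve-∀
      e₄ : ∀ s → 8 * s + 8 ≡ 8 * (s + 1)
      e₄ = solve-∀
      e₅ : ∀ k → 8 * k ≡ 2 * (4 * k)
      e₅ = solve-∀
      s-part : 8 * s + 8 ≤ 2 * n
      s-part = begin
        8 * s + 8 ≡⟨ e₄ s ⟩
        8 * (s + 1) ≤⟨ *-monoʳ-≤ 8 (+-mono-≤ (m≤m+n s K) (s≤s (z≤n {1}))) ⟩
        8 * K′ ≡⟨ e₅ K′ ⟩
        2 * (4 * K′) ≤⟨ *-monoʳ-≤ 2 4K′≤n ⟩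
        2 * n ∎

    D≡ : D ≡ 24 * (X₀ * r * Q) * d
    D≡ = trans D≡ed (cong (_* d) (trans (cong (2 *_) e₂≡) (sym (*-assoc 2 12 (X₀ * r * Q)))))

    2w≤D : 2 * (w + 2) ≤ D
    2w≤D = begin
      2 * (r * (3 * d) + 2) ≡⟨ e₁ r d ⟩
      6 * (r * d) + 4 * 1 ≤⟨ +-monoʳ-≤ (6 * (r * d)) (*-monoʳ-≤ 4 (*-mono-≤ r≥1 d≥1)) ⟩
      6 * (r * d) + 4 * (r * d) ≤⟨ ≤-trans (m≤m+n _ (14 * (r * d))) (≤-reflexive (e₂′ r d)) ⟩
      24 * (1 * r * 1) * d ≤⟨ *-monoˡ-≤ d (*-monoʳ-≤ 24 (*-mono-≤ {1 * r} {X₀ * r} {1} {Q} (*-monoˡ-≤ r X₀≥1) Q≥1)) ⟩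
      24 * (X₀ * r * Q) * d ≡⟨ D≡ ⟨
      D ∎
      where
      e₁ : ∀ r d → 2 * (r * (3 * d) + 2) ≡ 6 * (r * d) + 4 * 1
      e₁ = solve-∀
      e₂′ : ∀ r d → 6 * (r * d) + 4 * (r * d) + 14 * (r * d) ≡ 24 * (1 * r * 1) * d
      e₂′ = solve-∀

    X₀≤D′ : X₀ ≤ 1 + D″
    X₀≤D′ = s≤s⁻¹ (begin
      suc X₀ ≤⟨ +-monoˡ-≤ X₀ X₀≥1 ⟩
      X₀ + X₀ ≤⟨ ≤-trans (m≤m+n _ (22 * X₀)) (≤-reflexive (e₁ X₀)) ⟩
      24 * (X₀ * 1 * 1) * 1 ≤⟨ *-mono-≤ (*-monoʳ-≤ 24 (*-mono-≤ (*-monoʳ-≤ X₀ r≥1) Q≥1)) d≥1 ⟩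
      24 * (X₀ * r * Q) * d ≡⟨ D≡ ⟨
      D ∎)
      where
      e₁ : ∀ x → x + x + 22 * x ≡ 24 * (x * 1 * 1) * 1
      e₁ = solve-∀

    2u≤s : 2 * u ≤ s
    2u≤s = begin
      2 * (3 * d) ≡⟨ *-assoc 2 3 d ⟨
      6 * d ≤⟨ *-mono-≤ {6} {32} (s≤s (s≤s (s≤s (s≤s (s≤s (s≤s z≤n)))))) d≤D ⟩
      32 * D ≡⟨ e₁ D ⟩
      1 * (32 * 1 * 1 * D) ≤⟨ *-mono-≤ {1} {ℓ} (s≤s z≤n) (*-monoˡ-≤ D (≤-trans (*-mono-≤ (*-monoʳ-≤ 32 (s≤s (z≤n {ℓ′}))) r≥1) (≤-reflexive (sym c₁≡)))) ⟩
      s ∎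
      where
      e₁ : ∀ d → 32 * d ≡ 1 * (32 * 1 * 1 * d)
      e₁ = solve-∀

    u≥1 : 1 ≤ u
    u≥1 = *-mono-≤ {1} {3} (s≤s z≤n) d≥1

    K₁ : κ * s + r * u ≤ K
    K₁ = +-monoʳ-≤ (κ * s) (*-monoˡ-≤ u (≤-trans (m≤n+m r (2 * κ)) (m≤m+n (2 * κ + r) 1)))

    K₂ : κ * (2 * u) + (r * u + u) ≤ K
    K₂ = ≤-trans (≤-reflexive (e₁ κ r u)) (m≤n+m ((2 * κ + r + 1) * u) (κ * s))
      where
      e₁ : ∀ k r u → k * (2 * u) + (r * u + u) ≡ (2 * k + r + 1) * u
      e₁ = solve-∀

-- Connectedness from vanishing bad sums, and the bounds on these sums

⌊⌋-true : {P : Set} (p? : Dec P) → P → ⌊ p? ⌋ ≡ true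
⌊⌋-true (yes _) p = refl
⌊⌋-true (no ¬p) p = ⊥-elim (¬p p)

⌊⌋-true⁻ : {P : Set} (p? : Dec P) → ⌊ p? ⌋ ≡ true → P
⌊⌋-true⁻ (yes p) _ = p

-- Here x and y range over vertices that may have only one neighbour; W S is an expanding set that was
-- determined without looking at the edges at S.
module Conclusion {n r : ℕ} (adj : Adjacency n r) (adj-sym : ∀ {c u v} → adj c u v ≡ true → adj c v u ≡ true)
  (Early Soon : Fin n → Fin n → Set) (W : List (Fin n) → VSet n) (ℓ′ u₁ b : ℕ) (u₁≥1 : 1 ≤ u₁) (u₁≤b : u₁ ≤ b)
  (room : suc ℓ′ * b + b + (suc ℓ′ * u₁ + (2 + suc ℓ′ * u₁)) ≤ n)
  (joined : ∀ c A B → (∀ v → A v ≡ true → B v ≡ true → ⊥) → u₁ ≤ card A → b ≤ card B →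
            ∃ λ u → ∃ λ v → A u ≡ true × B v ≡ true × adj c u v ≡ true)
  (expanding : ∀ S → length S ≤ 2 → Expanding adj (5 * suc ℓ′) (suc ℓ′ * u₁) (W S))
  (exposed₄ : ∀ x z → x ≢ z → W (x ∷ []) z ≡ false → Soon x z → ∃ λ v → W (x ∷ []) v ≡ true × x ≢ v × Early x v)
  (exposed₅ : ∀ x y z → x ≢ y → x ≢ z → y ≢ z → Soon x z → Soon y z →
    ∃ λ v → W (x ∷ y ∷ []) v ≡ true × v ≢ x × v ≢ y × v ≢ z × (Early x v ⊎ Early y v))
  (pat : ℕ → Fin r) (pat-mod : Grow.Periodic adj ℓ′ pat) (pat-onto : ∀ c → ∃ λ i → pat i ≡ c)
  (R : Fin r → Fin n → Fin n → Set) (R-sym : ∀ {c u v} → R c u v → R c v u)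
  (adj⇒R : ∀ {c u v} → adj c u v ≡ true → R c u v)
  (early⇒R : ∀ {u v} → u ≢ v → Early u v → ∃ λ c → R c u v)
  (R⇒ : ∀ {c u v} → R c u v → u ≢ v × Soon u v)
  (R? : ∀ u v → Dec (∃ λ c → R c u v)) (no-isolated : ∀ u → ∃ λ c → ∃ λ v → R c u v) where

  -- If the known neighbour of `x` lies outside the core, it is joined to `x` in G₊, and `exposed₄`
  -- yields an early neighbour in the core, which is present as well.
  attach : ∀ x → ∃ λ z → ∃ λ c → R c x z × W (x ∷ []) z ≡ true
  attach x with no-isolated x
  ... | c , v , xv with W (x ∷ []) v in eq
  ...   | true  = v , c , xv , eq
  ...   | false with exposed₄ x v (proj₁ (R⇒ xv)) eq (proj₂ (R⇒ xv))
  ...     | z , Wz , x≢z , ez with early⇒R x≢z ez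
  ...       | c′ , xz = z , c′ , xz , Wz

  module C = Connect adj ℓ′ pat pat-mod R adj⇒R adj-sym u₁ b u₁≥1 u₁≤b room joined

  link : ∀ S S′ → length S ≤ 2 → length S′ ≤ 2 → ∀ {x y z z′ c c′} → x ≢ y → z ≢ z′ → z ∉ x ∷ y ∷ [] → z′ ∉ x ∷ y ∷ [] →
    W S z ≡ true → W S′ z′ ≡ true → R c x z → R c′ y z′ →
    ∃ λ p → ∃ λ vs → PatPath R pat p x y vs
  link S S′ S≤2 S′≤2 {x} {y} {z} {z′} {c} {c′} x≢y z≢z′ z∉ z′∉ Wz Wz′ xz yz′ with pat-onto c | pat-onto c′
  ... | p , refl | q , refl = p , C.Between.path (expanding S S≤2) (expanding S′ S′≤2)
                                    Wz Wz′ z≢z′ z∉ z′∉ x≢y p q xz (R-sym yz′)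

  connected : ∀ x y → x ≢ y → ∃ λ p → ∃ λ vs → PatPath R pat p x y vs
  connected x y x≢y with R? x y
  -- Adjacent pairs are treated separately, so that below no neighbour of `x` is `y` and no
  -- neighbour of `y` is `x`.
  ... | yes (c , xy) with pat-onto c
  ...   | p , refl = p , x ∷ y ∷ [] , edge∷ xy stay (λ { (here e) → x≢y e })
  connected x y x≢y | no ¬xy with attach x | attach y
  ... | z , c , xz , Wz | z′ , c′ , yz′ , Wz′ = choose (z F.≟ z′)
    where
    away-x : ∀ {c v} → R c x v → v ∉ x ∷ y ∷ []
    away-x xv (here refl)         = proj₁ (R⇒ xv) refl
    away-x xv (there (here refl)) = ¬xy (_ , xv)
    away-y : ∀ {c v} → R c y v → v ∉ x ∷ y ∷ []
    away-y yv (here refl)         = ¬xy (_ , R-sym yv)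
    away-y yv (there (here refl)) = proj₁ (R⇒ yv) refl
    choose : Dec (z ≡ z′) → ∃ λ p → ∃ λ vs → PatPath R pat p x y vs
    choose (no z≢z′) = link (x ∷ []) (y ∷ []) (s≤s z≤n) (s≤s z≤n) x≢y z≢z′ (away-x xz) (away-y yz′) Wz Wz′ xz yz′
    -- Both ends are attached to the same vertex: one of them gets another neighbour in the core
    -- with both stars masked, and the other end keeps `z`.
    choose (yes refl) with exposed₅ x y z x≢y (proj₁ (R⇒ xz)) (proj₁ (R⇒ yz′)) (proj₂ (R⇒ xz)) (proj₂ (R⇒ yz′))
    ... | v , Wv , v≢x , v≢y , v≢z , inj₁ ev = let (_ , xv) = early⇒R (≢-sym v≢x) ev in
            link (x ∷ y ∷ []) (y ∷ []) (s≤s (s≤s z≤n)) (s≤s z≤n) x≢y v≢z (away-x xv) (away-y yz′) Wv Wz′ xv yz′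
    ... | v , Wv , v≢x , v≢y , v≢z , inj₂ ev = let (_ , yv) = early⇒R (≢-sym v≢y) ev in
            link (x ∷ []) (x ∷ y ∷ []) (s≤s z≤n) (s≤s (s≤s z≤n)) x≢y (≢-sym v≢z) (away-x xz) (away-y yv) Wz Wv xz yv

module Events (k r ℓ′ : ℕ) (r≥1 : 1 ≤ r) (n n′ n″ : ℕ) (n≡ : n ≡ suc n′) (n′≡ : n′ ≡ suc n″)
  (sc : Scale (Parameters.X₀ k r ℓ′ r≥1) (Parameters.e k r ℓ′ r≥1) (Parameters.Z k r ℓ′ r≥1) n′)
  (n-large : Parameters.large k r ℓ′ r≥1 ≤ n) (m N : ℕ) (m≥1 : 1 ≤ m) (E : Fin n → Fin n → Fin N)
  (E-sym : ∀ u v → E u v ≡ E v u)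
  (E-inj : ∀ {u v u′ v′} → u ≢ v → u′ ≢ v′ → E u v ≡ E u′ v′ → (u ≡ u′ × v ≡ v′) ⊎ (u ≡ v′ × v ≡ u′)) where

  open Parameters k r ℓ′ r≥1 public
  open Sizes n n′ n≡ sc n-large public hiding (D)
  open Model n n′ n″ r D″ m N n≡ n′≡ m≥1 r≥1 E E-sym E-inj public

  IsCore : Labelling → Vec Bool n → Set
  IsCore f W = n ≤ card (lookup W) + w × Expanding (adjOf f) κ s (lookup W)

  isCore? : ∀ f W → Dec (IsCore f W)
  isCore? f W = (n ≤? _) ×-dec dec (expanding? (adjOf f) κ s (lookup W))
    where
    dec : Expanding (adjOf f) κ s (lookup W) ⊎ (∃ λ c → ∃ λ A → NonExpansion (adjOf f) κ s (lookup W) c A) →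
          Dec (Expanding (adjOf f) κ s (lookup W))
    dec (inj₁ ex) = yes ex
    dec (inj₂ (c , A , sub , pos , small , le)) = no λ ex → <⇒≱ (ex c A sub pos small) le

  opaque
   -- The exposure sums over all labellings, so the core must always be defined. The full vertex set
   -- as default keeps `core-big` unconditional; expansion is claimed only when a core exists.
   core : Labelling → Vec Bool n
   core f with ∃Vec? n (IsCore f) (isCore? f)
   ... | yes (W , _) = W
   ... | no _        = Vec.replicate n true

   core-big : ∀ f → n ≤ card (lookup (core f)) + w
   core-big f with ∃Vec? n (IsCore f) (isCore? f)
   ... | yes (W , big , _) = big
   ... | no _ = ≤-trans (≤-reflexive (trans (sym (card-all {n})) (card-cong {P = full} {Q = lookup (Vec.replicate n true)} (λ v → sym (lookup-replicate v true))))) (m≤m+n _ w)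

   core-expanding : ∀ f → ∃ (IsCore f) → Expanding (adjOf f) κ s (lookup (core f))
   core-expanding f ex with ∃Vec? n (IsCore f) (isCore? f)
   ... | yes (W , _ , expW) = expW
   ... | no ¬ex = ⊥-elim (¬ex ex)

  open Exposure core w core-big 2w≤D public

  T1 : X₀ * B ≤ n * A
  T1 = subst (λ z → X₀ * B ≤ z * A) (sym n≡) lower

  T2 : n * A ≤ 2 * X₀ * B
  T2 = subst (λ z → z * A ≤ 2 * X₀ * B) (sym n≡) upper

  -- A set failing to expand gives a pair for `cndA`: at least `d` of its vertices, and all but `K′`
  -- vertices, none reached in that colour. `cndB` is for the joining of two large sets.
  cndA cndB : Vec Ty n → Bool
  cndA τ = ⌊ d ≤? card (typeA τ) ⌋ ∧ ⌊ n ≤? card (typeB τ) + K′ ⌋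
  cndB τ = ⌊ u₁ ≤? card (typeA τ) ⌋ ∧ ⌊ b ≤? card (typeB τ) ⌋

  β₃A β₃B : Labelling → ℕ
  β₃A = β₃ cndA
  β₃B = β₃ cndB

  module _ where
    open ≤-Reasoning

    suc-Y≡ : suc Y ≡ y * d
    suc-Y≡ = trans suc-Y (trans (cong (_* r) D≡ed) (eq e d r))
      where
      eq : ∀ e d r → e * d * r ≡ e * r * d
      eq = solve-∀

    Y≥1 : 1 ≤ Y
    Y≥1 = s≤s⁻¹ (≤-trans (*-mono-≤ {2} {D} {1} {r} (s≤s (s≤s z≤n)) r≥1) (≤-reflexive (sym suc-Y)))

    Y≢0 : NonZero Y
    Y≢0 = >-nonZero Y≥1

    Y+1 : Y + 1 ≡ suc Y
    Y+1 = +-comm Y 1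

    bound₁ : Q * ∑ Ω β₁ ≤ total
    bound₁ = *-cancelˡ-≤ 2 (≤-trans (≤-reflexive (trans (sym (*-assoc 2 Q (∑ Ω β₁))) (cong (_* ∑ Ω β₁) (sym X₀≡)))) (SecondMoment.bound X₀ T1 X₀≤D′))

    bound₂ : Q * ∑ Ω β₂ ≤ total
    bound₂ = *-cancelˡ-≤ (4 * (X₀ * X₀)) {{>-nonZero (*-mono-≤ {1} {4} (s≤s z≤n) (*-mono-≤ {1} {X₀} {1} {X₀} X₀≥1 X₀≥1))}} (begin
      4 * (X₀ * X₀) * (Q * ∑ Ω β₂) ≡⟨ *-assoc (4 * (X₀ * X₀)) Q (∑ Ω β₂) ⟨
      4 * (X₀ * X₀) * Q * ∑ Ω β₂ ≤⟨ *-monoˡ-≤ (∑ Ω β₂) (≤-trans large≥₁ n-large) ⟩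
      n * ∑ Ω β₂ ≤⟨ β₂-bound X₀ T2 ⟩
      4 * (X₀ * X₀) * total ∎)

    -- A vertex has no edge of a given colour to `d` given ones with probability at most y/(y + 1):
    -- (1 + 1/Y)^d ≥ 1 + d/Y ≥ 1 + 1/y, since Y ≤ y d.
    decay-A : suc y ^ g * Y ^ (d * g) ≤ y ^ g * suc Y ^ (d * g)
    decay-A = begin
      suc y ^ g * Y ^ (d * g) ≡⟨ cong (suc y ^ g *_) (^-*-assoc Y d g) ⟨
      suc y ^ g * (Y ^ d) ^ g ≡⟨ ^-distrib-* (suc y) (Y ^ d) g ⟨
      (suc y * Y ^ d) ^ g ≤⟨ ^-monoˡ-≤ g one ⟩
      (y * suc Y ^ d) ^ g ≡⟨ ^-distrib-* y (suc Y ^ d) g ⟩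
      y ^ g * (suc Y ^ d) ^ g ≡⟨ cong (y ^ g *_) (^-*-assoc (suc Y) d g) ⟩
      y ^ g * suc Y ^ (d * g) ∎
      where
      one : suc y * Y ^ d ≤ y * suc Y ^ d
      one = *-cancelʳ-≤ _ _ Y {{Y≢0}} (begin
        suc y * Y ^ d * Y ≡⟨ e₁ y (Y ^ d) Y ⟩
        Y ^ d * (Y + y * Y) ≤⟨ *-monoʳ-≤ (Y ^ d) (+-monoˡ-≤ (y * Y) (≤-trans (n≤1+n Y) (≤-reflexive suc-Y≡))) ⟩
        Y ^ d * (y * d + y * Y) ≡⟨ e₂′ (Y ^ d) y d Y ⟩
        y * (Y ^ d * (Y + d * 1)) ≤⟨ *-monoʳ-≤ y (bernoulli⁺ Y 1 d) ⟩
        y * ((Y + 1) ^ d * Y) ≡⟨ cong (λ z → y * (z ^ d * Y)) Y+1 ⟩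
        y * (suc Y ^ d * Y) ≡⟨ *-assoc y (suc Y ^ d) Y ⟨
        y * suc Y ^ d * Y ∎)
        where
        e₁ : ∀ y p z → (1 + y) * p * z ≡ p * (z + y * z)
        e₁ = solve-∀
        e₂′ : ∀ p y d z → p * (y * d + y * z) ≡ y * (p * (z + d * 1))
        e₂′ = solve-∀

    -- Counting the pairs with weight X = 16 y costs X^K′ (1 + 2/X)^n, while `decay-A` gains (1 +
    -- 1/y) for each of at least `g` vertices of type B; `entropy-decay` compares the two.
    bound₃A : Q * ∑ Ω β₃A ≤ total
    bound₃A = *-cancelˡ-≤ (X ^ n * suc y ^ g * suc Y ^ h) {{m*n≢0 _ _ {{m*n≢0 _ _ {{^-pos X n {{X≢0}}}} {{^-pos (suc y) g}}}} {{^-pos (suc Y) h}}}} (begin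
      X ^ n * suc y ^ g * suc Y ^ h * (Q * ∑ Ω β₃A) ≡⟨ f₁ (X ^ n) (suc y ^ g) (suc Y ^ h) Q (∑ Ω β₃A) ⟩
      X ^ n * suc y ^ g * Q * (suc Y ^ h * ∑ Ω β₃A) ≤⟨ *-monoʳ-≤ (X ^ n * suc y ^ g * Q) (β₃-bound cndA h size) ⟩
      X ^ n * suc y ^ g * Q * (r * (C * (Y ^ h * total))) ≡⟨ f₂ (X ^ n) (suc y ^ g) Q r C (Y ^ h) total ⟩
      Q * r * (X ^ n * C) * (suc y ^ g * Y ^ h) * total ≤⟨ *-monoˡ-≤ total (*-mono-≤ (*-monoʳ-≤ (Q * r) (types-entropy n X K′ cndA X≥1 almost)) decay-A) ⟩
      Q * r * (X ^ K′ * (X + 2) ^ n) * (y ^ g * suc Y ^ h) * total ≡⟨ f₃ (Q * r * (X ^ K′ * (X + 2) ^ n)) (y ^ g) (suc Y ^ h) total ⟩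
      Q * r * (X ^ K′ * (X + 2) ^ n) * y ^ g * (suc Y ^ h * total) ≤⟨ *-monoˡ-≤ (suc Y ^ h * total) (entropy-decay y (Q * r) K′ n g y≥1 n≤2g (subst (λ p → p * K′ ≤ g) P≡ PK′≤g) 8yQr≤g) ⟩
      X ^ n * suc y ^ g * (suc Y ^ h * total) ≡⟨ *-assoc (X ^ n * suc y ^ g) (suc Y ^ h) total ⟨
      X ^ n * suc y ^ g * suc Y ^ h * total ∎)
      where
      X h C : ℕ
      X = 16 * y
      h = d * g
      C = ∑-types cndA
      X≥1 : 1 ≤ X
      X≥1 = *-mono-≤ {1} {16} (s≤s z≤n) y≥1
      X≢0 : NonZero X
      X≢0 = >-nonZero X≥1
      almost : ∀ τ → cndA τ ≡ true → n ≤ card (typeB τ) + K′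
      almost τ p = ⌊⌋-true⁻ (n ≤? _) (proj₂ (∧-true⁻ ⌊ d ≤? card (typeA τ) ⌋ p))
      size : ∀ τ → cndA τ ≡ true → h ≤ card (typeA τ) * card (typeB τ)
      size τ p = *-mono-≤ (⌊⌋-true⁻ (d ≤? _) (proj₁ (∧-true⁻ ⌊ d ≤? card (typeA τ) ⌋ p)))
        (+-cancelʳ-≤ K′ _ _ (≤-trans (≤-reflexive g+K′) (almost τ p)))
      f₁ : ∀ a b c q s → a * b * c * (q * s) ≡ a * b * q * (c * s)
      f₁ = solve-∀
      f₂ : ∀ a b q r c z t → a * b * q * (r * (c * (z * t))) ≡ q * r * (a * c) * (b * z) * t
      f₂ = solve-∀
      f₃ : ∀ a b c t → a * (b * c) * t ≡ a * b * (c * t)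
      f₃ = solve-∀

    -- There are at most 3^n pairs, each with 2n (Y + 1) possible edges. As (1 + 1/Y)^(Y+1) ≥ 2,
    -- each pair has probability at most 4^(-n), and (3/4)^n beats Q r.
    bound₃B : Q * ∑ Ω β₃B ≤ total
    bound₃B = *-cancelˡ-≤ (4 ^ n * suc Y ^ h) {{m*n≢0 _ _ {{^-pos 4 n}} {{^-pos (suc Y) h}}}} (begin
      4 ^ n * suc Y ^ h * (Q * ∑ Ω β₃B) ≡⟨ f₁ (4 ^ n) (suc Y ^ h) Q (∑ Ω β₃B) ⟩
      4 ^ n * Q * (suc Y ^ h * ∑ Ω β₃B) ≤⟨ *-monoʳ-≤ (4 ^ n * Q) (β₃-bound cndB h size) ⟩
      4 ^ n * Q * (r * (C * (Y ^ h * total))) ≤⟨ *-monoʳ-≤ (4 ^ n * Q) (*-monoʳ-≤ r (*-monoˡ-≤ (Y ^ h * total) C≤)) ⟩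
      4 ^ n * Q * (r * (3 ^ n * (Y ^ h * total))) ≡⟨ f₂ (4 ^ n) Q r (3 ^ n) (Y ^ h) total ⟩
      Q * r * 3 ^ n * (4 ^ n * Y ^ h) * total ≤⟨ *-monoˡ-≤ total (*-mono-≤ three-four decay-B) ⟩
      4 ^ n * suc Y ^ h * total ∎)
      where
      h C : ℕ
      h = suc Y * (2 * n)
      C = ∑-types cndB
      C≤ : C ≤ 3 ^ n
      C≤ = ≤-trans (∑-mono (allVecs tys n) (λ τ → χ≤1 (cndB τ))) (≤-reflexive (trans (sym (length≡∑1 (allVecs tys n))) (length-allVecs tys n)))
      size : ∀ τ → cndB τ ≡ true → h ≤ card (typeA τ) * card (typeB τ)
      size τ p = begin
        suc Y * (2 * n) ≡⟨ cong (_* (2 * n)) suc-Y ⟩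
        D * r * (2 * n) ≤⟨ *-monoʳ-≤ (D * r) (*-monoʳ-≤ 2 n≤16ℓb) ⟩
        D * r * (2 * (16 * ℓ * b)) ≡⟨ trans (e₁ D r ℓ b) (cong (λ c → c * D * b) (sym c₁≡)) ⟩
        u₁ * b ≤⟨ *-mono-≤ (⌊⌋-true⁻ (u₁ ≤? _) (proj₁ (∧-true⁻ ⌊ u₁ ≤? card (typeA τ) ⌋ p)))
                                                    (⌊⌋-true⁻ (b ≤? _) (proj₂ (∧-true⁻ ⌊ u₁ ≤? card (typeA τ) ⌋ p))) ⟩
        card (typeA τ) * card (typeB τ) ∎
        where
        e₁ : ∀ d r l b → d * r * (2 * (16 * l * b)) ≡ 32 * l * r * d * b
        e₁ = solve-∀
      block : 2 * Y ^ suc Y ≤ suc Y ^ suc Y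
      block = *-cancelʳ-≤ _ _ Y {{Y≢0}} (begin
        2 * Y ^ suc Y * Y ≡⟨ e₁ (Y ^ suc Y) Y ⟩
        Y ^ suc Y * (Y + Y) ≤⟨ *-monoʳ-≤ (Y ^ suc Y) (+-monoʳ-≤ Y (≤-trans (n≤1+n Y) (≤-reflexive (sym (*-identityʳ (suc Y)))))) ⟩
        Y ^ suc Y * (Y + suc Y * 1) ≤⟨ bernoulli⁺ Y 1 (suc Y) ⟩
        (Y + 1) ^ suc Y * Y ≡⟨ cong (λ z → z ^ suc Y * Y) Y+1 ⟩
        suc Y ^ suc Y * Y ∎)
        where
        e₁ : ∀ p y → 2 * p * y ≡ p * (y + y)
        e₁ = solve-∀
      decay-B : 4 ^ n * Y ^ h ≤ suc Y ^ h
      decay-B = begin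
        4 ^ n * Y ^ h ≡⟨ cong₂ _*_ (^-*-assoc 2 2 n) (sym (^-*-assoc Y (suc Y) (2 * n))) ⟩
        2 ^ (2 * n) * (Y ^ suc Y) ^ (2 * n) ≡⟨ ^-distrib-* 2 (Y ^ suc Y) (2 * n) ⟨
        (2 * Y ^ suc Y) ^ (2 * n) ≤⟨ ^-monoˡ-≤ (2 * n) block ⟩
        (suc Y ^ suc Y) ^ (2 * n) ≡⟨ ^-*-assoc (suc Y) (suc Y) (2 * n) ⟩
        suc Y ^ h ∎
      three-four : Q * r * 3 ^ n ≤ 4 ^ n
      three-four = *-cancelʳ-≤ _ _ 3 (begin
        Q * r * 3 ^ n * 3 ≡⟨ e₁ (Q * r) (3 ^ n) ⟩
        3 ^ n * (3 * (Q * r)) ≤⟨ *-monoʳ-≤ (3 ^ n) (≤-trans (≤-trans large≥₂ n-large) (≤-trans (≤-reflexive (sym (*-identityʳ n))) (m≤n+m (n * 1) 3))) ⟩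
        3 ^ n * (3 + n * 1) ≤⟨ bernoulli⁺ 3 1 n ⟩
        4 ^ n * 3 ∎)
        where
        e₁ : ∀ q p → q * p * 3 ≡ p * (3 * q)
        e₁ = solve-∀
      f₁ : ∀ a c q s → a * c * (q * s) ≡ a * q * (c * s)
      f₁ = solve-∀
      f₂ : ∀ a q r c z t → a * q * (r * (c * (z * t))) ≡ q * r * c * (a * z) * t
      f₂ = solve-∀

    -- The expectation is at most 4 (n A/B) w/D ≤ 24 X₀ r d/D, which is 1/Q by the choice of `e₂`.
    bound₄ : Q * ∑ Ω β₄ ≤ total
    bound₄ = *-cancelˡ-≤ (24 * (X₀ * r * d) * B) {{m*n≢0 _ B {{>-nonZero (*-mono-≤ {1} {24} (s≤s z≤n) (*-mono-≤ {1} {X₀ * r} {1} {d} (*-mono-≤ {1} {X₀} {1} {r} X₀≥1 r≥1) d≥1))}} {{^-pos D n′}}}} (begin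
      24 * (X₀ * r * d) * B * (Q * ∑ Ω β₄) ≡⟨ f₁ X₀ r d B Q (∑ Ω β₄) ⟩
      24 * (X₀ * r * Q) * d * B * ∑ Ω β₄ ≡⟨ cong (λ z → z * B * ∑ Ω β₄) D≡ ⟨
      D * B * ∑ Ω β₄ ≤⟨ β₄-bound ⟩
      4 * A * (n * w * total) ≡⟨ f₂ A n w total ⟩
      4 * (n * A) * w * total ≤⟨ *-monoˡ-≤ total (*-monoˡ-≤ w (*-monoʳ-≤ 4 T2)) ⟩
      4 * (2 * X₀ * B) * (r * (3 * d)) * total ≡⟨ f₃ X₀ B r d total ⟩
      24 * (X₀ * r * d) * B * total ∎)
      where
      f₁ : ∀ x r d b q s → 24 * (x * r * d) * b * (q * s) ≡ 24 * (x * r * q) * d * b * s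
      f₁ = solve-∀
      f₂ : ∀ a n w t → 4 * a * (n * w * t) ≡ 4 * (n * a) * w * t
      f₂ = solve-∀
      f₃ : ∀ x b r d t → 4 * (2 * x * b) * (r * (3 * d)) * t ≡ 24 * (x * r * d) * b * t
      f₃ = solve-∀

    n≥1 : 1 ≤ n
    n≥1 = subst (1 ≤_) (sym n≡) (s≤s z≤n)

    -- n³ triples of probability at most 16 (A/B)²/D² give 16 (n/D²)(n A/B)² ≤ 64 X₀² n/D², small
    -- because D² ≥ Z n.
    bound₅ : Q * ∑ Ω β₅ ≤ total
    bound₅ = *-cancelˡ-≤ (64 * (X₀ * X₀) * n * (B * B)) {{m*n≢0 _ (B * B) {{>-nonZero (*-mono-≤ {1} {64 * (X₀ * X₀)} {1} {n} (*-mono-≤ {1} {64} (s≤s z≤n) (*-mono-≤ {1} {X₀} {1} {X₀} X₀≥1 X₀≥1)) n≥1)}} {{m*n≢0 B B {{^-pos D n′}} {{^-pos D n′}}}}}} (begin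
      64 * (X₀ * X₀) * n * (B * B) * (Q * ∑ Ω β₅) ≡⟨ f₁ (64 * (X₀ * X₀)) n B Q (∑ Ω β₅) ⟩
      64 * (X₀ * X₀) * Q * n * (B * B) * ∑ Ω β₅ ≤⟨ *-monoˡ-≤ (∑ Ω β₅) (*-monoˡ-≤ (B * B) (≤-trans (*-monoˡ-≤ n Z≥₂) Zn≤DD)) ⟩
      D * D * (B * B) * ∑ Ω β₅ ≤⟨ β₅-bound ⟩
      16 * (A * A) * (n * n * n * total) ≡⟨ f₂ A n total ⟩
      16 * n * (n * A * (n * A)) * total ≤⟨ *-monoˡ-≤ total (*-monoʳ-≤ (16 * n) (*-mono-≤ T2 T2)) ⟩
      16 * n * (2 * X₀ * B * (2 * X₀ * B)) * total ≡⟨ f₃ n X₀ B total ⟩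
      64 * (X₀ * X₀) * n * (B * B) * total ∎)
      where
      f₁ : ∀ x n b q s → x * n * (b * b) * (q * s) ≡ x * q * n * (b * b) * s
      f₁ = solve-∀
      f₂ : ∀ a n t → 16 * (a * a) * (n * n * n * t) ≡ 16 * n * (n * a * (n * a)) * t
      f₂ = solve-∀
      f₃ : ∀ n x b t → 16 * n * (2 * x * b * (2 * x * b)) * t ≡ 64 * (x * x) * n * (b * b) * t
      f₃ = solve-∀

    β : Labelling → ℕ
    β f = β₁ f + β₂ f + β₃A f + β₃B f + β₄ f + β₅ f

    β-bound : 2 * suc k * ∑ Ω β ≤ total
    β-bound = *-cancelˡ-≤ 6 (begin
      6 * (2 * suc k * ∑ Ω β) ≡⟨ trans (sym (*-assoc 6 (2 * suc k) (∑ Ω β))) (cong (_* ∑ Ω β) (trans (sym (*-assoc 6 2 (suc k))) (sym Q≡))) ⟩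
      Q * ∑ Ω β ≡⟨ cong (Q *_) split ⟩
      Q * (∑ Ω β₁ + ∑ Ω β₂ + ∑ Ω β₃A + ∑ Ω β₃B + ∑ Ω β₄ + ∑ Ω β₅)
                                  ≡⟨ dist Q (∑ Ω β₁) (∑ Ω β₂) (∑ Ω β₃A) (∑ Ω β₃B) (∑ Ω β₄) (∑ Ω β₅) ⟩
      Q * ∑ Ω β₁ + Q * ∑ Ω β₂ + Q * ∑ Ω β₃A + Q * ∑ Ω β₃B + Q * ∑ Ω β₄ + Q * ∑ Ω β₅
        ≤⟨ +-mono-≤ (+-mono-≤ (+-mono-≤ (+-mono-≤ (+-mono-≤ bound₁ bound₂) bound₃A) bound₃B) bound₄) bound₅ ⟩
      total + total + total + total + total + total ≡⟨ six total ⟩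
      6 * total ∎)
      where
      dist : ∀ q a b c d e f → q * (a + b + c + d + e + f) ≡ q * a + q * b + q * c + q * d + q * e + q * f
      dist = solve-∀
      six : ∀ t → t + t + t + t + t + t ≡ 6 * t
      six = solve-∀
      split : ∑ Ω β ≡ ∑ Ω β₁ + ∑ Ω β₂ + ∑ Ω β₃A + ∑ Ω β₃B + ∑ Ω β₄ + ∑ Ω β₅
      split = trans (∑-+ Ω (λ f → β₁ f + β₂ f + β₃A f + β₃B f + β₄ f) β₅) (cong (_+ ∑ Ω β₅)
        (trans (∑-+ Ω (λ f → β₁ f + β₂ f + β₃A f + β₃B f) β₄) (cong (_+ ∑ Ω β₄)
        (trans (∑-+ Ω (λ f → β₁ f + β₂ f + β₃A f) β₃B) (cong (_+ ∑ Ω β₃B)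
        (trans (∑-+ Ω (λ f → β₁ f + β₂ f) β₃A) (cong (_+ ∑ Ω β₃A) (∑-+ Ω β₁ β₂))))))))

  τ-of : VSet n → VSet n → Vec Ty n
  τ-of P R = Vec.tabulate (λ v → if P v then inA else (if R v then inB else rest))

  τ-of-A : ∀ P R v → typeA (τ-of P R) v ≡ P v
  τ-of-A P R v rewrite lookup∘tabulate (λ v → if P v then inA else (if R v then inB else rest)) v with P v | R v
  ... | true  | _     = refl
  ... | false | true  = refl
  ... | false | false = refl

  τ-of-B : ∀ P R v → typeB (τ-of P R) v ≡ not (P v) ∧ R v
  τ-of-B P R v rewrite lookup∘tabulate (λ v → if P v then inA else (if R v then inB else rest)) v with P v | R v
  ... | true  | _     = refl
  ... | false | true  = refl
  ... | false | false = refl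

  use₃ : ∀ cnd f → β₃ cnd f ≡ 0 → ∀ c P R → (∀ v → P v ≡ true → R v ≡ true → ⊥) →
    (card (typeA (τ-of P R)) ≡ card P → card R ≤ card (typeB (τ-of P R)) → cnd (τ-of P R) ≡ true) →
    ∃ λ u → ∃ λ v → P u ≡ true × R v ≡ true × adjOf f c u v ≡ true
  use₃ cnd f z c P R dis ok with β₃-zero cnd f z c (τ-of P R) (ok (card-cong (τ-of-A P R)) (card-mono R (typeB (τ-of P R)) sub))
    where
    sub : ∀ v → R v ≡ true → typeB (τ-of P R) v ≡ true
    sub v q with P v in eq
    ... | true  = ⊥-elim (dis v eq q)
    ... | false = trans (τ-of-B P R v) (∧-true (cong not eq) q)
  ... | u , v , uA , vB , a = u , v , trans (sym (τ-of-A P R u)) uA , proj₂ (∧-true⁻ (not (P v)) (trans (sym (τ-of-B P R v)) vB)) , a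

  joined : ∀ f → β₃B f ≡ 0 → ∀ c P R → (∀ v → P v ≡ true → R v ≡ true → ⊥) → u₁ ≤ card P → b ≤ card R →
    ∃ λ u → ∃ λ v → P u ≡ true × R v ≡ true × adjOf f c u v ≡ true
  joined f z c P R dis p q = use₃ cndB f z c P R dis λ eA leB →
    ∧-true (⌊⌋-true (u₁ ≤? _) (subst (u₁ ≤_) (sym eA) p)) (⌊⌋-true (b ≤? _) (≤-trans q leB))

  -- Masking leaves edges away from `S` intact. If `P` had at most `K` neighbours, then `P` without
  -- `S` and the vertices outside `P`, `S` and these neighbours would be a pair for `cndA` with no
  -- edge of colour `c`.
  masked-expansion : ∀ f → β₃A f ≡ 0 → ∀ S → length S ≤ 2 → ∀ c P → u ≤ card P → card P ≤ s →
    K < card (nbrs (adjOf (mask S f)) c P)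
  masked-expansion f z S S≤2 c P u≤P P≤s = ≰⇒> contra
    where
    open ≤-Reasoning
    nb : VSet n
    nb = nbrs (adjOf (mask S f)) c P
    P′ R′ : VSet n
    P′ = without S P
    R′ v = not (P v) ∧ (not (mem S v) ∧ not (nb v))
    d≤P′ : d ≤ card P′
    d≤P′ = +-cancelʳ-≤ 2 d (card P′) (begin
      d + 2 ≤⟨ +-monoʳ-≤ d (*-monoʳ-≤ 2 d≥1) ⟩
      d + 2 * d ≤⟨ u≤P ⟩
      card P ≤⟨ card-without S P ⟩
      card P′ + length S ≤⟨ +-monoʳ-≤ (card P′) S≤2 ⟩
      card P′ + 2 ∎)
    split : ∀ v → true ≡ true → R′ v ≡ true ⊎ P v ∨ (mem S v ∨ nb v) ≡ true
    split v _ with P v | mem S v | nb v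
    ... | true  | _     | _     = inj₂ refl
    ... | false | true  | _     = inj₂ refl
    ... | false | false | true  = inj₂ refl
    ... | false | false | false = inj₁ refl
    n≤ : card nb ≤ K → n ≤ card R′ + K′
    n≤ nb≤K = begin
      n ≡⟨ card-all {n} ⟨
      card {n} full ≤⟨ card-cover full R′ (λ v → P v ∨ (mem S v ∨ nb v)) split ⟩
      card R′ + card (λ v → P v ∨ (mem S v ∨ nb v)) ≤⟨ +-monoʳ-≤ (card R′) (card-cover (λ v → P v ∨ (mem S v ∨ nb v)) P (λ v → mem S v ∨ nb v) (λ v → ∨-true⁻ (P v))) ⟩
      card R′ + (card P + card (λ v → mem S v ∨ nb v)) ≤⟨ +-monoʳ-≤ (card R′) (+-mono-≤ P≤s (card-cover (λ v → mem S v ∨ nb v) (mem S) nb (λ v → ∨-true⁻ (mem S v)))) ⟩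
      card R′ + (s + (card (mem S) + card nb)) ≤⟨ +-monoʳ-≤ (card R′) (+-monoʳ-≤ s (+-mono-≤ (≤-trans (card-mem-≤ S) S≤2) nb≤K)) ⟩
      card R′ + (s + (2 + K)) ≡⟨ cong (λ z → card R′ + z) (eq s K) ⟩
      card R′ + K′ ∎
      where
      eq : ∀ s k → s + (2 + k) ≡ s + k + 2
      eq = solve-∀
    disjoint : ∀ v → P′ v ≡ true → R′ v ≡ true → ⊥
    disjoint v p q = true≢false (trans (sym (without-∈ S P p)) (not-true⁻ (P v) (proj₁ (∧-true⁻ (not (P v)) q))))
    ok : card nb ≤ K → card (typeA (τ-of P′ R′)) ≡ card P′ → card R′ ≤ card (typeB (τ-of P′ R′)) → cndA (τ-of P′ R′) ≡ true
    ok nb≤K eA leB = ∧-true (⌊⌋-true (d ≤? _) (subst (d ≤_) (sym eA) d≤P′)) (⌊⌋-true (n ≤? _) (≤-trans (n≤ nb≤K) (+-monoˡ-≤ K′ leB)))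
    clash : (∃ λ a → ∃ λ v → P′ a ≡ true × R′ v ≡ true × adjOf f c a v ≡ true) → ⊥
    clash (a , v , a∈ , v∈ , e) = true≢false (trans (sym (nbrs⁺ (adjOf (mask S f)) c P (without-∈ S P a∈)
        (adj-mask⁺ S f c a v (without-∉ S P a∈) (∉⇐mem (not-true⁻ (mem S v) (proj₁ q))) e))) (not-true⁻ (nb v) (proj₂ q)))
      where q = ∧-true⁻ (not (mem S v)) (proj₂ (∧-true⁻ (not (P v)) v∈))
    contra : card nb ≤ K → ⊥
    contra nb≤K = clash (use₃ cndA f z c P′ R′ disjoint (ok nb≤K))

  -- The removal process runs in the masked graph, whose edges all occur in the true one, so the
  -- expansion carries over.
  core-of-mask : ∀ f → β₃A f ≡ 0 → ∀ S → length S ≤ 2 → Expanding (adjOf f) κ s (lookup (core (mask S f)))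
  core-of-mask f z S S≤2 c P sub pos small = ≤-trans (core-expanding (mask S f) exists c P sub pos small)
      (card-mono _ _ λ v p → let (p₁ , p₂) = ∧-true⁻ (nbrs (adjOf (mask S f)) c P v) p
                                 (a , a∈ , e) = nbrs⁻ (adjOf (mask S f)) c P {v} p₁
                             in ∧-true (nbrs⁺ (adjOf f) c P a∈ (adj-mask⁻ S f c a v e)) p₂)
    where
    module C = Core (adjOf (mask S f)) κ s u K u≥1 2u≤s K₁ K₂ (masked-expansion f z S S≤2)
    exists : ∃ (IsCore (mask S f))
    exists = let (W , big , ex) = C.core in Vec.tabulate W ,
      subst (λ c → n ≤ c + w) (sym (card-cong (lookup∘tabulate W))) big ,
      λ c A sub pos small → subst (κ * card A <_)
        (card-cong (λ v → cong (nbrs (adjOf (mask S f)) c A v ∧_) (sym (lookup∘tabulate W v))))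
        (ex c A (λ v a → trans (sym (lookup∘tabulate W v)) (sub v a)) pos small)


  adj-sym : ∀ f {c u v} → adjOf f c u v ≡ true → adjOf f c v u ≡ true
  adj-sym f {c} {u} {v} p = let (u≢v , q) = adjOf⁻ f c u v p in
    adjOf⁺ f c (≢-sym u≢v) (subst (λ e → hasᵇ c (lookup f e) ≡ true) (E-sym u v) q)

  Early Soon : Labelling → Fin n → Fin n → Set
  Early f u v = earlyᵇ (lookup f (E u v)) ≡ true
  Soon f u v = soonᵇ (lookup f (E u v)) ≡ true

  early⇒adj : ∀ f {u v} → u ≢ v → Early f u v → ∃ λ c → adjOf f c u v ≡ true
  early⇒adj f {u} {v} u≢v p = c , adjOf⁺ f c u≢v (∧-true p (⌊⌋-true (c F.≟ c) refl))
    where c = proj₂ (lookup f (E u v))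

  module Connected (f : Labelling) (zero₃A : β₃A f ≡ 0) (zero₃B : β₃B f ≡ 0) (zero₄ : β₄ f ≡ 0) (zero₅ : β₅ f ≡ 0)
    (pat : ℕ → Fin r) (pat-mod : Grow.Periodic (adjOf f) ℓ′ pat) (pat-onto : ∀ c → ∃ λ i → pat i ≡ c)
    (R : Fin r → Fin n → Fin n → Set) (R-sym : ∀ {c u v} → R c u v → R c v u)
    (adj⇒R : ∀ c u v → adjOf f c u v ≡ true → R c u v)
    (R⇒ : ∀ {c u v} → R c u v → u ≢ v × Soon f u v)
    (R? : ∀ u v → Dec (∃ λ c → R c u v)) (no-isolated : ∀ u → ∃ λ c → ∃ λ v → R c u v) where

    early⇒R : ∀ u v → u ≢ v → Early f u v → ∃ λ c → R c u v
    early⇒R u v u≢v ev = let (c , a) = early⇒adj f u≢v ev in c , adj⇒R c u v a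

    connected : ∀ x y → x ≢ y → ∃ λ p → ∃ λ vs → PatPath R pat p x y vs
    connected = Conclusion.connected (adjOf f) (λ {c u v} → adj-sym f {c} {u} {v}) (Early f) (Soon f)
      (λ S → lookup (core (mask S f))) ℓ′ u₁ b u₁≥1 u₁≤b room (joined f zero₃B) (core-of-mask f zero₃A)
      (t₄-zero f zero₄) (t₅-zero f zero₅) pat (λ {i j} → pat-mod {i} {j}) pat-onto
      R R-sym (λ {c u v} → adj⇒R c u v) (λ {u v} → early⇒R u v) R⇒ R? no-isolated

-- Orderings of the edges

lookup-unique : {X : Set} {xs : List X} → Unique xs → ∀ i j → List.lookup xs i ≡ List.lookup xs j → i ≡ j
lookup-unique (x∉ ∷ u) F.zero    F.zero    e = refl
lookup-unique {xs = x ∷ xs} (x∉ ∷ u) F.zero (F.suc j) e = ⊥-elim (All.lookup x∉ (∈-lookup j) e)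
lookup-unique {xs = x ∷ xs} (x∉ ∷ u) (F.suc i) F.zero e = ⊥-elim (All.lookup x∉ (∈-lookup i) (sym e))
lookup-unique (x∉ ∷ u) (F.suc i) (F.suc j) e = cong F.suc (lookup-unique u i j e)

suc² : {n : ℕ} → Fin n × Fin n → Fin (suc n) × Fin (suc n)
suc² (a , b) = F.suc a , F.suc b

pairs : (n : ℕ) → List (Fin n × Fin n)
pairs zero    = []
pairs (suc n) = map (λ j → F.zero , F.suc j) (allFin n) ++ map suc² (pairs n)

length-pairs : ∀ n → length (pairs n) ≡ Npairs n
length-pairs zero    = refl
length-pairs (suc n) = trans (length-++ (map (λ j → F.zero , F.suc j) (allFin n)))
  (trans (cong₂ _+_ (trans (length-map (λ j → F.zero , F.suc j) (allFin n)) (trans (length-allFin n) (sym (nC1≡n n))))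
                    (trans (length-map suc² (pairs n)) (length-pairs n)))
         (nCk+nC[k+1]≡[n+1]C[k+1] n 1))

pairs-< : ∀ n {p} → p ∈ pairs n → proj₁ p F.< proj₂ p
pairs-< (suc n) p∈ with ∈-++⁻ (map (λ j → F.zero , F.suc j) (allFin n)) p∈
... | inj₁ q with ∈-map⁻ (λ j → F.zero , F.suc j) q
...   | j , _ , refl = s≤s z≤n
pairs-< (suc n) p∈ | inj₂ q with ∈-map⁻ suc² q
...   | ab , ab∈ , refl = s≤s (pairs-< n ab∈)

∈-pairs : ∀ n {a b : Fin n} → a F.< b → (a , b) ∈ pairs n
∈-pairs (suc n) {F.zero}  {F.suc b} _         = ∈-++⁺ˡ (∈-map⁺ (λ j → F.zero , F.suc j) (∈-allFin b))
∈-pairs (suc n) {F.suc a} {F.suc b} (s≤s a<b) = ∈-++⁺ʳ _ (∈-map⁺ suc² (∈-pairs n a<b))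

pairs-unique : ∀ n → Unique (pairs n)
pairs-unique zero    = []
pairs-unique (suc n) = Unique.++⁺ (Unique-map (λ { _ _ refl → refl }) (Unique.allFin⁺ n))
  (Unique-map (λ { _ _ refl → refl }) (pairs-unique n)) dis
  where
  dis : ∀ {p} → p ∈ map (λ j → F.zero , F.suc j) (allFin n) × p ∈ map suc² (pairs n) → ⊥
  dis (p , q) with ∈-map⁻ (λ j → F.zero , F.suc j) p | ∈-map⁻ suc² q
  ... | _ , _ , refl | _ , _ , ()

edge : (n : ℕ) → Fin (Npairs n) → Fin n × Fin n
edge n e = List.lookup (pairs n) (F.cast (sym (length-pairs n)) e)

module EdgeCode (n : ℕ) where

  N : ℕ
  N = Npairs n

  cast-injective : ∀ {a b} (eq : a ≡ b) {i j : Fin a} → F.cast eq i ≡ F.cast eq j → i ≡ j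
  cast-injective eq {i} {j} e = F.toℕ-injective (trans (sym (F.toℕ-cast eq i)) (trans (cong toℕ e) (F.toℕ-cast eq j)))

  edge-injective : ∀ {i j} → edge n i ≡ edge n j → i ≡ j
  edge-injective e = cast-injective (sym (length-pairs n)) (lookup-unique (pairs-unique n) _ _ e)

  edge-< : ∀ e → proj₁ (edge n e) F.< proj₂ (edge n e)
  edge-< e = pairs-< n (∈-lookup (F.cast (sym (length-pairs n)) e))

  code : ∀ {a b} → a F.< b → ∃ λ e → edge n e ≡ (a , b)
  code {a} {b} a<b = F.cast (length-pairs n) i ,
      trans (cong (List.lookup (pairs n)) (F.toℕ-injective (trans (F.toℕ-cast (sym (length-pairs n)) _) (F.toℕ-cast (length-pairs n) i))))
            (sym (lookup-index (∈-pairs n a<b)))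
    where i = Any.index (∈-pairs n a<b)

  module Code (dummy : Fin N) where

    -- `dummy` fills the diagonal, where there is no edge; `adjOf` excludes it.
    E : Fin n → Fin n → Fin N
    E u v with F.<-cmp u v
    ... | tri< u<v _ _ = proj₁ (code u<v)
    ... | tri≈ _ _ _   = dummy
    ... | tri> _ _ v<u = proj₁ (code v<u)

    E-< : ∀ {u v} → u F.< v → edge n (E u v) ≡ (u , v)
    E-< {u} {v} u<v with F.<-cmp u v
    ... | tri< p _ _ = proj₂ (code p)
    ... | tri≈ ¬p _ _ = ⊥-elim (¬p u<v)
    ... | tri> ¬p _ _ = ⊥-elim (¬p u<v)

    E-> : ∀ {u v} → v F.< u → edge n (E u v) ≡ (v , u)
    E-> {u} {v} v<u with F.<-cmp u v
    ... | tri< _ _ ¬p = ⊥-elim (¬p v<u)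
    ... | tri≈ _ _ ¬p = ⊥-elim (¬p v<u)
    ... | tri> _ _ p = proj₂ (code p)

    E-joins : ∀ {u v} → u ≢ v → edge n (E u v) ≡ (u , v) ⊎ edge n (E u v) ≡ (v , u)
    E-joins {u} {v} u≢v with F.<-cmp u v
    ... | tri< p _ _ = inj₁ (proj₂ (code p))
    ... | tri≈ _ e _ = ⊥-elim (u≢v e)
    ... | tri> _ _ p = inj₂ (proj₂ (code p))

    E-sym : ∀ u v → E u v ≡ E v u
    E-sym u v = by-cmp (F.<-cmp u v)
      where
      by-cmp : _ → E u v ≡ E v u
      by-cmp (tri< p _ _)    = edge-injective (trans (E-< p) (sym (E-> p)))
      by-cmp (tri≈ _ refl _) = refl
      by-cmp (tri> _ _ p)    = edge-injective (trans (E-> p) (sym (E-< p)))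

    E-inj : ∀ {u v u′ v′} → u ≢ v → u′ ≢ v′ → E u v ≡ E u′ v′ → (u ≡ u′ × v ≡ v′) ⊎ (u ≡ v′ × v ≡ u′)
    E-inj {u} {v} {u′} {v′} u≢v u′≢v′ e = align (E-joins u≢v) (E-joins u′≢v′)
      where
      same : ∀ {p q : Fin n × Fin n} → edge n (E u v) ≡ p → edge n (E u′ v′) ≡ q → p ≡ q
      same a b = trans (sym a) (trans (cong (edge n) e) b)
      align : edge n (E u v) ≡ (u , v) ⊎ edge n (E u v) ≡ (v , u) → edge n (E u′ v′) ≡ (u′ , v′) ⊎ edge n (E u′ v′) ≡ (v′ , u′) →
                (u ≡ u′ × v ≡ v′) ⊎ (u ≡ v′ × v ≡ u′)
      align (inj₁ a) (inj₁ b) = inj₁ (cong proj₁ (same a b) , cong proj₂ (same a b))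
      align (inj₁ a) (inj₂ b) = inj₂ (cong proj₁ (same a b) , cong proj₂ (same a b))
      align (inj₂ a) (inj₁ b) = inj₂ (cong proj₂ (same a b) , cong proj₁ (same a b))
      align (inj₂ a) (inj₂ b) = inj₁ (cong proj₂ (same a b) , cong proj₁ (same a b))

    edge⇒E : ∀ {e u v} → edge n e ≡ (u , v) → e ≡ E u v
    edge⇒E {e} {u} {v} p = edge-injective (trans p (sym (E-< (subst (λ q → proj₁ q F.< proj₂ q) p (edge-< e)))))

perms : (N : ℕ) → List (Vec (Fin N) N)
perms zero    = [] ∷ []
perms (suc N) = map (λ (i , π) → i ∷ Vec.map (F.punchIn i) π) (cartesianProduct (allFin (suc N)) (perms N))

length-perms : ∀ N → length (perms N) ≡ N !
length-perms zero    = refl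
length-perms (suc N) = trans (length-map _ (cartesianProduct (allFin (suc N)) (perms N)))
  (trans (length-cartesianProduct (allFin (suc N)) (perms N)) (cong₂ _*_ (length-allFin (suc N)) (length-perms N)))

map-injective : {X Y : Set} {f : X → Y} {n : ℕ} (u v : Vec X n) → (∀ {x y} → f x ≡ f y → x ≡ y) → Vec.map f u ≡ Vec.map f v → u ≡ v
map-injective []      []      inj e = refl
map-injective (x ∷ u) (y ∷ v) inj e with ∷-injective e
... | p , q = cong₂ _∷_ (inj p) (map-injective u v inj q)

perms-unique : ∀ N → Unique (perms N)
perms-unique zero    = [] ∷ []
perms-unique (suc N) = Unique-map inj (Unique.cartesianProduct⁺ (Unique.allFin⁺ (suc N)) (perms-unique N))
  where
  inj : ∀ {p q} → p ∈ _ → q ∈ _ → proj₁ p ∷ Vec.map (F.punchIn (proj₁ p)) (proj₂ p) ≡ proj₁ q ∷ Vec.map (F.punchIn (proj₁ q)) (proj₂ q) → p ≡ q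
  inj {i , π} {j , ρ} _ _ e with ∷-injective e
  ... | refl , f = cong (i ,_) (map-injective π ρ (λ {x} {y} → F.punchIn-injective i x y) f)

record IsPerm {N : ℕ} (π : Vec (Fin N) N) : Set where
  field
    injective  : ∀ i j → lookup π i ≡ lookup π j → i ≡ j
    surjective : ∀ e → ∃ λ i → lookup π i ≡ e

∈-perms⇒ : ∀ N {π} → π ∈ perms N → IsPerm π
∈-perms⇒ zero    (here refl) = record { injective = λ () ; surjective = λ () }
∈-perms⇒ (suc N) p with ∈-map⁻ _ p
... | (i , π) , q , refl with ∈-cartesianProduct⁻ (allFin (suc N)) (perms N) q
...   | _ , π∈ = record { injective = inj ; surjective = sur }
  where
  open IsPerm (∈-perms⇒ N π∈)
  at : ∀ k → lookup (Vec.map (F.punchIn i) π) k ≡ F.punchIn i (lookup π k)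
  at k = lookup-map k (F.punchIn i) π
  inj : ∀ j k → lookup (i ∷ Vec.map (F.punchIn i) π) j ≡ lookup (i ∷ Vec.map (F.punchIn i) π) k → j ≡ k
  inj F.zero    F.zero    e = refl
  inj F.zero    (F.suc k) e = ⊥-elim (F.punchInᵢ≢i i (lookup π k) (sym (trans e (at k))))
  inj (F.suc j) F.zero    e = ⊥-elim (F.punchInᵢ≢i i (lookup π j) (trans (sym (at j)) e))
  inj (F.suc j) (F.suc k) e = cong F.suc (injective j k (F.punchIn-injective i _ _ (trans (sym (at j)) (trans e (at k)))))
  sur : ∀ e → ∃ λ k → lookup (i ∷ Vec.map (F.punchIn i) π) k ≡ e
  sur e with i F.≟ e
  ... | yes i≡e = F.zero , i≡e
  ... | no i≢e  = let (k , q) = surjective (F.punchOut i≢e) in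
          F.suc k , trans (at k) (trans (cong (F.punchIn i) q) (F.punchIn-punchOut i≢e))

-- The k-subsets of `Fin M`, split as in Pascal's rule by whether they contain 0. They serve as the
-- sorted times of a labelling.
increasing : (k M : ℕ) → List (Vec (Fin M) k)
increasing zero    M       = [] ∷ []
increasing (suc k) zero    = []
increasing (suc k) (suc M) = map (λ g → F.zero ∷ Vec.map F.suc g) (increasing k M) ++ map (Vec.map F.suc) (increasing (suc k) M)

∈-increasing⇒ : ∀ k M {g} → g ∈ increasing k M → ∀ i j → i F.< j → lookup g i F.< lookup g j
∈-increasing⇒ (suc k) (suc M) g∈ i j i<j with ∈-++⁻ (map (λ g → F.zero ∷ Vec.map F.suc g) (increasing k M)) g∈
∈-increasing⇒ (suc k) (suc M) g∈ i j i<j | inj₂ q with ∈-map⁻ (Vec.map F.suc) q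
... | g , g∈′ , refl = subst₂ F._<_ (sym (lookup-map i F.suc g)) (sym (lookup-map j F.suc g)) (s≤s (∈-increasing⇒ (suc k) M g∈′ i j i<j))
∈-increasing⇒ (suc k) (suc M) g∈ F.zero (F.suc j) i<j | inj₁ q with ∈-map⁻ (λ g → F.zero ∷ Vec.map F.suc g) q
... | g , _ , refl = subst (λ z → F.zero {M} F.< z) (sym (lookup-map j F.suc g)) z<s
∈-increasing⇒ (suc k) (suc M) g∈ (F.suc i) (F.suc j) (s≤s i<j) | inj₁ q with ∈-map⁻ (λ g → F.zero ∷ Vec.map F.suc g) q
... | g , g∈′ , refl = subst₂ F._<_ (sym (lookup-map i F.suc g)) (sym (lookup-map j F.suc g)) (s≤s (∈-increasing⇒ k M g∈′ i j i<j))

increasing-unique : ∀ k M → Unique (increasing k M)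
increasing-unique zero    M       = [] ∷ []
increasing-unique (suc k) zero    = []
increasing-unique (suc k) (suc M) = Unique.++⁺
  (Unique-map (λ {g} {h} _ _ e → map-injective g h F.suc-injective (proj₂ (∷-injective e))) (increasing-unique k M))
  (Unique-map (λ {g} {h} _ _ e → map-injective g h F.suc-injective e) (increasing-unique (suc k) M)) dis
  where
  dis : ∀ {g} → g ∈ map (λ g → F.zero ∷ Vec.map F.suc g) (increasing k M) × g ∈ map (Vec.map F.suc) (increasing (suc k) M) → ⊥
  dis (p , q) with ∈-map⁻ _ p | ∈-map⁻ (Vec.map F.suc) q
  ... | _ , _ , refl | x ∷ _ , _ , ()

#increasing-suc : ∀ k M → length (increasing (suc k) (suc M)) ≡ length (increasing k M) + length (increasing (suc k) M)
#increasing-suc k M = trans (length-++ (map (λ g → F.zero ∷ Vec.map F.suc g) (increasing k M)))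
  (cong₂ _+_ (length-map _ (increasing k M)) (length-map _ (increasing (suc k) M)))

-- The falling factorial (k+j)...(j+1) is at least (j+1)^k. In the induction by Pascal's rule the
-- required step (j+2)^(k+1) - (j+1)^(k+1) ≤ (k+1)(j+2)^k comes from `bernoulli⁻`.
#increasing≥ : ∀ k j → suc j ^ k ≤ k ! * length (increasing k (k + j))
#increasing≥ zero    j = ≤-refl
#increasing≥ (suc k) zero = begin
  1 ^ suc k ≡⟨ ^-zeroˡ (suc k) ⟩
  1 ≡⟨ ^-zeroˡ k ⟨
  1 ^ k ≤⟨ #increasing≥ k zero ⟩
  k ! * length (increasing k (k + 0)) ≤⟨ *-mono-≤ (m≤n*m (k !) (suc k)) (≤-trans (m≤m+n _ _) (≤-reflexive (sym (#increasing-suc k (k + 0))))) ⟩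
  suc k ! * length (increasing (suc k) (suc k + 0)) ∎
  where open ≤-Reasoning
#increasing≥ (suc k) (suc j) = begin
  suc (suc j) ^ suc k ≤⟨ bern ⟩
  suc k * suc (suc j) ^ k + suc j ^ suc k ≤⟨ +-mono-≤ (*-monoʳ-≤ (suc k) (#increasing≥ k (suc j))) (#increasing≥ (suc k) j) ⟩
  suc k * (k ! * length (increasing k (k + suc j))) + suc k ! * length (increasing (suc k) (suc k + j))
                                                              ≡⟨ cong (λ z → suc k * (k ! * length (increasing k (k + suc j))) + suc k ! * length (increasing (suc k) z)) (sym (+-suc k j)) ⟩
  suc k * (k ! * length (increasing k (k + suc j))) + suc k ! * length (increasing (suc k) (k + suc j))
                                                              ≡⟨ eq (suc k) (k !) (length (increasing k (k + suc j))) (length (increasing (suc k) (k + suc j))) ⟩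
  suc k ! * (length (increasing k (k + suc j)) + length (increasing (suc k) (k + suc j)))
                                                              ≡⟨ cong (suc k ! *_) (#increasing-suc k (k + suc j)) ⟨
  suc k ! * length (increasing (suc k) (suc k + suc j)) ∎
  where
  open ≤-Reasoning
  eq : ∀ a b x y → a * (b * x) + a * b * y ≡ a * b * (x + y)
  eq = solve-∀
  bern : suc (suc j) ^ suc k ≤ suc k * suc (suc j) ^ k + suc j ^ suc k
  bern = *-cancelʳ-≤ _ _ (suc (suc j)) (begin
    suc (suc j) ^ suc k * suc (suc j) ≡⟨ cong (λ z → z ^ suc k * z) (+-comm 1 (suc j)) ⟩
    (suc j + 1) ^ suc k * (suc j + 1) ≤⟨ bernoulli⁻ (suc j) 1 (suc k) ⟩
    suc j ^ suc k * (suc j + 1) + suc k * 1 * (suc j + 1) ^ suc k ≡⟨ cong (λ z → suc j ^ suc k * z + suc k * 1 * z ^ suc k) (+-comm (suc j) 1) ⟩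
    suc j ^ suc k * suc (suc j) + suc k * 1 * suc (suc j) ^ suc k ≡⟨ eq₂ (suc j ^ suc k) (suc (suc j)) (suc k) (suc (suc j) ^ k) ⟩
    (suc k * suc (suc j) ^ k + suc j ^ suc k) * suc (suc j) ∎)
    where
    eq₂ : ∀ p q k z → p * q + k * 1 * (q * z) ≡ (k * z + p) * q
    eq₂ = solve-∀

-- N ! * length (increasing N M) is the number of injections from an N-set to an M-set.
functions≤2injections : ∀ N M → 2 * (N * N) ≤ M → N ≤ M → M ^ N ≤ 2 * (N ! * length (increasing N M))
functions≤2injections N M big N≤M with m≤n⇒∃[o]m+o≡n N≤M
... | j , refl = ≤-trans dbl (*-monoʳ-≤ 2 (≤-trans (^-monoˡ-≤ N (n≤1+n j)) (#increasing≥ N j)))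
  where
  dbl : (N + j) ^ N ≤ 2 * j ^ N
  dbl with j + N in eq
  ... | zero  rewrite m+n≡0⇒n≡0 j eq = s≤s z≤n
  ... | suc _ = subst (λ z → z ^ N ≤ 2 * j ^ N) (+-comm j N)
    (^-≤-double j N N {{subst NonZero (sym eq) _}} (≤-trans big (≤-reflexive (+-comm N j))))

-- The hitting time

≗⇒≡ : {X : Set} {n : ℕ} {u v : Vec X n} → (∀ k → lookup u k ≡ lookup v k) → u ≡ v
≗⇒≡ {u = u} {v} e = trans (sym (tabulate∘lookup u)) (trans (tabulate-cong e) (tabulate∘lookup v))

module Position {N : ℕ} where

  pos : Vec (Fin N) N → Fin N → Fin N
  pos π e with F.any? (λ k → lookup π k F.≟ e)
  ... | yes (k , _) = k
  ... | no _        = e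

  lookup-pos : ∀ {π} → IsPerm π → ∀ e → lookup π (pos π e) ≡ e
  lookup-pos {π} perm e with F.any? (λ k → lookup π k F.≟ e)
  ... | yes (_ , p) = p
  ... | no ¬p       = ⊥-elim (¬p (IsPerm.surjective perm e))

  pos-lookup : ∀ {π} → IsPerm π → ∀ k → pos π (lookup π k) ≡ k
  pos-lookup {π} perm k = IsPerm.injective perm _ _ (lookup-pos perm (lookup π k))

  Increasing : {M : ℕ} → Vec (Fin M) N → Set
  Increasing g = ∀ i j → i F.< j → lookup g i F.< lookup g j

  increasing-reflects : ∀ {M} {g : Vec (Fin M) N} → Increasing g → ∀ {i j} → lookup g i F.< lookup g j → i F.< j
  increasing-reflects {g = g} inc {i} {j} lt with F.<-cmp i j
  ... | tri< i<j _ _  = i<j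
  ... | tri≈ _ refl _ = ⊥-elim (<-irrefl refl lt)
  ... | tri> _ _ j<i  = ⊥-elim (<-asym lt (inc j i j<i))

  increasing-≤ : ∀ {M} {g : Vec (Fin M) N} → Increasing g → ∀ {i j} → toℕ i ≤ toℕ j → toℕ (lookup g i) ≤ toℕ (lookup g j)
  increasing-≤ {g = g} inc i≤j = ≮⇒≥ λ lt → <⇒≱ (increasing-reflects {g = g} inc lt) i≤j

  increasing-injective : ∀ {M} {g : Vec (Fin M) N} → Increasing g → ∀ {i j} → lookup g i ≡ lookup g j → i ≡ j
  increasing-injective {g = g} inc {i} {j} e = F.toℕ-injective (≤-antisym
    (≮⇒≥ λ lt → <-irrefl (cong toℕ (sym e)) (inc j i lt)) (≮⇒≥ λ lt → <-irrefl (cong toℕ e) (inc i j lt)))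

  monotone-≥ : (ρ : Fin N → Fin N) → (∀ {i j} → i F.< j → ρ i F.< ρ j) → ∀ k → toℕ k ≤ toℕ (ρ k)
  monotone-≥ ρ mono k = go (toℕ k) k refl
    where
    go : ∀ t k → toℕ k ≡ t → t ≤ toℕ (ρ k)
    go zero    k e = z≤n
    go (suc t) k e = ≤-<-trans (go t k′ e′) (mono (≤-reflexive (trans (cong suc e′) (sym e))))
      where
      t<N : t < N
      t<N = <-trans (≤-reflexive (sym e)) (F.toℕ<n k)
      k′ = F.fromℕ< t<N
      e′ : toℕ k′ ≡ t
      e′ = F.toℕ-fromℕ< t<N

  module _ {M r : ℕ} where

    -- A labelling with distinct times is recovered from the order of the edges, their colours in
    -- that order and the sorted list of times.
    encode : Vec (Fin N) N → Vec (Fin r) N → Vec (Fin M) N → Vec (Fin M × Fin r) N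
    encode π c g = Vec.tabulate (λ e → lookup g (pos π e) , lookup c (pos π e))

    lookup-encode : ∀ π c g e → lookup (encode π c g) e ≡ (lookup g (pos π e) , lookup c (pos π e))
    lookup-encode π c g e = lookup∘tabulate (λ e → lookup g (pos π e) , lookup c (pos π e)) e

    -- Equal labellings give an increasing map ρ of positions with g ∘ ρ = g′. Such a ρ is at least
    -- the identity, so g ≤ g′; by symmetry g = g′, hence ρ is the identity.
    encode-injective : ∀ {π π′ c c′ g g′} → IsPerm π → IsPerm π′ → Increasing g → Increasing g′ →
      encode π c g ≡ encode π′ c′ g′ → π ≡ π′ × c ≡ c′ × g ≡ g′
    encode-injective {π} {π′} {c} {c′} {g} {g′} perm perm′ inc inc′ e = ≗⇒≡ π≡ , ≗⇒≡ c≡ , ≗⇒≡ g≡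
      where
      transferred : ∀ {π π′ c c′ g g′} → IsPerm π′ → encode π c g ≡ encode π′ c′ g′ →
        ∀ k → (lookup g (pos π (lookup π′ k)) , lookup c (pos π (lookup π′ k))) ≡ (lookup g′ k , lookup c′ k)
      transferred {π} {π′} {c} {c′} {g} {g′} perm′ e k = trans (sym (lookup-encode π c g (lookup π′ k)))
        (trans (cong (λ f → lookup f (lookup π′ k)) e) (trans (lookup-encode π′ c′ g′ (lookup π′ k))
          (cong (λ i → lookup g′ i , lookup c′ i) (pos-lookup perm′ k))))
      one-sided : ∀ {π π′ c c′ g g′} → IsPerm π′ → Increasing g → Increasing g′ → encode π c g ≡ encode π′ c′ g′ →
        ∀ k → toℕ (lookup g k) ≤ toℕ (lookup g′ k)
      one-sided {π} {π′} {c} {c′} {g} {g′} perm′ inc inc′ e k = ≤-trans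
        (increasing-≤ {g = g} inc (monotone-≥ ρ (λ {i} {j} i<j → increasing-reflects {g = g} inc (subst₂ F._<_ (sym (gρ i)) (sym (gρ j)) (inc′ i j i<j))) k))
        (≤-reflexive (cong toℕ (gρ k)))
        where
        ρ : Fin N → Fin N
        ρ k = pos π (lookup π′ k)
        gρ : ∀ k → lookup g (ρ k) ≡ lookup g′ k
        gρ k = cong proj₁ (transferred {π} {π′} {c} {c′} {g} {g′} perm′ e k)
      g≡ : ∀ k → lookup g k ≡ lookup g′ k
      g≡ k = F.toℕ-injective (≤-antisym (one-sided {π} {π′} {c} {c′} {g} {g′} perm′ inc inc′ e k)
                                        (one-sided {π′} {π} {c′} {c} {g′} {g} perm inc′ inc (sym e) k))
      ρ≡ : ∀ k → pos π (lookup π′ k) ≡ k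
      ρ≡ k = increasing-injective {g = g} inc (trans (cong proj₁ (transferred {π} {π′} {c} {c′} {g} {g′} perm′ e k)) (sym (g≡ k)))
      π≡ : ∀ k → lookup π k ≡ lookup π′ k
      π≡ k = trans (cong (lookup π) (sym (ρ≡ k))) (lookup-pos perm (lookup π′ k))
      c≡ : ∀ k → lookup c k ≡ lookup c′ k
      c≡ k = trans (cong (lookup c) (sym (ρ≡ k))) (cong proj₂ (transferred {π} {π′} {c} {c′} {g} {g′} perm′ e k))

open Position

module Pattern {r : ℕ} (ℓ′ : ℕ) (Π : Vec (Fin r) (suc ℓ′)) where

  pat : ℕ → Fin r
  pat s = lookup Π (s mod suc ℓ′)

  mod-cong : ∀ {i j} → i % suc ℓ′ ≡ j % suc ℓ′ → i mod suc ℓ′ ≡ j mod suc ℓ′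
  mod-cong {i} {j} e = F.toℕ-injective (trans (F.toℕ-fromℕ< (m%n<n i (suc ℓ′))) (trans e (sym (F.toℕ-fromℕ< (m%n<n j (suc ℓ′))))))

  pat-mod : ∀ {i j} → i % suc ℓ′ ≡ j % suc ℓ′ → pat i ≡ pat j
  pat-mod {i} {j} e = cong (lookup Π) (mod-cong {i} {j} e)

  toℕ-mod : ∀ (j : Fin (suc ℓ′)) → toℕ j mod suc ℓ′ ≡ j
  toℕ-mod j = F.toℕ-injective (trans (F.toℕ-fromℕ< (m%n<n (toℕ j) (suc ℓ′))) (m<n⇒m%n≡m (F.toℕ<n j)))

  pat-onto : (∀ c → ∃ λ j → lookup Π j ≡ c) → ∀ c → ∃ λ i → pat i ≡ c
  pat-onto onto c = let (j , e) = onto c in toℕ j , trans (cong (lookup Π) (toℕ-mod j)) e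

  -- The indexed form that `PiPath` asks for. `in-vs` turns the freshness condition of `PatPath`
  -- into injectivity.
  record Walk {n : ℕ} (R : Fin r → Fin n → Fin n → Set) (s : ℕ) (x y : Fin n) (vs : List (Fin n)) : Set where
    field
      len   : ℕ
      verts : Fin (suc len) → Fin n
      start : verts F.zero ≡ x
      end   : verts (F.fromℕ len) ≡ y
      in-vs : ∀ j → verts j ∈ vs
      inj   : ∀ i j → verts i ≡ verts j → i ≡ j
      steps : ∀ (j : Fin len) → R (pat (toℕ j + s)) (verts (F.inject₁ j)) (verts (F.suc j))

  walk : ∀ {n} {R : Fin r → Fin n → Fin n → Set} {s x y vs} → PatPath R pat s x y vs → Walk R s x y vs
  walk {x = x} stay = record { len = 0 ; verts = λ _ → x ; start = refl ; end = refl ; in-vs = λ _ → here refl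
                             ; inj = λ { F.zero F.zero _ → refl } ; steps = λ () }
  walk {R = R} {s} {x} (edge∷ {vs = vs} e p x∉) = record
    { len = suc len ; verts = verts′ ; start = refl ; end = end
    ; in-vs = λ { F.zero → here refl ; (F.suc j) → there (in-vs j) } ; inj = inj′ ; steps = steps′ }
    where
    open Walk (walk p)
    verts′ : Fin (suc (suc len)) → _
    verts′ F.zero    = x
    verts′ (F.suc j) = verts j
    inj′ : ∀ i j → verts′ i ≡ verts′ j → i ≡ j
    inj′ F.zero    F.zero    q = refl
    inj′ F.zero    (F.suc j) q = ⊥-elim (x∉ (subst (_∈ vs) (sym q) (in-vs j)))
    inj′ (F.suc i) F.zero    q = ⊥-elim (x∉ (subst (_∈ vs) q (in-vs i)))
    inj′ (F.suc i) (F.suc j) q = cong F.suc (inj i j q)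
    steps′ : ∀ j → R (pat (toℕ j + s)) (verts′ (F.inject₁ j)) (verts′ (F.suc j))
    steps′ F.zero    = subst (R (pat s) x) (sym start) e
    steps′ (F.suc j) = subst (λ i → R (pat i) (verts (F.inject₁ j)) (verts (F.suc j))) (+-suc (toℕ j) s) (steps j)

module Hitting {n r : ℕ} (ℓ′ : ℕ) (other : (x : Fin n) → ∃ λ y → x ≢ y) (Π : Vec (Fin r) (suc ℓ′)) (dummy : Fin (Npairs n)) where

  open EdgeCode n
  open Code dummy
  open Pattern ℓ′ Π

  orderingOf : Vec (Fin N) N → Ordering n
  orderingOf π = Vec.map (edge n) π

  orderingOf-valid : ∀ {π} → IsPerm π → ValidOrdering n (orderingOf π)
  orderingOf-valid {π} perm =
    (λ k → subst (λ p → proj₁ p F.< proj₂ p) (sym (lookup-map k (edge n) π)) (edge-< (lookup π k))) ,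
    (λ a b a<b → let (e , q) = code a<b in
      pos π e , trans (lookup-map (pos π e) (edge n) π) (trans (cong (edge n) (lookup-pos perm e)) q))

  orderingOf-injective : ∀ {π π′} → orderingOf π ≡ orderingOf π′ → π ≡ π′
  orderingOf-injective {π} {π′} e = map-injective π π′ edge-injective e

  module Run {π : Vec (Fin N) N} (perm : IsPerm π) (c : Coloring n r) (G : Fin N → ℕ)
    (G-mono : ∀ p q → p F.< q → G p < G q) (a b : ℕ)
    (lonely : ∃ λ x → ∀ v → x ≢ v → a ≤ G (pos π (E x v)))
    (soon : ∀ x → ∃ λ v → x ≢ v × G (pos π (E x v)) < b) where

    σ : Ordering n
    σ = orderingOf π

    G-reflects : ∀ {p q} → G p < G q → p F.< q
    G-reflects {p} {q} lt with F.<-cmp p q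
    ... | tri< p<q _ _  = p<q
    ... | tri≈ _ refl _ = ⊥-elim (<-irrefl refl lt)
    ... | tri> _ _ q<p  = ⊥-elim (<-asym lt (G-mono q p q<p))

    σ-at : ∀ p → lookup σ p ≡ edge n (lookup π p)
    σ-at p = lookup-map p (edge n) π

    joins⇒ : ∀ {p u v} → Joins (lookup σ p) u v → u ≢ v × lookup π p ≡ E u v
    joins⇒ {p} {u} {v} j = by-side j refl
      where
      lt : proj₁ (lookup σ p) F.< proj₂ (lookup σ p)
      lt = proj₁ (orderingOf-valid perm) p
      by-side : Joins (lookup σ p) u v → ∀ {q} → lookup σ p ≡ q → u ≢ v × lookup π p ≡ E u v
      by-side (inj₁ (refl , refl)) _ = (λ e → <-irrefl (cong toℕ e) lt) , edge⇒E (sym (σ-at p))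
      by-side (inj₂ (refl , refl)) _ = (λ e → <-irrefl (cong toℕ (sym e)) lt) , trans (edge⇒E (sym (σ-at p))) (E-sym (proj₁ (lookup σ p)) (proj₂ (lookup σ p)))

    ⇒joins : ∀ {u v} → u ≢ v → Joins (lookup σ (pos π (E u v))) u v
    ⇒joins {u} {v} u≢v = by-side (E-joins u≢v)
      where
      at : lookup σ (pos π (E u v)) ≡ edge n (E u v)
      at = trans (σ-at _) (cong (edge n) (lookup-pos perm (E u v)))
      by-side : edge n (E u v) ≡ (u , v) ⊎ edge n (E u v) ≡ (v , u) → Joins (lookup σ (pos π (E u v))) u v
      by-side (inj₁ q) = inj₁ (cong proj₁ (trans at q) , cong proj₂ (trans at q))
      by-side (inj₂ q) = inj₂ (cong proj₁ (trans at q) , cong proj₂ (trans at q))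

    endpoint⇒ : ∀ {p x} → Endpoint x (lookup σ p) → ∃ λ v → Joins (lookup σ p) x v
    endpoint⇒ {p} (inj₁ e) = proj₂ (lookup σ p) , inj₁ (e , refl)
    endpoint⇒ {p} (inj₂ e) = proj₁ (lookup σ p) , inj₂ (refl , e)

    joins⇒endpoint : ∀ q {x v} → Joins (lookup σ q) x v → Endpoint x (lookup σ q)
    joins⇒endpoint q (inj₁ (e , _)) = inj₁ e
    joins⇒endpoint q (inj₂ (_ , e)) = inj₂ e

    joins-sym : ∀ q {u v} → Joins (lookup σ q) u v → Joins (lookup σ q) v u
    joins-sym q (inj₁ e) = inj₂ e
    joins-sym q (inj₂ e) = inj₁ e

    minDeg1? : ∀ i → Dec (MinDeg1 n σ i)
    minDeg1? i = F.all? λ x → F.any? λ k → (toℕ k <? i) ×-dec ((proj₁ (lookup σ k) F.≟ x) ⊎-dec (proj₂ (lookup σ k) F.≟ x))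

    minDeg1-N : MinDeg1 n σ N
    minDeg1-N x = let (y , x≢y) = other x in pos π (E x y) , F.toℕ<n _ , joins⇒endpoint (pos π (E x y)) (⇒joins x≢y)

    hitting : ∃ λ i → i ≤ N × MinDeg1 n σ i × (∀ j → j < i → ¬ MinDeg1 n σ j)
    hitting = ≤-minimal (MinDeg1 n σ) minDeg1? N minDeg1-N

    τ₁ : ℕ
    τ₁ = proj₁ hitting
    τ₁-hit : MinDeg1 n σ τ₁
    τ₁-hit = proj₁ (proj₂ (proj₂ hitting))
    τ₁-least : ∀ j → j < τ₁ → ¬ MinDeg1 n σ j
    τ₁-least = proj₂ (proj₂ (proj₂ hitting))

    -- An isolated vertex at time a forces τ₁ to be later than all times below a.
    early-present : ∀ p → G p < a → toℕ p < τ₁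
    early-present p Gp<a =
      let (x , late) = lonely
          (k , k<τ , ep) = τ₁-hit x
          (v , jn) = endpoint⇒ {k} ep
          (x≢v , πk) = joins⇒ {k} jn
          a≤Gk = subst (λ q → a ≤ G q) (trans (cong (pos π) (sym πk)) (pos-lookup perm k)) (late v x≢v)
      in <-trans (G-reflects (<-≤-trans Gp<a a≤Gk)) k<τ

    -- Were an edge of time at least `b` present, every vertex would already have an edge before it,
    -- and `τ₁` would have been reached earlier.
    present-soon : ∀ p → toℕ p < τ₁ → G p < b
    present-soon p p<τ = ≰⇒> λ b≤Gp → τ₁-least (toℕ p) p<τ λ x →
      let (v , x≢v , Gv<b) = soon x in
      pos π (E x v) , G-reflects (<-≤-trans Gv<b b≤Gp) , joins⇒endpoint (pos π (E x v)) (⇒joins x≢v)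

    R : Fin r → Fin n → Fin n → Set
    R col u v = Σ (Fin N) λ p → toℕ p < τ₁ × Joins (lookup σ p) u v × lookup c p ≡ col

    R-sym : ∀ {col u v} → R col u v → R col v u
    R-sym (p , p<τ , j , e) = p , p<τ , joins-sym p j , e

    R? : ∀ u v → Dec (∃ λ col → R col u v)
    R? u v = map′ (λ (p , p<τ , j) → lookup c p , p , p<τ , j , refl) (λ (_ , p , p<τ , j , _) → p , p<τ , j)
      (F.any? λ p → (toℕ p <? τ₁) ×-dec (((proj₁ (lookup σ p) F.≟ u) ×-dec (proj₂ (lookup σ p) F.≟ v)) ⊎-dec ((proj₁ (lookup σ p) F.≟ v) ×-dec (proj₂ (lookup σ p) F.≟ u))))

    no-isolated : ∀ u → ∃ λ col → ∃ λ v → R col u v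
    no-isolated u = let (k , k<τ , ep) = τ₁-hit u ; (v , jn) = endpoint⇒ {k} ep in lookup c k , v , k , k<τ , jn , refl

    R-present : ∀ {u v} → u ≢ v → G (pos π (E u v)) < a → R (lookup c (pos π (E u v))) u v
    R-present {u} {v} u≢v lt = pos π (E u v) , early-present _ lt , ⇒joins u≢v , refl

    R⇒ : ∀ {col u v} → R col u v → u ≢ v × G (pos π (E u v)) < b
    R⇒ (p , p<τ , j , _) = let (u≢v , πp) = joins⇒ {p} j in
      u≢v , subst (λ q → G q < b) (trans (sym (pos-lookup perm p)) (cong (pos π) πp)) (present-soon p p<τ)

    toPiPath : ∀ {s x y vs} → PatPath R pat s x y vs → PiPath n Π σ c τ₁ x y
    toPiPath {s} p = record { len = len ; verts = verts ; inj = inj ; start = start ; end = end ; shift = s mod suc ℓ′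
      ; edge = λ j → let (q , q<τ , jn , col) = steps j in q , q<τ , jn , trans (pat-mod {toℕ j + toℕ (s mod suc ℓ′)} {toℕ j + s} (shifted j)) (sym col) }
      where
      open Walk (walk p)
      shifted : ∀ (j : Fin len) → (toℕ j + toℕ (s mod suc ℓ′)) % suc ℓ′ ≡ (toℕ j + s) % suc ℓ′
      shifted j = trans (cong (λ t → (toℕ j + t) % suc ℓ′) (F.toℕ-fromℕ< (m%n<n s (suc ℓ′))))
        (trans (%-distribˡ-+ (toℕ j) (s % suc ℓ′) (suc ℓ′))
        (trans (cong (λ t → (toℕ j % suc ℓ′ + t) % suc ℓ′) (m%n%n≡m%n s (suc ℓ′))) (sym (%-distribˡ-+ (toℕ j) s (suc ℓ′)))))

    trivial : ∀ x → PiPath n Π σ c τ₁ x x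
    trivial x = record { len = 0 ; verts = λ _ → x ; inj = λ { F.zero F.zero _ → refl } ; start = refl ; end = refl
                       ; shift = F.zero ; edge = λ () }

    -- A path to another vertex has a first edge. Hence connectedness cannot precede `τ₁`, and only
    -- connectedness at `τ₁` remains to be shown.
    connected⇒minDeg1 : ∀ i → PiConnected n Π σ c i → MinDeg1 n σ i
    connected⇒minDeg1 i conn x = let (y , x≢y) = other x in first x≢y (conn x y)
      where
      first : ∀ {y} → x ≢ y → PiPath n Π σ c i x y → ∃ λ k → toℕ k < i × Endpoint x (lookup σ k)
      first x≢y record { len = zero ; start = s ; end = e } = ⊥-elim (x≢y (trans (sym s) e))
      first x≢y record { len = suc _ ; verts = vs ; start = s ; edge = edge } = let (q , q<i , jn , _) = edge F.zero in
        q , q<i , joins⇒endpoint q (subst (λ z → Joins (lookup σ q) z (vs (F.suc F.zero))) s jn)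

    good : (∀ x y → x ≢ y → ∃ λ s → ∃ λ vs → PatPath R pat s x y vs) → GoodEvent n Π (σ , c)
    good conn = τ₁ , (proj₁ (proj₂ hitting) , τ₁-hit , τ₁-least) ,
      (proj₁ (proj₂ hitting) , all-joined , λ j j<τ pc → τ₁-least j j<τ (connected⇒minDeg1 j pc))
      where
      joined-by : ∀ {x y} → Dec (x ≡ y) → PiPath n Π σ c τ₁ x y
      joined-by (yes refl) = trivial _
      joined-by (no x≢y)   = toPiPath (proj₂ (proj₂ (conn _ _ x≢y)))
      all-joined : PiConnected n Π σ c τ₁
      all-joined x y = joined-by (x F.≟ y)

-- From labels to uniform orderings

allVecs-unique : {X : Set} {xs : List X} → Unique xs → ∀ n → Unique (allVecs xs n)
allVecs-unique u zero    = [] ∷ []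
allVecs-unique {X} {xs} u (suc n) = go xs u
  where
  vs = allVecs xs n
  go : ∀ ys → Unique ys → Unique (concatMap (λ y → map (y ∷_) vs) ys)
  go []       _        = []
  go (y ∷ ys) (y∉ ∷ v) = Unique.++⁺ (Unique-map (λ { _ _ refl → refl }) (allVecs-unique u n)) (go ys v) dis
    where
    dis : ∀ {w} → w ∈ map (y ∷_) vs × w ∈ concatMap (λ y → map (y ∷_) vs) ys → ⊥
    dis (p , q) with ∈-map⁻ (y ∷_) p | ∈-concatMap⁻ (λ y → map (y ∷_) vs) ys q
    ... | _ , _ , refl | z , z∈ , q′ with ∈-map⁻ (z ∷_) q′
    ...   | _ , _ , refl = All.lookup y∉ z∈ refl

-- Transfer from independent labels to the uniform ordering: an outcome is kept if some increasing
-- sequence of times turns it into a labelling of weight β = 0.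
module Transfer {N r M : ℕ} (M≥1 : 1 ≤ M) (β : Vec (Fin M × Fin r) N → ℕ) (k : ℕ)
  (few-collisions : M ^ N ≤ 2 * (N ! * length (increasing N M)))
  (bound : 2 * suc k * ∑ (allVecs (cartesianProduct (allFin M) (allFin r)) N) β ≤
           ∑ (allVecs (cartesianProduct (allFin M) (allFin r)) N) (λ _ → 1)) where

  Λs = cartesianProduct (allFin M) (allFin r)
  Ω = allVecs Λs N
  times = increasing N M

  Outcome : Set
  Outcome = Vec (Fin N) N × Vec (Fin r) N

  outcomes : List Outcome
  outcomes = cartesianProduct (perms N) (allVecs (allFin r) N)

  labelling : Outcome × Vec (Fin M) N → Vec (Fin M × Fin r) N
  labelling ((π , c) , g) = encode π c g

  -- One suitable sequence of times is enough, because the event depends on the ordering and the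
  -- colours only.
  Kept : Outcome → Set
  Kept o = Any.Any (λ g → β (labelling (o , g)) ≡ 0) times

  kept? : ∀ o → Dec (Kept o)
  kept? o = Any.any? (λ g → β (labelling (o , g)) ≟ 0) times

  kept : List Outcome
  kept = filter (λ o → ⌊ kept? o ⌋ Bool.≟ true) outcomes

  outcomes-unique : Unique outcomes
  outcomes-unique = Unique.cartesianProduct⁺ (perms-unique N) (allVecs-unique (Unique.allFin⁺ r) N)

  kept-unique : Unique kept
  kept-unique = Unique.filter⁺ _ outcomes-unique

  ∈-kept⁻ : ∀ {π c} → (π , c) ∈ kept → IsPerm π × ∃ λ g → Increasing g × β (encode π c g) ≡ 0
  ∈-kept⁻ {π} {c} o∈ with ∈-filter⁻ (λ o → ⌊ kept? o ⌋ Bool.≟ true) {xs = outcomes} o∈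
  ... | p , q with find (⌊⌋-true⁻ (kept? (π , c)) q)
  ...   | g , g∈ , z = ∈-perms⇒ N (proj₁ (∈-cartesianProduct⁻ (perms N) _ p)) , g , ∈-increasing⇒ N M g∈ , z

  #outcomes : length outcomes ≡ N ! * r ^ N
  #outcomes = trans (length-cartesianProduct (perms N) (allVecs (allFin r) N))
    (cong₂ _*_ (length-perms N) (trans (length-allVecs (allFin r) N) (cong (_^ N) (length-allFin r))))

  open ≤-Reasoning

  labelled≤ : ∑ outcomes (λ o → ∑ times (λ g → β (labelling (o , g)))) ≤ ∑ Ω β
  labelled≤ = begin
    ∑ outcomes (λ o → ∑ times (λ g → β (labelling (o , g)))) ≡⟨ ∑-cartesianProduct outcomes times (β ∘ labelling) ⟨
    ∑ (cartesianProduct outcomes times) (β ∘ labelling) ≤⟨ ∑-inject (cartesianProduct outcomes times) Ω labelling β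
                                                                   (Unique.cartesianProduct⁺ outcomes-unique (increasing-unique N M)) inj (λ _ → ∈-allVecs _ (λ i → ∈-cartesianProduct⁺ (∈-allFin _) (∈-allFin _))) ⟩
    ∑ Ω β ∎
    where
    parts : ∀ {o} → o ∈ cartesianProduct outcomes times → IsPerm (proj₁ (proj₁ o)) × Increasing (proj₂ o)
    parts p = let (q , g∈) = ∈-cartesianProduct⁻ outcomes times p in
      ∈-perms⇒ N (proj₁ (∈-cartesianProduct⁻ (perms N) (allVecs (allFin r) N) q)) , ∈-increasing⇒ N M g∈
    inj : ∀ {o o′} → o ∈ cartesianProduct outcomes times → o′ ∈ cartesianProduct outcomes times → labelling o ≡ labelling o′ → o ≡ o′
    inj {(π , c) , g} {(π′ , c′) , g′} p p′ e =
      let (perm , inc) = parts p ; (perm′ , inc′) = parts p′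
          (π≡ , c≡ , g≡) = encode-injective {π = π} {π′} {c} {c′} {g} {g′} perm perm′ inc inc′ e
      in cong₂ _,_ (cong₂ _,_ π≡ c≡) g≡

  -- Markov's inequality: an outcome that is not kept contributes at least 1 to the sum of `β` for
  -- each of its sequences of times.
  count : length outcomes * length times ≤ length kept * length times + ∑ Ω β
  count = begin
    length outcomes * length times
      ≡⟨ ∑-const outcomes (length times) ⟨
    ∑ outcomes (λ _ → length times)
      ≤⟨ ∑-mono outcomes pointwise ⟩
    ∑ outcomes (λ o → χ ⌊ kept? o ⌋ * length times + ∑ times (λ g → β (labelling (o , g))))
      ≡⟨ ∑-+ outcomes (λ o → χ ⌊ kept? o ⌋ * length times) (λ o → ∑ times (λ g → β (labelling (o , g)))) ⟩
    ∑ outcomes (λ o → χ ⌊ kept? o ⌋ * length times) + ∑ outcomes (λ o → ∑ times (λ g → β (labelling (o , g))))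
      ≤⟨ +-mono-≤ (≤-reflexive (trans (∑-*ʳ outcomes (λ o → χ ⌊ kept? o ⌋) (length times)) (cong (_* length times) (sym (length-filter-χ (λ o → ⌊ kept? o ⌋) outcomes))))) labelled≤ ⟩
    length kept * length times + ∑ Ω β ∎
    where
    pointwise : ∀ o → length times ≤ χ ⌊ kept? o ⌋ * length times + ∑ times (λ g → β (labelling (o , g)))
    pointwise o with kept? o
    ... | yes _ = ≤-trans (≤-reflexive (sym (+-identityʳ _))) (m≤m+n _ _)
    ... | no ¬k = ≤-trans (≤-reflexive (length≡∑1 times)) (∑-mono-∈ times λ g g∈ → n≢0⇒n>0 (λ z → ¬k (lose g∈ z)))

  -- The injective labellings number P G, at least half of all labellings. A total weight of at most
  -- 1/(2 (k + 1)) of all labellings is thus at most 1/(k + 1) of the injective ones.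
  enough : k * (N ! * r ^ N) ≤ suc k * length kept
  enough = *-cancelʳ-≤ _ _ G {{G≢0}} (+-cancelˡ-≤ (P * G) _ _ (begin
    P * G + k * P * G ≡⟨ e₁ P G k ⟩
    suc k * (P * G) ≤⟨ *-monoʳ-≤ (suc k) (subst (λ z → z * G ≤ l * G + ∑ Ω β) #outcomes count) ⟩
    suc k * (l * G + ∑ Ω β) ≡⟨ e₂ k l G (∑ Ω β) ⟩
    suc k * ∑ Ω β + suc k * l * G ≤⟨ +-monoˡ-≤ (suc k * l * G) half ⟩
    P * G + suc k * l * G ∎))
    where
    G l P : ℕ
    G = length times
    l = length kept
    P = N ! * r ^ N
    G≢0 : NonZero G
    G≢0 = ≢-nonZero λ G≡0 → <⇒≱ (n≢0⇒n>0 (≢-nonZero⁻¹ (M ^ N) {{^-pos M N {{>-nonZero M≥1}}}}))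
      (≤-trans few-collisions (≤-reflexive (trans (cong (λ z → 2 * (N ! * z)) G≡0) (cong (2 *_) (*-zeroʳ (N !))))))
    half : suc k * ∑ Ω β ≤ P * G
    half = *-cancelˡ-≤ 2 (begin
      2 * (suc k * ∑ Ω β) ≡⟨ *-assoc 2 (suc k) (∑ Ω β) ⟨
      2 * suc k * ∑ Ω β ≤⟨ bound ⟩
      ∑ Ω (λ _ → 1) ≡⟨ trans (sym (length≡∑1 Ω)) (trans (length-allVecs Λs N) (cong (_^ N)
                                             (trans (length-cartesianProduct (allFin M) (allFin r)) (cong₂ _*_ (length-allFin M) (length-allFin r))))) ⟩
      (M * r) ^ N ≡⟨ ^-distrib-* M r N ⟩
      M ^ N * r ^ N ≤⟨ *-monoˡ-≤ (r ^ N) few-collisions ⟩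
      2 * (N ! * G) * r ^ N ≡⟨ e₃ (N !) G (r ^ N) ⟩
      2 * (P * G) ∎)
      where
      e₃ : ∀ a g b → 2 * (a * g) * b ≡ 2 * (a * b * g)
      e₃ = solve-∀
    e₁ : ∀ p g k → p * g + k * p * g ≡ suc k * (p * g)
    e₁ = solve-∀
    e₂ : ∀ k l g b → suc k * (l * g + b) ≡ suc k * b + suc k * l * g
    e₂ = solve-∀

-- Assembling the process and the theorem

<ᵇ-false : ∀ a b → (a <ᵇ b) ≡ false → b ≤ a
<ᵇ-false a b e = ≮⇒≥ λ lt → subst Bool.T e (<⇒<ᵇ lt)

<ᵇ-true : ∀ a b → (a <ᵇ b) ≡ true → a < b
<ᵇ-true a b e = <ᵇ⇒< a b (subst Bool.T (sym e) _)

true-<ᵇ : ∀ {a b} → a < b → (a <ᵇ b) ≡ true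
true-<ᵇ {a} {b} lt = T⇒true (<⇒<ᵇ lt)
  where
  T⇒true : ∀ {x} → Bool.T x → x ≡ true
  T⇒true {true} _ = refl

module Process (k r ℓ′ : ℕ) (r≥1 : 1 ≤ r) (n n′ n″ : ℕ) (n≡ : n ≡ suc n′) (n′≡ : n′ ≡ suc n″)
  (sc : Scale (Parameters.X₀ k r ℓ′ r≥1) (Parameters.e k r ℓ′ r≥1) (Parameters.Z k r ℓ′ r≥1) n′)
  (n-large : Parameters.large k r ℓ′ r≥1 ≤ n) (other : (x : Fin n) → ∃ λ y → x ≢ y) (dummy : Fin (Npairs n))
  (Π : Vec (Fin r) (suc ℓ′)) (onto : ∀ c → ∃ λ j → lookup Π j ≡ c) where

  open EdgeCode n
  open Code dummy

  m : ℕ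
  -- With M ≥ 2 N² times, at least half of the labellings are injective; the summand N gives N ≤ M
  -- also for small N.
  m = suc (2 * (N * N) + N)

  module Ev = Events k r ℓ′ r≥1 n n′ n″ n≡ n′≡ sc n-large m N (s≤s z≤n) E E-sym E-inj
  module Hit = Hitting {n} {r} ℓ′ other Π dummy
  open Pattern ℓ′ Π

  m≤M : m ≤ Ev.M
  m≤M = m≤m+n m _

  few-collisions : Ev.M ^ N ≤ 2 * (N ! * length (increasing N Ev.M))
  few-collisions = functions≤2injections N Ev.M (≤-trans (≤-trans (m≤m+n _ N) (n≤1+n _)) m≤M) (≤-trans (≤-trans (m≤n+m N _) (n≤1+n _)) m≤M)

  module Tr = Transfer {N} {r} {Ev.M} (≤-trans (s≤s z≤n) m≤M) Ev.β k few-collisions Ev.β-bound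

  module Good (π : Vec (Fin N) N) (c : Vec (Fin r) N) (g : Vec (Fin Ev.M) N) (perm : IsPerm π) (inc : Increasing g)
              (zero-β : Ev.β (encode π c g) ≡ 0) where

    f : Ev.Labelling
    f = encode π c g

    zero₅ = m+n≡0⇒n≡0 (Ev.β₁ f + Ev.β₂ f + Ev.β₃A f + Ev.β₃B f + Ev.β₄ f) zero-β
    sum₄ = m+n≡0⇒m≡0 (Ev.β₁ f + Ev.β₂ f + Ev.β₃A f + Ev.β₃B f + Ev.β₄ f) zero-β
    zero₄ = m+n≡0⇒n≡0 (Ev.β₁ f + Ev.β₂ f + Ev.β₃A f + Ev.β₃B f) sum₄
    sum₃ = m+n≡0⇒m≡0 (Ev.β₁ f + Ev.β₂ f + Ev.β₃A f + Ev.β₃B f) sum₄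
    zero₃B = m+n≡0⇒n≡0 (Ev.β₁ f + Ev.β₂ f + Ev.β₃A f) sum₃
    sum₂ = m+n≡0⇒m≡0 (Ev.β₁ f + Ev.β₂ f + Ev.β₃A f) sum₃
    zero₃A = m+n≡0⇒n≡0 (Ev.β₁ f + Ev.β₂ f) sum₂
    sum₁ = m+n≡0⇒m≡0 (Ev.β₁ f + Ev.β₂ f) sum₂
    zero₂ = m+n≡0⇒n≡0 (Ev.β₁ f) sum₁
    zero₁ = m+n≡0⇒m≡0 (Ev.β₁ f) sum₁

    G : Fin N → ℕ
    G p = toℕ (lookup g p)

    at : ∀ e → lookup f e ≡ (lookup g (pos π e) , lookup c (pos π e))
    at = lookup-encode π c g

    lonely : ∃ λ x → ∀ v → x ≢ v → m ≤ G (pos π (E x v))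
    lonely = let (x , late) = Ev.β₁-zero f zero₁ in
      x , λ v x≢v → <ᵇ-false (G (pos π (E x v))) m (trans (cong Ev.earlyᵇ (sym (at (E x v)))) (late v x≢v))

    soon : ∀ x → ∃ λ v → x ≢ v × G (pos π (E x v)) < 2 * m
    soon x = let (v , x≢v , sn) = Ev.β₂-zero f zero₂ x in
      v , x≢v , <ᵇ-true (G (pos π (E x v))) (2 * m) (trans (cong Ev.soonᵇ (sym (at (E x v)))) sn)

    module H = Hit.Run {π} perm c G inc m (2 * m) lonely soon

    adj⇒R : ∀ col u v → Ev.adjOf f col u v ≡ true → H.R col u v
    adj⇒R col u v a =
      let (u≢v , has) = Ev.adjOf⁻ f col u v a
          (ea , eq) = ∧-true⁻ (Ev.earlyᵇ (lookup g (pos π (E u v)) , lookup c (pos π (E u v)))) (trans (cong (Ev.hasᵇ col) (sym (at (E u v)))) has)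
      in subst (λ z → H.R z u v) (sym (⌊⌋-true⁻ (col F.≟ lookup c (pos π (E u v))) eq))
           (H.R-present u≢v (<ᵇ-true (G (pos π (E u v))) m ea))

    R⇒ : ∀ {col u v} → H.R col u v → u ≢ v × Ev.Soon f u v
    R⇒ {col} {u} {v} p = let (u≢v , lt) = H.R⇒ {col} {u} {v} p in u≢v , trans (cong Ev.soonᵇ (at (E u v))) (true-<ᵇ lt)

    event : GoodEvent n Π (Hit.orderingOf π , c)
    event = H.good (Ev.Connected.connected f zero₃A zero₃B zero₄ zero₅ pat (λ {i j} → pat-mod {i} {j}) (pat-onto onto)
      H.R (λ {col u v} → H.R-sym {col} {u} {v}) adj⇒R (λ {col u v} → R⇒ {col} {u} {v}) H.R? H.no-isolated)

  likely : ProbAtLeast n r (GoodEvent n Π) k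
  likely = map out Tr.kept ,
    Unique-map (λ {o} {o′} _ _ e → cong₂ _,_ (Hit.orderingOf-injective (cong proj₁ e)) (cong proj₂ e)) Tr.kept-unique ,
    Allₚ.map⁺ (All.tabulate (λ {o} o∈ → let (perm , g , inc , z) = Tr.∈-kept⁻ o∈ in
      Hit.orderingOf-valid perm , Good.event (proj₁ o) (proj₂ o) g perm inc z)) ,
    ≤-trans Tr.enough (≤-reflexive (cong (suc k *_) (sym (length-map out Tr.kept))))
    where
    out : Tr.Outcome → Ordering n × Coloring n r
    out (π , c) = Hit.orderingOf π , c

other-vertex : ∀ {n} (x : Fin (suc (suc n))) → ∃ λ y → x ≢ y
other-vertex F.zero    = F.suc F.zero , λ ()
other-vertex (F.suc _) = F.zero , λ ()

theorem2 : (r ℓ : ℕ) → 1 ≤ r → 2 ≤ ℓ → (Π : Vec (Fin r) ℓ) →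
    ((col : Fin r) → ∃ λ (j : Fin ℓ) → lookup Π j ≡ col) →
    (k : ℕ) → ∃ λ (n₀ : ℕ) → (n : ℕ) → n₀ ≤ n → ℓ ∣ n →
    ProbAtLeast n r (GoodEvent n Π) k
theorem2 r (suc ℓ′) r≥1 (s≤s _) Π onto k = 2 + (n₁ + large) , at
  where
  open Parameters k r ℓ′ r≥1
  n₁ : ℕ
  n₁ = proj₁ (threshold X₀ e₂ Z X₀≥1 e₂≥1 Z≥₁)
  at : ∀ n → 2 + (n₁ + large) ≤ n → suc ℓ′ ∣ n → ProbAtLeast n r (GoodEvent n Π) k
  -- Two vertices are split off from n: they provide the edge for `dummy` and a vertex other than
  -- any given one.
  at (suc (suc n)) (s≤s (s≤s le)) _ = Process.likely k r ℓ′ r≥1 (2 + n) (1 + n) n refl refl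
    (toScale e≥2 (proj₂ (threshold X₀ e₂ Z X₀≥1 e₂≥1 Z≥₁) (1 + n) (≤-trans (m≤m+n n₁ large) (≤-trans le (n≤1+n n)))))
    (≤-trans (m≤n+m large n₁) (≤-trans le (≤-trans (n≤1+n n) (n≤1+n (1 + n)))))
    other-vertex (proj₁ (EdgeCode.code (2 + n) {F.zero} {F.suc F.zero} (s≤s z≤n))) Π onto
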